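{- Let $q$ be even, let $Q^+(5,q)$ be a hyperbolic (Klein) quadric in $\mathrm{PG}(5,q)$ with associated symplectic polarity $\zeta$, and let $\Pi$ be a $3$-dimensional subspace of $\mathrm{PG}(5,q)$ with $\Pi\cap Q^+(5,q)=Q^-(3,q)$ an elliptic quadric. Let $W(q)$ be the generalized quadrangle whose points are the points of $\Pi$ and whose lines are the lines of $\Pi$ meeting $Q^-(3,q)$ in exactly one point. For an ovoid $O\neq Q^-(3,q)$ of $W(q)$ define \[ H_O:=\Big(\bigcup_{x\in O\setminus Q^-(3,q)}\mathcal{C}_x\Big)\cup\big(Q^-(3,q)\setminus O\big), \] where for $x\in\Pi\setminus Q^-(3,q)$, $\pi_x$ is the plane of $\Pi$ containing all lines of $W(q)$ through $x$ and $\mathcal{C}_x:=\pi_x^\zeta\cap Q^+(5,q)$. Let $O_1,O_2$ be two ovoids of $W(q)$ distinct from $Q^-(3,q)$. Then the following are equivalent: (1) the hyperovals $H_{O_1}$ and $H_{O_2}$ are isomorphic, i.e. there is a collineation of $\mathrm{PG}(5,q)$ stabilizing $Q^+(5,q)$ and mapping $H_{O_1}$ to $H_{O_2}$; (2) there exists a collineation of $\Pi$ stabilizing $Q^-(3,q)$ and mapping $O_1$ to $O_2$.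
   Context: $Q^+(5,q)$ is the set of singular points of a nondegenerate quadratic form $Q$ of plus type on $V=\mathbb{F}_q^6$; $\zeta$ is the symplectic polarity of $\mathrm{PG}(5,q)$ associated with the bilinear form $B(v,w)=Q(v+w)-Q(v)-Q(w)$. An ovoid of $W(q)$ is a set of points of $\Pi$ meeting every line of $W(q)$ in exactly one point. For $x\in\Pi\setminus Q^-(3,q)$, $\pi_x$ meets $Q^-(3,q)$ in an irreducible conic and $\mathcal{C}_x$ is an irreducible conic of the plane $\pi_x^\zeta$. A hyperoval of $Q^+(5,q)$ is a nonempty set of points of $Q^+(5,q)$ meeting every line contained in $Q^+(5,q)$ in $0$ or $2$ points; $H_O$ is such a hyperoval. -}

module Defs where

open import Data.Nat using (ℕ; zero; suc)
open import Data.Fin using (Fin; zero; suc)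
open import Data.Product using (Σ; ∃; ∃-syntax; _×_; _,_)
open import Data.Sum using (_⊎_)
open import Relation.Nullary using (¬_)
open import Relation.Binary.PropositionalEquality using (_≡_; _≢_)
open import Algebra.Structures using (IsCommutativeRing)
open import Function.Bundles using (_↔_)

record FiniteField (q : ℕ) : Set₁ where
  infixl 6 _+_
  infixl 7 _*_
  field
    Carrier : Set
    _+_ _*_ : Carrier → Carrier → Carrier
    -_ : Carrier → Carrier
    0# 1# : Carrier
    isCommutativeRing : IsCommutativeRing _≡_ _+_ _*_ -_ 0# 1#
    0≢1 : 0# ≢ 1#
    inverse : ∀ x → x ≢ 0# → ∃[ y ] (x * y ≡ 1#)
    enumeration : Fin q ↔ Carrier

_⟺_ : ∀ {a b} → Set a → Set b → Set _
A ⟺ B = (A → B) × (B → A)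

module Geometry {q : ℕ} (F : FiniteField q) where
  open FiniteField F

  V : ℕ → Set
  V n = Fin n → Carrier

  _≈_ : ∀ {n} → V n → V n → Set
  u ≈ v = ∀ i → u i ≡ v i

  0V : ∀ {n} → V n
  0V _ = 0#

  _⊕_ : ∀ {n} → V n → V n → V n
  (u ⊕ v) i = u i + v i

  _·_ : ∀ {n} → Carrier → V n → V n
  (a · v) i = a * v i

  infixl 6 _⊕_
  infixr 7 _·_

  sumF : ∀ n → (Fin n → Carrier) → Carrier
  sumF zero f = 0#
  sumF (suc n) f = f zero + sumF n (λ i → f (suc i))

  Matrix : ℕ → ℕ → Set
  Matrix n m = Fin n → Fin m → Carrier

  apply : ∀ {n m} → Matrix n m → V m → V n
  apply {n} {m} M v i = sumF m (λ j → M i j * v j)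

  Nonzero : ∀ {n} → V n → Set
  Nonzero v = ¬ (v ≈ 0V)

  -- u and v represent the same projective point.
  Proportional : ∀ {n} → V n → V n → Set
  Proportional u v = ∃[ a ] (a ≢ 0# × u ≈ (a · v))

  InSpan2 : ∀ {n} → V n → V n → V n → Set
  InSpan2 u v w = ∃[ a ] ∃[ b ] (w ≈ (a · u ⊕ b · v))

  Indep2 : ∀ {n} → V n → V n → Set
  Indep2 u v = ∀ a b → (a · u ⊕ b · v) ≈ 0V → a ≡ 0# × b ≡ 0#

  Indep3 : ∀ {n} → V n → V n → V n → Set
  Indep3 u v w = ∀ a b c → (a · u ⊕ b · v ⊕ c · w) ≈ 0V → a ≡ 0# × b ≡ 0# × c ≡ 0#

  -- A set of points of PG(n-1,q): a predicate on nonzero vectors, closed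
  -- under pointwise equality and nonzero scalars.
  PointSet : ∀ {n} → (V n → Set) → Set
  PointSet {n} S = (∀ v → S v → Nonzero v)
                 × (∀ u v → u ≈ v → S u → S v)
                 × (∀ a v → a ≢ 0# → S v → S (a · v))

  ExactlyOneOnLine : ∀ {n} → (V n → Set) → V n → V n → Set
  ExactlyOneOnLine S u v =
    ∃[ w ] (Nonzero w × InSpan2 u v w × S w
      × (∀ w' → Nonzero w' → InSpan2 u v w' → S w' → Proportional w' w))

  B : ∀ {n} → (V n → Carrier) → V n → V n → Carrier
  B Q u v = Q (u ⊕ v) + - (Q u) + - (Q v)

  IsQuadraticForm : ∀ n → (V n → Carrier) → Set
  IsQuadraticForm n Q = (∀ u v → u ≈ v → Q u ≡ Q v)
                      × (∀ a v → Q (a · v) ≡ a * a * Q v)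
                      × (∀ u v w → B Q (u ⊕ v) w ≡ B Q u w + B Q v w)
                      × (∀ a u w → B Q (a · u) w ≡ a * B Q u w)

  Nondegenerate : ∀ n → (V n → Carrier) → Set
  Nondegenerate n Q = ∀ v → (∀ w → B Q v w ≡ 0#) → v ≈ 0V

  PlusType6 : (V 6 → Carrier) → Set
  PlusType6 Q = IsQuadraticForm 6 Q × Nondegenerate 6 Q
              × ∃[ u₁ ] ∃[ u₂ ] ∃[ u₃ ] (Indep3 u₁ u₂ u₃
                  × (∀ a b c → Q (a · u₁ ⊕ b · u₂ ⊕ c · u₃) ≡ 0#))

  Elliptic4 : (V 4 → Carrier) → Set
  Elliptic4 Q = Nondegenerate 4 Q
              × (∃[ v ] (Nonzero v × Q v ≡ 0#))
              × ¬ (∃[ u ] ∃[ v ] (Indep2 u v × (∀ a b → Q (a · u ⊕ b · v) ≡ 0#)))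

  -- The GQ W(q) in Π ≅ PG(3,q) (coordinates F^4), with quadric Q' = Q|_Π.

  WLine : (V 4 → Carrier) → V 4 → V 4 → Set
  WLine Q' u v = Indep2 u v × ExactlyOneOnLine (λ w → Q' w ≡ 0#) u v

  IsOvoid : (V 4 → Carrier) → (V 4 → Set) → Set
  IsOvoid Q' O = PointSet O × (∀ u v → WLine Q' u v → ExactlyOneOnLine O u v)

  EqualsQuadric : (V 4 → Carrier) → (V 4 → Set) → Set
  EqualsQuadric Q' O = ∀ v → Nonzero v → (O v ⟺ (Q' v ≡ 0#))

  πplane : (V 4 → Carrier) → V 4 → V 4 → Set
  πplane Q' x z = Nonzero z × (Proportional z x ⊎ WLine Q' x z)

  -- C_x = π_x^ζ ∩ Q^+(5,q), where Π is the image of E.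
  Cx : (Q : V 6 → Carrier) → Matrix 6 4 → V 4 → V 6 → Set
  Cx Q E x y = Nonzero y × Q y ≡ 0#
             × (∀ z → πplane (λ w → Q (apply E w)) x z → B Q y (apply E z) ≡ 0#)

  H : (Q : V 6 → Carrier) → Matrix 6 4 → (V 4 → Set) → V 6 → Set
  H Q E O y =
      (∃[ x ] (O x × Q (apply E x) ≢ 0# × Cx Q E x y))
    ⊎ (∃[ x ] (Nonzero x × y ≈ apply E x × Q (apply E x) ≡ 0# × ¬ O x))

  -- Collineations of PG(n-1,q): maps induced by invertible semilinear maps
  -- v ↦ M σ(v), with σ a field automorphism.
  record FieldAut : Set where
    field
      σ σ⁻¹ : Carrier → Carrier
      σσ⁻¹ : ∀ x → σ (σ⁻¹ x) ≡ x
      σ⁻¹σ : ∀ x → σ⁻¹ (σ x) ≡ x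
      σ-+ : ∀ x y → σ (x + y) ≡ σ x + σ y
      σ-* : ∀ x y → σ (x * y) ≡ σ x * σ y
      σ-1 : σ 1# ≡ 1#

  record Collineation (n : ℕ) : Set where
    field
      aut : FieldAut
      M N : Matrix n n
      MN : ∀ v → apply M (apply N v) ≈ v
      NM : ∀ v → apply N (apply M v) ≈ v

    act : V n → V n
    act v = apply M (λ i → FieldAut.σ aut (v i))

  open Collineation public using (act)

  MapsStabilizing : ∀ n → (V n → Carrier) → (V n → Set) → (V n → Set) → Set
  MapsStabilizing n Q S₁ S₂ =
    ∃[ c ] ((∀ v → Nonzero v → ((Q v ≡ 0#) ⟺ (Q (act {n} c v) ≡ 0#)))
           × (∀ v → S₁ v ⟺ S₂ (act {n} c v)))

{-# OPTIONS --safe #-}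

-- Write L = Π^ζ, so that V = Π ⊥ L and Q is anisotropic on L.  A singular
-- point y = x + l (x ∈ Π, l ∈ L) lies in H_O iff either l ≠ 0 and x ∈ O, or
-- l = 0 and x ∉ O.
--
-- (2) ⇒ (1): a collineation of Π preserving Q⁻(3,q) multiplies Q|Π by a scalar
-- up to a field automorphism; since t ↦ t² + t has an image of index 2, it
-- extends to L with the same multiplier and the same automorphism.
--
-- (1) ⇒ (2): let Θ map H_{O₁} to H = H_{O₂}.  Both L and M = Θ(L) are "axes" of
-- H: all transvections with center on them preserve H, and the point sets on
-- L^ζ and M^ζ from which H arises contain no two perpendicular points.  Some
-- isometry preserving H takes M to L; composed with Θ it fixes L, hence Π, and
-- maps O₁ to O₂.  If M is not perpendicular to L, the isometry is a product of
-- transvections: for nonperpendicular centers u, v normalised by Q = 1, the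
-- transvection exchanging u and v also preserves H.  If M ⊥ L, it is the
-- isometry exchanging M and L and fixing (L + M)^ζ.
module Submission where

-- The obstacle in (1) ⇒ (2) is that nothing forces Θ to map L to L, so Θ need not respect Π. What
-- helps is that conjugating a transvection by an isometry preserving H gives another transvection
-- preserving H: the set of centers is closed under the group that its own transvections generate,
-- and this turns nonperpendicularity of centers into conjugacy. Since every field element has
-- exactly one square root, each nonsingular point has exactly one representative v with Q(v) = 1,
-- and its transvection is y ↦ y + B(y,v)v.
--
-- Axes are compared through bases on which Q takes prescribed values, the form being s² + sr + δr²
-- on each axis. A semisimilitude may change δ, but only by an element t² + t, which a change of
-- basis absorbs; so the index 2 of these elements serves both directions.
--
-- Ovoids are arbitrary predicates, without a decision procedure. A line of W(q) through a given
-- point supplies a point of the ovoid to compare with, so membership of nonzero vectors is stable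
-- under double negation, and so is membership in H. This licenses the arguments by contradiction.

open import Defs
open import Algebra.Bundles using (CommutativeRing; RawRing)
import Algebra.Properties.CommutativeMonoid.Sum as CMSum
import Algebra.Properties.Ring
import Algebra.Solver.Ring
open import Algebra.Solver.Ring.AlmostCommutativeRing
  using (AlmostCommutativeRing; fromCommutativeRing; _-Raw-AlmostCommutative⟶_; Induced-equivalence)
open import Algebra.Structures using (IsCommutativeRing)
open import Data.Bool using (Bool; true; false; _xor_; _∧_; if_then_else_)
open import Data.Empty using (⊥)
open import Data.Fin as Fin using (Fin; zero; suc; toℕ; finToFun; funToFin)
open import Data.Fin.Permutation using (permutation)
import Data.Fin.Properties as Finₚ
open import Data.Maybe using (just; nothing)
open import Data.Nat as ℕ using (ℕ; zero; suc)
open import Data.Nat.Divisibility using (_∣_; divides; ∣m+n∣m⇒∣n; ∣1⇒≡1)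
open import Data.Nat.GeneralisedArithmetic using (fold)
import Data.Nat.Properties as ℕₚ
open import Data.Product using (∃-syntax; _×_; _,_; proj₁; proj₂)
open import Data.Sum using (_⊎_; inj₁; inj₂)
open import Function.Bundles using (Inverse; mk↣)
open import Relation.Binary.Definitions using (DecidableEquality; WeaklyDecidable)
open import Relation.Binary.PropositionalEquality
  using (_≡_; _≢_; refl; sym; trans; cong; cong₂; subst; module ≡-Reasoning)
open import Relation.Nullary using (¬_; Dec; yes; no; does; contradiction)
open import Relation.Nullary.Decidable using (via-injection; map′; ¬?; _×-dec_; decidable-stable)

-- Finite orbits of injective maps replace all dimension counts below.
module Recurrence {A : Set} (_~_ : A → A → Set) {k : ℕ} (code : A → Fin k)
  (code-injective : ∀ {x y} → code x ≡ code y → x ~ y)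
  (f : A → A) (f-injective : ∀ {x y} → f x ~ f y → x ~ y) where

  cancel : ∀ m d x → fold x f m ~ fold x f (m ℕ.+ suc d) → x ~ f (fold x f d)
  cancel zero d x p = p
  cancel (suc m) d x p = cancel m d x (f-injective p)

  -- Two of the first `k + 1` iterates share a code, and injectivity pulls the coincidence back to
  -- `x`. In particular `x` has a preimage under `f`, namely `fold x f d`: this is how injective
  -- maps are shown to be surjective. The relation `_~_` is kept general because vectors are
  -- compared by `_≈_`.
  recurrent : ∀ x → ∃[ d ] (x ~ f (fold x f d))
  recurrent x with Finₚ.pigeonhole (ℕₚ.n<1+n k) (λ i → code (fold x f (toℕ i)))
  ... | i , j , i<j , eq with ℕₚ.m≤n⇒∃[o]m+o≡n i<j
  ... | d , i+d≡j = d , cancel (toℕ i) d x (code-injective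
        (trans eq (cong (λ m → code (fold x f m)) (sym (trans (ℕₚ.+-suc (toℕ i) d) i+d≡j)))))

-- Fixed points of an involution of a finite set, modulo 2.

private
  indicator : Bool → ℕ
  indicator b = if b then 1 else 0

  module Σℕ = CMSum ℕₚ.+-0-commutativeMonoid

  sum-delta : ∀ n (c : Fin n) → Σℕ.sum (λ i → indicator (does (i Finₚ.≟ c))) ≡ 1
  sum-delta (suc n) zero = cong suc (trans (Σℕ.sum-cong-≗ {n} {y = λ _ → 0} (λ _ → refl)) (Σℕ.sum-replicate-zero n))
  sum-delta (suc n) (suc c) = trans (Σℕ.sum-cong-≗ {n} (λ i → shift i)) (sum-delta n c)
    where
    shift : ∀ i → indicator (does (suc i Finₚ.≟ suc c)) ≡ indicator (does (i Finₚ.≟ c))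
    shift i with i Finₚ.≟ c
    ... | yes _ = refl
    ... | no _ = refl

  sum-one : ∀ n → Σℕ.sum {n} (λ _ → 1) ≡ n
  sum-one zero = refl
  sum-one (suc n) = cong suc (sum-one n)

-- The involution exchanges the indices below their image with those above it, so the two classes
-- have equal size; `c` is the one index left over, and `n` is odd.
involution-odd : ∀ {n} (τ : Fin n → Fin n) → (∀ i → τ (τ i) ≡ i) →
                 (c : Fin n) → τ c ≡ c → (∀ i → τ i ≡ i → i ≡ c) → ¬ 2 ∣ n
involution-odd {n} τ ττ c τc unique 2∣n with
    ∣1⇒≡1 (∣m+n∣m⇒∣n (subst (2 ∣_) total 2∣n) (divides (Σℕ.sum below) (trans (cong (Σℕ.sum below ℕ.+_) (sym (ℕₚ.+-identityʳ _))) (ℕₚ.*-comm 2 (Σℕ.sum below)))))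
  where
  below above fixed : Fin n → ℕ
  below i = indicator (does (i Finₚ.<? τ i))
  above i = indicator (does (τ i Finₚ.<? i))
  fixed i = indicator (does (i Finₚ.≟ c))

  split : ∀ i → 1 ≡ (below i ℕ.+ above i) ℕ.+ fixed i
  split i = cases (i Finₚ.<? τ i) (τ i Finₚ.<? i) (i Finₚ.≟ c)
    where
    cases : (p? : Dec (i Fin.< τ i)) (r? : Dec (τ i Fin.< i)) (e? : Dec (i ≡ c)) →
            1 ≡ (indicator (does p?) ℕ.+ indicator (does r?)) ℕ.+ indicator (does e?)
    cases (yes p) (yes r) _ = contradiction r (ℕₚ.<-asym p)
    cases (yes p) (no _) (yes refl) = contradiction (sym (cong toℕ τc)) (ℕₚ.<⇒≢ p)
    cases (yes p) (no _) (no _) = refl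
    cases (no _) (yes r) (yes refl) = contradiction (cong toℕ τc) (ℕₚ.<⇒≢ r)
    cases (no _) (yes r) (no _) = refl
    cases (no _) (no _) (yes _) = refl
    cases (no p) (no r) (no e) = contradiction (unique i (Finₚ.≤-antisym (ℕₚ.≮⇒≥ p) (ℕₚ.≮⇒≥ r))) e

  above≡below : Σℕ.sum above ≡ Σℕ.sum below
  above≡below = trans
    (Σℕ.sum-cong-≗ {n} (λ i → cong (λ j → indicator (does (τ i Finₚ.<? j))) (sym (ττ i))))
    (sym (Σℕ.sum-permute below (permutation τ τ ττ ττ)))

  total : n ≡ (Σℕ.sum below ℕ.+ Σℕ.sum below) ℕ.+ 1
  total = begin
    n ≡⟨ sym (sum-one n) ⟩
    Σℕ.sum {n} (λ _ → 1) ≡⟨ Σℕ.sum-cong-≗ {n} split ⟩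
    Σℕ.sum (λ i → (below i ℕ.+ above i) ℕ.+ fixed i) ≡⟨ Σℕ.∑-distrib-+ (λ i → below i ℕ.+ above i) fixed ⟩
    Σℕ.sum (λ i → below i ℕ.+ above i) ℕ.+ Σℕ.sum fixed ≡⟨ cong₂ ℕ._+_ (Σℕ.∑-distrib-+ below above) (sum-delta n c) ⟩
    (Σℕ.sum below ℕ.+ Σℕ.sum above) ℕ.+ 1 ≡⟨ cong (λ s → (Σℕ.sum below ℕ.+ s) ℕ.+ 1) above≡below ⟩
    (Σℕ.sum below ℕ.+ Σℕ.sum below) ℕ.+ 1 ∎
    where open ≡-Reasoning
... | ()

-- Finite fields of even order: characteristic 2, square roots, Artin-Schreier elements.

module EvenField {q : ℕ} (2∣q : 2 ∣ q) (F : FiniteField q) where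
  open FiniteField F public
  open IsCommutativeRing isCommutativeRing public
    using (+-assoc; +-comm; +-identityˡ; +-identityʳ; *-assoc; *-comm; *-identityˡ; *-identityʳ;
           distribˡ; distribʳ; zeroˡ; zeroʳ; -‿inverseʳ)

  commutativeRing : CommutativeRing _ _
  commutativeRing = record { isCommutativeRing = isCommutativeRing }

  module Ringₚ = Algebra.Properties.Ring (CommutativeRing.ring commutativeRing)

  index : Carrier → Fin q
  index = Inverse.from enumeration

  index-injective : ∀ {x y} → index x ≡ index y → x ≡ y
  index-injective {x} {y} eq = trans (sym (Inverse.strictlyInverseˡ enumeration x))
    (trans (cong (Inverse.to enumeration) eq) (Inverse.strictlyInverseˡ enumeration y))

  infix 4 _≟_
  _≟_ : DecidableEquality Carrier
  _≟_ = via-injection (mk↣ index-injective) Finₚ._≟_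

  any? : {P : Carrier → Set} → (∀ x → Dec (P x)) → Dec (∃[ x ] P x)
  any? {P} P? = map′ (λ (i , p) → Inverse.to enumeration i , p)
    (λ (x , p) → index x , subst P (sym (Inverse.strictlyInverseˡ enumeration x)) p)
    (Finₚ.any? (λ i → P? (Inverse.to enumeration i)))

  integral : ∀ {x y} → x ≢ 0# → x * y ≡ 0# → y ≡ 0#
  integral {x} {y} x≢0 xy≡0 with inverse x x≢0
  ... | x⁻¹ , xx⁻¹≡1 = begin
    y ≡⟨ sym (*-identityˡ y) ⟩
    1# * y ≡⟨ cong (_* y) (sym (trans (*-comm x⁻¹ x) xx⁻¹≡1)) ⟩
    (x⁻¹ * x) * y ≡⟨ *-assoc x⁻¹ x y ⟩
    x⁻¹ * (x * y) ≡⟨ cong (x⁻¹ *_) xy≡0 ⟩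
    x⁻¹ * 0# ≡⟨ zeroʳ x⁻¹ ⟩
    0# ∎
    where open ≡-Reasoning

  -- Otherwise negation, transported to `Fin q`, would be an involution fixing only the index of
  -- `0#`, and `q` would be odd.
  1+1≡0 : 1# + 1# ≡ 0#
  1+1≡0 = decidable-stable (1# + 1# ≟ 0#) λ 1+1≢0 →
    involution-odd negate negate-involutive (index 0#) (cong index (trans (cong -_ (strict 0#)) Ringₚ.-0#≈0#))
      (λ i eq → index-of i (fixed 1+1≢0 (Inverse.to enumeration i) (index-injective (trans eq (sym (Inverse.strictlyInverseʳ enumeration i)))))) 2∣q
    where
    strict = Inverse.strictlyInverseˡ enumeration
    negate : Fin q → Fin q
    negate i = index (- (Inverse.to enumeration i))
    negate-involutive : ∀ i → negate (negate i) ≡ i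
    negate-involutive i = trans (cong index (trans (cong -_ (strict _)) (Ringₚ.-‿involutive _)))
      (Inverse.strictlyInverseʳ enumeration i)
    index-of : ∀ i → Inverse.to enumeration i ≡ 0# → i ≡ index 0#
    index-of i eq = trans (sym (Inverse.strictlyInverseʳ enumeration i)) (cong index eq)
    fixed : 1# + 1# ≢ 0# → ∀ x → - x ≡ x → x ≡ 0#
    fixed 1+1≢0 x eq = integral 1+1≢0 (begin
      (1# + 1#) * x ≡⟨ distribʳ x 1# 1# ⟩
      1# * x + 1# * x ≡⟨ cong₂ _+_ (*-identityˡ x) (*-identityˡ x) ⟩
      x + x ≡⟨ cong (x +_) (sym eq) ⟩
      x + - x ≡⟨ -‿inverseʳ x ⟩
      0# ∎)
      where open ≡-Reasoning

  x+x≡0 : ∀ x → x + x ≡ 0#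
  x+x≡0 x = begin
    x + x ≡⟨ cong₂ _+_ (sym (*-identityˡ x)) (sym (*-identityˡ x)) ⟩
    1# * x + 1# * x ≡⟨ sym (distribʳ x 1# 1#) ⟩
    (1# + 1#) * x ≡⟨ cong (_* x) 1+1≡0 ⟩
    0# * x ≡⟨ zeroˡ x ⟩
    0# ∎
    where open ≡-Reasoning

  -x≡x : ∀ x → - x ≡ x
  -x≡x x = sym (Ringₚ.+-inverseˡ-unique x x (x+x≡0 x))

  private
    𝔽₂ : RawRing _ _
    𝔽₂ = record { Carrier = Bool ; _≈_ = _≡_ ; _+_ = _xor_ ; _*_ = _∧_ ; -_ = λ b → b ; 0# = false ; 1# = true }

    almostRing : AlmostCommutativeRing _ _
    almostRing = fromCommutativeRing commutativeRing

    embed : 𝔽₂ -Raw-AlmostCommutative⟶ almostRing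
    embed = record
      { ⟦_⟧ = λ b → if b then 1# else 0#
      ; +-homo = λ { true true → sym 1+1≡0 ; true false → sym (+-identityʳ 1#)
                   ; false true → sym (+-identityˡ 1#) ; false false → sym (+-identityˡ 0#) }
      ; *-homo = λ { true true → sym (*-identityˡ 1#) ; true false → sym (*-identityˡ 0#)
                   ; false true → sym (zeroˡ 1#) ; false false → sym (zeroˡ 0#) }
      ; -‿homo = λ { true → sym (-x≡x 1#) ; false → sym (-x≡x 0#) }
      ; 0-homo = refl
      ; 1-homo = refl
      }

    coefficient≟ : WeaklyDecidable (Induced-equivalence embed)
    coefficient≟ true true = just refl
    coefficient≟ false false = just refl
    coefficient≟ _ _ = nothing

  -- With 𝔽₂ coefficients the solver knows that the characteristic is 2.
  open Algebra.Solver.Ring 𝔽₂ almostRing embed coefficient≟ public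
    using (solve; _:+_; _:*_; con; _:=_; Polynomial)

  :0 :1 : ∀ {n} → Polynomial n
  :0 = con false
  :1 = con true

  sum-zero : ∀ {x y} → x + y ≡ 0# → x ≡ y
  sum-zero {x} {y} eq = begin
    x ≡⟨ solve 2 (λ x y → x := (x :+ y) :+ y) refl x y ⟩
    (x + y) + y ≡⟨ cong (_+ y) eq ⟩
    0# + y ≡⟨ +-identityˡ y ⟩
    y ∎
    where open ≡-Reasoning

  square-zero : ∀ {x} → x * x ≡ 0# → x ≡ 0#
  square-zero {x} eq with x ≟ 0#
  ... | yes x≡0 = x≡0
  ... | no x≢0 = integral x≢0 eq

  *-nonzero : ∀ {x y} → x ≢ 0# → y ≢ 0# → x * y ≢ 0#
  *-nonzero x≢0 y≢0 eq = y≢0 (integral x≢0 eq)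

  square-injective : ∀ {x y} → x * x ≡ y * y → x ≡ y
  square-injective {x} {y} eq = sum-zero (square-zero (begin
    (x + y) * (x + y) ≡⟨ solve 2 (λ x y → (x :+ y) :* (x :+ y) := x :* x :+ y :* y) refl x y ⟩
    x * x + y * y ≡⟨ cong (_+ y * y) eq ⟩
    y * y + y * y ≡⟨ x+x≡0 (y * y) ⟩
    0# ∎))
    where open ≡-Reasoning

  injective⇒surjective : (f : Carrier → Carrier) → (∀ {x y} → f x ≡ f y → x ≡ y) → ∀ y → ∃[ x ] f x ≡ y
  injective⇒surjective f f-injective y with Recurrence.recurrent _≡_ index index-injective f f-injective y
  ... | d , eq = fold y f d , sym eq

  -- Squaring is injective in characteristic 2 and hence bijective on a finite field. Every
  -- nonsingular vector can therefore be rescaled so that `Q` takes the value `1#`.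
  √ : Carrier → Carrier
  √ x = proj₁ (injective⇒surjective (λ y → y * y) square-injective x)

  √-square : ∀ x → √ x * √ x ≡ x
  √-square x = proj₂ (injective⇒surjective (λ y → y * y) square-injective x)

  √-nonzero : ∀ {x} → x ≢ 0# → √ x ≢ 0#
  √-nonzero {x} x≢0 eq = x≢0 (trans (sym (√-square x)) (trans (cong (_* √ x) eq) (zeroˡ (√ x))))

  inv : ∀ x → x ≢ 0# → Carrier
  inv x x≢0 = proj₁ (inverse x x≢0)

  inv-right : ∀ x (x≢0 : x ≢ 0#) → x * inv x x≢0 ≡ 1#
  inv-right x x≢0 = proj₂ (inverse x x≢0)

  inv-nonzero : ∀ x (x≢0 : x ≢ 0#) → inv x x≢0 ≢ 0#
  inv-nonzero x x≢0 eq = 0≢1 (trans (sym (zeroʳ x)) (trans (cong (x *_) (sym eq)) (inv-right x x≢0)))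

  -- The image of the Artin-Schreier map. An element δ lies outside it exactly when the binary form
  -- s² + sr + δr² is anisotropic.
  IsAS : Carrier → Set
  IsAS x = ∃[ t ] t * t + t ≡ x

  -- The elements t² + t form an additive subgroup of index 2.  Choose one
  -- element of each pair {t, t + 1}: adding δ to t² + t on the others makes
  -- t ↦ t² + t injective, hence surjective.
  AS-index : ∀ {δ ε} → ¬ IsAS δ → ¬ IsAS ε → IsAS (δ + ε)
  AS-index {δ} {ε} δ∉ ε∉ with injective⇒surjective shifted shifted-injective ε
    where
    lower? : ∀ t → Dec (index t Fin.< index (t + 1#))
    lower? t = index t Finₚ.<? index (t + 1#)

    pick : ∀ {t} → Dec (index t Fin.< index (t + 1#)) → Carrier
    pick {t} (yes _) = t * t + t
    pick {t} (no _) = t * t + t + δ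

    shifted : Carrier → Carrier
    shifted t = pick {t} (lower? t)

    expand : ∀ s t → (s + t) * (s + t) + (s + t) ≡ (s * s + s) + (t * t + t)
    expand = solve 2 (λ s t → (s :+ t) :* (s :+ t) :+ (s :+ t) := (s :* s :+ s) :+ (t :* t :+ t)) refl

    differ : ∀ {s t} → s * s + s ≡ t * t + t → s ≢ t → s ≡ t + 1#
    differ {s} {t} eq s≢t = sum-zero (trans (solve 2 (λ s t → s :+ (t :+ :1) := (s :+ t) :+ :1) refl s t)
      (integral {s + t} (λ z → s≢t (sum-zero z)) (begin
        (s + t) * ((s + t) + 1#) ≡⟨ solve 2 (λ s t → (s :+ t) :* ((s :+ t) :+ :1) := (s :* s :+ s) :+ (t :* t :+ t)) refl s t ⟩
        (s * s + s) + (t * t + t) ≡⟨ cong (_+ (t * t + t)) eq ⟩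
        (t * t + t) + (t * t + t) ≡⟨ x+x≡0 _ ⟩
        0# ∎)))
      where open ≡-Reasoning

    one-lower : ∀ {s t} → s ≡ t + 1# → index s Fin.< index (s + 1#) → ¬ (index t Fin.< index (t + 1#))
    one-lower {s} {t} refl s< t< = ℕₚ.<-asym t< (subst (λ r → index (t + 1#) Fin.< index r)
      (solve 1 (λ t → (t :+ :1) :+ :1 := t) refl t) s<)

    one-upper : ∀ {s t} → s ≡ t + 1# → ¬ index s Fin.< index (s + 1#) → ¬ ¬ (index t Fin.< index (t + 1#))
    one-upper {s} {t} refl s≮ t≮ = 0≢1 (begin
      0# ≡⟨ sym (x+x≡0 t) ⟩
      t + t ≡⟨ cong (t +_) (index-injective (Finₚ.≤-antisym (ℕₚ.≮⇒≥ s≮′) (ℕₚ.≮⇒≥ t≮))) ⟩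
      t + (t + 1#) ≡⟨ solve 1 (λ t → t :+ (t :+ :1) := :1) refl t ⟩
      1# ∎)
      where
      open ≡-Reasoning
      s≮′ : ¬ index (t + 1#) Fin.< index t
      s≮′ = subst (λ r → ¬ index (t + 1#) Fin.< index r) (solve 1 (λ t → (t :+ :1) :+ :1 := t) refl t) s≮

    +-cancel : ∀ {x y} → x + δ ≡ y + δ → x ≡ y
    +-cancel {x} {y} eq = trans (solve 2 (λ x d → x := (x :+ d) :+ d) refl x δ)
      (trans (cong (_+ δ) eq) (solve 2 (λ x d → (x :+ d) :+ d := x) refl y δ))

    -- The map t ↦ t² + t is additive, so a shifted value meeting an unshifted one would put `δ`
    -- itself in its image.
    mixed : ∀ {s t} → s * s + s ≡ t * t + t + δ → IsAS δ
    mixed {s} {t} eq = s + t , trans (expand s t) (trans (cong (_+ (t * t + t)) eq)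
      (solve 2 (λ x d → (x :+ d) :+ x := d) refl (t * t + t) δ))

    shifted-injective : ∀ {s t} → shifted s ≡ shifted t → s ≡ t
    shifted-injective {s} {t} eq = decidable-stable (s ≟ t) (cases (lower? s) (lower? t) eq)
      where
      cases : (ls : Dec (index s Fin.< index (s + 1#))) (lt : Dec (index t Fin.< index (t + 1#))) →
              pick ls ≡ pick lt → ¬ s ≢ t
      cases (yes ls) (yes lt) e s≢t = one-lower (differ e s≢t) ls lt
      cases (yes ls) (no lt) e s≢t = δ∉ (mixed e)
      cases (no ls) (yes lt) e s≢t = δ∉ (mixed (sym e))
      cases (no ls) (no lt) e s≢t = one-upper (differ (+-cancel e) s≢t) ls lt
  ... | t , eq with index t Finₚ.<? index (t + 1#)
  -- The value `ε` cannot be reached without the shift, so t² + t + δ = ε for the `t` found.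
  ...   | yes _ = contradiction (t , eq) ε∉
  ...   | no _ = t , trans (solve 2 (λ x d → x := d :+ (x :+ d)) refl (t * t + t) δ) (cong (δ +_) eq)

-- Linear and semilinear maps on coordinate vectors, without dimension theory.

module LinearAlgebra {q : ℕ} (2∣q : 2 ∣ q) (F : FiniteField q) where
  open EvenField 2∣q F public
  open Geometry F public

  ≈-refl : ∀ {n} {v : V n} → v ≈ v
  ≈-refl i = refl

  ≈-sym : ∀ {n} {u v : V n} → u ≈ v → v ≈ u
  ≈-sym p i = sym (p i)

  ≈-trans : ∀ {n} {u v w : V n} → u ≈ v → v ≈ w → u ≈ w
  ≈-trans p r i = trans (p i) (r i)

  ⊕-cong : ∀ {n} {u u′ v v′ : V n} → u ≈ u′ → v ≈ v′ → (u ⊕ v) ≈ (u′ ⊕ v′)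
  ⊕-cong p r i = cong₂ _+_ (p i) (r i)

  ·-cong : ∀ {n} {a b} {u v : V n} → a ≡ b → u ≈ v → (a · u) ≈ (b · v)
  ·-cong p r i = cong₂ _*_ p (r i)

  ⊕-zero : ∀ {n} {u v : V n} → (u ⊕ v) ≈ 0V → u ≈ v
  ⊕-zero p i = sum-zero (p i)

  infix 4 _≈?_
  _≈?_ : ∀ {n} (u v : V n) → Dec (u ≈ v)
  u ≈? v = Finₚ.all? (λ i → u i ≟ v i)

  Nonzero-cong : ∀ {n} {u v : V n} → u ≈ v → Nonzero u → Nonzero v
  Nonzero-cong u≈v u≢0 v≈0 = u≢0 (≈-trans u≈v v≈0)

  ·-zero : ∀ {n} {a} {v : V n} → a ≢ 0# → (a · v) ≈ 0V → v ≈ 0V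
  ·-zero a≢0 p i = integral a≢0 (p i)

  coefficient-zero : ∀ {n} {a} {v : V n} → Nonzero v → (a · v) ≈ 0V → a ≡ 0#
  coefficient-zero {a = a} v≢0 p = decidable-stable (a ≟ 0#) (λ a≢0 → v≢0 (·-zero a≢0 p))

  ·-inv : ∀ {n} {a} {u v : V n} (a≢0 : a ≢ 0#) → (a · u) ≈ v → u ≈ (inv a a≢0 · v)
  ·-inv {a = a} {u} {v} a≢0 p i = begin
    u i ≡⟨ sym (*-identityˡ (u i)) ⟩
    1# * u i ≡⟨ cong (_* u i) (sym (inv-right a a≢0)) ⟩
    (a * inv a a≢0) * u i ≡⟨ solve 3 (λ a b x → (a :* b) :* x := b :* (a :* x)) refl a (inv a a≢0) (u i) ⟩
    inv a a≢0 * (a * u i) ≡⟨ cong (inv a a≢0 *_) (p i) ⟩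
    inv a a≢0 * v i ∎
    where open ≡-Reasoning

  Proportional? : ∀ {n} (u v : V n) → Dec (Proportional u v)
  Proportional? u v = any? (λ a → ¬? (a ≟ 0#) ×-dec u ≈? (a · v))

  Proportional-sym : ∀ {n} {u v : V n} → Proportional u v → Proportional v u
  Proportional-sym (a , a≢0 , u≈av) = inv a a≢0 , inv-nonzero a a≢0 , ·-inv a≢0 (≈-sym u≈av)

  Proportional-trans : ∀ {n} {u v w : V n} → Proportional u v → Proportional v w → Proportional u w
  Proportional-trans {w = w} (a , a≢0 , p) (b , b≢0 , r) = a * b , *-nonzero a≢0 b≢0 ,
    λ i → trans (p i) (trans (cong (a *_) (r i)) (sym (*-assoc a b (w i))))

  Indep2-fromNonProportional : ∀ {n} {u v : V n} → Nonzero u → Nonzero v → ¬ Proportional u v → Indep2 u v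
  Indep2-fromNonProportional {u = u} {v} u≢0 v≢0 ¬prop a b p with a ≟ 0# | b ≟ 0#
  ... | yes refl | _ = refl , coefficient-zero v≢0 (λ i → trans (solve 2 (λ x y → y := :0 :* x :+ y) refl (u i) (b * v i)) (p i))
  ... | no a≢0 | yes refl = contradiction (coefficient-zero u≢0 (λ i → trans (solve 2 (λ x y → x := x :+ :0 :* y) refl (a * u i) (v i)) (p i))) a≢0
  ... | no a≢0 | no b≢0 = contradiction
    (inv a a≢0 * b , *-nonzero (inv-nonzero a a≢0) b≢0 ,
      λ i → trans (·-inv a≢0 (⊕-zero p) i) (sym (*-assoc _ b (v i)))) ¬prop

  Indep2-nonzeroˡ : ∀ {n} {u v : V n} → Indep2 u v → Nonzero u
  Indep2-nonzeroˡ {u = u} {v} ind u≈0 = 0≢1 (sym (proj₁ (ind 1# 0# (λ i →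
    trans (cong₂ (λ x y → x + y) (trans (*-identityˡ (u i)) (u≈0 i)) (zeroˡ (v i))) (+-identityˡ 0#)))))

  Indep2-nonzeroʳ : ∀ {n} {u v : V n} → Indep2 u v → Nonzero v
  Indep2-nonzeroʳ {u = u} {v} ind v≈0 = 0≢1 (sym (proj₂ (ind 0# 1# (λ i →
    trans (cong₂ (λ x y → x + y) (zeroˡ (u i)) (trans (*-identityˡ (v i)) (v≈0 i))) (+-identityˡ 0#)))))

  -- Makes `V n` a finite set for `Recurrence`, with `_≈_` as its equality.
  code : ∀ {n} → V n → Fin (q ℕ.^ n)
  code v = funToFin (λ i → index (v i))

  code-injective : ∀ {n} {u v : V n} → code u ≡ code v → u ≈ v
  code-injective {u = u} {v} eq i = index-injective (trans (sym (Finₚ.finToFun-funToFin (λ j → index (u j)) i))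
    (trans (cong (λ k → finToFun k i) eq) (Finₚ.finToFun-funToFin (λ j → index (v j)) i)))

  -- Vectors are functions compared pointwise, so respecting `_≈_` is a condition of its own beside
  -- additivity and homogeneity. The laws of the twist `σ` are carried separately, by `FieldAut`.
  record IsSemilinear {m n} (σ : Carrier → Carrier) (f : V m → V n) : Set where
    field
      f-cong : ∀ {u v} → u ≈ v → f u ≈ f v
      f-⊕ : ∀ u v → f (u ⊕ v) ≈ (f u ⊕ f v)
      f-· : ∀ a v → f (a · v) ≈ (σ a · f v)

  IsLinear : ∀ {m n} → (V m → V n) → Set
  IsLinear = IsSemilinear (λ a → a)

  record IsFunctional {n} (φ : V n → Carrier) : Set where
    field
      φ-cong : ∀ {u v} → u ≈ v → φ u ≡ φ v
      φ-⊕ : ∀ u v → φ (u ⊕ v) ≡ φ u + φ v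
      φ-· : ∀ a v → φ (a · v) ≡ a * φ v

  sumF-cong : ∀ n {f g : Fin n → Carrier} → (∀ i → f i ≡ g i) → sumF n f ≡ sumF n g
  sumF-cong zero p = refl
  sumF-cong (suc n) p = cong₂ _+_ (p zero) (sumF-cong n (λ i → p (suc i)))

  sumF-+ : ∀ n (f g : Fin n → Carrier) → sumF n (λ i → f i + g i) ≡ sumF n f + sumF n g
  sumF-+ zero f g = sym (+-identityˡ 0#)
  sumF-+ (suc n) f g = trans (cong (f zero + g zero +_) (sumF-+ n _ _))
    (solve 4 (λ a b c d → (a :+ b) :+ (c :+ d) := (a :+ c) :+ (b :+ d)) refl (f zero) (g zero) _ _)

  sumF-* : ∀ n a (f : Fin n → Carrier) → sumF n (λ i → a * f i) ≡ a * sumF n f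
  sumF-* zero a f = sym (zeroʳ a)
  sumF-* (suc n) a f = trans (cong (a * f zero +_) (sumF-* n a _)) (sym (distribˡ a _ _))

  apply-linear : ∀ {m n} (M : Matrix n m) → IsLinear (apply M)
  apply-linear {m} M = record
    { f-cong = λ p i → sumF-cong m (λ j → cong (M i j *_) (p j))
    ; f-⊕ = λ u v i → trans (sumF-cong m (λ j → distribˡ (M i j) (u j) (v j))) (sumF-+ m _ _)
    ; f-· = λ a v i → trans (sumF-cong m (λ j → solve 3 (λ x a y → x :* (a :* y) := a :* (x :* y)) refl (M i j) a (v j))) (sumF-* m a _)
    }

  infixr 5 _◂_
  _◂_ : ∀ {n} → Carrier → V n → V (suc n)
  (a ◂ v) zero = a
  (a ◂ v) (suc i) = v i

  e : ∀ {n} → Fin n → V n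
  e zero = 1# ◂ 0V
  e (suc j) = 0# ◂ e j

  functional-sum : ∀ {n} {φ : V n → Carrier} → IsFunctional φ → ∀ v → φ v ≡ sumF n (λ j → φ (e j) * v j)
  functional-sum {zero} {φ} isφ v = trans (φ-cong (λ ())) (trans (φ-· 0# v) (zeroˡ (φ v)))
    where open IsFunctional isφ
  functional-sum {suc n} {φ} isφ v = begin
    φ v ≡⟨ φ-cong (λ { zero → sym (trans (cong (_+ 0#) (*-comm (v zero) 1#)) (trans (+-identityʳ _) (*-identityˡ _)))
                     ; (suc i) → sym (trans (cong (_+ v (suc i)) (zeroʳ (v zero))) (+-identityˡ _)) }) ⟩
    φ ((v zero · e zero) ⊕ (0# ◂ λ i → v (suc i))) ≡⟨ φ-⊕ _ _ ⟩
    φ (v zero · e zero) + φ (0# ◂ λ i → v (suc i)) ≡⟨ cong₂ _+_ (trans (φ-· _ _) (*-comm _ _)) (functional-sum tail-functional _) ⟩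
    φ (e zero) * v zero + sumF n (λ j → φ (e (suc j)) * v (suc j)) ∎
    where
    open ≡-Reasoning
    open IsFunctional isφ
    tail-functional : IsFunctional (λ w → φ (0# ◂ w))
    tail-functional = record
      { φ-cong = λ p → φ-cong (λ { zero → refl ; (suc i) → p i })
      ; φ-⊕ = λ u w → trans (φ-cong (λ { zero → sym (+-identityˡ 0#) ; (suc i) → refl })) (φ-⊕ _ _)
      ; φ-· = λ a w → trans (φ-cong (λ { zero → sym (zeroʳ a) ; (suc i) → refl })) (φ-· _ _)
      }

  functional-ext : ∀ {n} {φ ψ : V n → Carrier} → IsFunctional φ → IsFunctional ψ →
                   (∀ j → φ (e j) ≡ ψ (e j)) → ∀ v → φ v ≡ ψ v
  functional-ext {n} isφ isψ p v = trans (functional-sum isφ v)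
    (trans (sumF-cong n (λ j → cong (_* v j) (p j))) (sym (functional-sum isψ v)))

  coordinate-functional : ∀ {m n} {f : V m → V n} → IsLinear f → ∀ i → IsFunctional (λ v → f v i)
  coordinate-functional isf i = record { φ-cong = λ p → f-cong p i ; φ-⊕ = λ u v → f-⊕ u v i ; φ-· = λ a v → f-· a v i }
    where open IsSemilinear isf

  matrix-of : ∀ {m n} {f : V m → V n} → IsLinear f → ∀ v → apply (λ i j → f (e j) i) v ≈ f v
  matrix-of isf v i = sym (functional-sum (coordinate-functional isf i) v)

  module Semilinear {m n} {σ : Carrier → Carrier} {f : V m → V n} (isf : IsSemilinear σ f) where
    open IsSemilinear isf public

    f-lin2 : ∀ a b u v → f (a · u ⊕ b · v) ≈ (σ a · f u ⊕ σ b · f v)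
    f-lin2 a b u v = ≈-trans (f-⊕ _ _) (⊕-cong (f-· a u) (f-· b v))

    injective : (∀ v → f v ≈ 0V → v ≈ 0V) → ∀ {u v} → f u ≈ f v → u ≈ v
    injective kernel {u} {v} p = ⊕-zero (kernel (u ⊕ v) (≈-trans (f-⊕ u v)
      (λ i → trans (cong (_+ f v i) (p i)) (x+x≡0 (f v i)))))

  linear-zero : ∀ {m n} {f : V m → V n} → IsLinear f → ∀ {v} → v ≈ 0V → f v ≈ 0V
  linear-zero isf {v} p = ≈-trans (f-cong (λ i → trans (p i) (sym (zeroˡ (v i))))) (≈-trans (f-· 0# v) (λ i → zeroˡ _))
    where open IsSemilinear isf

  -- Stands in for rank and nullity: the orbit of `y` under the injective map `f` returns to `y`,
  -- and the vector just before the return is a preimage.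
  kernel-zero⇒surjective : ∀ {n} {σ} {f : V n → V n} → IsSemilinear σ f → (∀ v → f v ≈ 0V → v ≈ 0V) →
                           ∀ y → ∃[ x ] f x ≈ y
  kernel-zero⇒surjective {f = f} isf kernel y
    with Recurrence.recurrent _≈_ code code-injective f (Semilinear.injective isf kernel) y
  ... | d , p = fold y f d , ≈-sym p

  comb : ∀ {n} → V n → V n → V n → Carrier → Carrier → Carrier → V n
  comb u v w a b c = a · u ⊕ b · v ⊕ c · w

  InSpan3 : ∀ {n} → V n → V n → V n → V n → Set
  InSpan3 u v w x = ∃[ a ] ∃[ b ] ∃[ c ] (x ≈ comb u v w a b c)

  record KernelPair {n} (u v w : V n) (φ : V n → Carrier) : Set where
    field
      x y : V n
      x-span : InSpan3 u v w x
      y-span : InSpan3 u v w y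
      φx≡0 : φ x ≡ 0#
      φy≡0 : φ y ≡ 0#
      indep : Indep2 x y

  functional-comb : ∀ {n} {φ : V n → Carrier} → IsFunctional φ → ∀ u v w a b c →
                    φ (comb u v w a b c) ≡ a * φ u + b * φ v + c * φ w
  functional-comb isφ u v w a b c = trans (φ-⊕ _ _) (cong₂ _+_ (trans (φ-⊕ _ _) (cong₂ _+_ (φ-· _ _) (φ-· _ _))) (φ-· _ _))
    where open IsFunctional isφ

  comb-lin2 : ∀ {n} {u v w : V n} x y {a₁ b₁ c₁ a₂ b₂ c₂} →
              (x · comb u v w a₁ b₁ c₁ ⊕ y · comb u v w a₂ b₂ c₂) ≈
              comb u v w (x * a₁ + y * a₂) (x * b₁ + y * b₂) (x * c₁ + y * c₂)
  comb-lin2 {u = u} {v} {w} x y {a₁} {b₁} {c₁} {a₂} {b₂} {c₂} i =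
    solve 11 (λ x y a₁ b₁ c₁ a₂ b₂ c₂ u v w →
      x :* (a₁ :* u :+ b₁ :* v :+ c₁ :* w) :+ y :* (a₂ :* u :+ b₂ :* v :+ c₂ :* w) :=
      (x :* a₁ :+ y :* a₂) :* u :+ (x :* b₁ :+ y :* b₂) :* v :+ (x :* c₁ :+ y :* c₂) :* w)
      refl x y a₁ b₁ c₁ a₂ b₂ c₂ (u i) (v i) (w i)

  -- The coefficients of the two vectors depend on which of `φ u` and `φ v` is nonzero. They are
  -- chosen so that each coefficient of a vanishing combination can be read from a single
  -- coordinate.
  kernel-pair : ∀ {n} {u v w : V n} → Indep3 u v w → ∀ {φ} → IsFunctional φ → KernelPair u v w φ
  kernel-pair {n} {u} {v} {w} ind {φ} isφ = go (φ u ≟ 0#) (φ v ≟ 0#)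
    where
    C = comb u v w

    relations : ∀ x y {a₁ b₁ c₁ a₂ b₂ c₂} → (x · C a₁ b₁ c₁ ⊕ y · C a₂ b₂ c₂) ≈ 0V →
                x * a₁ + y * a₂ ≡ 0# × x * b₁ + y * b₂ ≡ 0# × x * c₁ + y * c₂ ≡ 0#
    relations x y p = ind _ _ _ (≈-trans (≈-sym (comb-lin2 x y)) p)

    pair : ∀ {a₁ b₁ c₁ a₂ b₂ c₂} → a₁ * φ u + b₁ * φ v + c₁ * φ w ≡ 0# → a₂ * φ u + b₂ * φ v + c₂ * φ w ≡ 0# →
           (∀ x y → x * a₁ + y * a₂ ≡ 0# × x * b₁ + y * b₂ ≡ 0# × x * c₁ + y * c₂ ≡ 0# → x ≡ 0# × y ≡ 0#) →
           KernelPair u v w φ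
    pair {a₁} {b₁} {c₁} {a₂} {b₂} {c₂} p₁ p₂ only = record
      { x = C a₁ b₁ c₁ ; y = C a₂ b₂ c₂ ; x-span = _ , _ , _ , ≈-refl ; y-span = _ , _ , _ , ≈-refl
      ; φx≡0 = trans (functional-comb isφ u v w a₁ b₁ c₁) p₁
      ; φy≡0 = trans (functional-comb isφ u v w a₂ b₂ c₂) p₂
      ; indep = λ x y p → only x y (relations x y p)
      }

    first : ∀ x y a → x * a + y * 0# ≡ a * x
    first = solve 3 (λ x y a → x :* a :+ y :* :0 := a :* x) refl

    second : ∀ x y a → x * 0# + y * a ≡ a * y
    second = solve 3 (λ x y a → x :* :0 :+ y :* a := a :* y) refl

    go : Dec (φ u ≡ 0#) → Dec (φ v ≡ 0#) → KernelPair u v w φ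
    go (no φu≢0) _ = pair {φ v} {φ u} {0#} {φ w} {0#} {φ u}
      (solve 3 (λ a b c → b :* a :+ a :* b :+ :0 :* c := :0) refl (φ u) (φ v) (φ w))
      (solve 3 (λ a b c → c :* a :+ :0 :* b :+ a :* c := :0) refl (φ u) (φ v) (φ w))
      (λ x y (_ , r , s) → integral φu≢0 (trans (sym (first x y _)) r) , integral φu≢0 (trans (sym (second x y _)) s))
    go (yes φu≡0) (no φv≢0) = pair {1#} {0#} {0#} {0#} {φ w} {φ v}
      (trans (solve 3 (λ a b c → :1 :* a :+ :0 :* b :+ :0 :* c := a) refl (φ u) (φ v) (φ w)) φu≡0)
      (solve 3 (λ a b c → :0 :* a :+ c :* b :+ b :* c := :0) refl (φ u) (φ v) (φ w))
      (λ x y (r , _ , s) → trans (sym (*-identityˡ x)) (trans (sym (first x y _)) r) , integral φv≢0 (trans (sym (second x y _)) s))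
    go (yes φu≡0) (yes φv≡0) = pair {1#} {0#} {0#} {0#} {1#} {0#}
      (trans (solve 3 (λ a b c → :1 :* a :+ :0 :* b :+ :0 :* c := a) refl (φ u) (φ v) (φ w)) φu≡0)
      (trans (solve 3 (λ a b c → :0 :* a :+ :1 :* b :+ :0 :* c := b) refl (φ u) (φ v) (φ w)) φv≡0)
      (λ x y (r , s , _) → trans (sym (*-identityˡ x)) (trans (sym (first x y _)) r) ,
                           trans (sym (*-identityˡ y)) (trans (sym (second x y _)) s))

  module Automorphism (A : FieldAut) where
    open FieldAut A public

    σ-0 : σ 0# ≡ 0#
    σ-0 = trans (solve 1 (λ x → x := (x :+ x) :+ x) refl (σ 0#))
      (trans (cong (_+ σ 0#) (trans (sym (σ-+ 0# 0#)) (cong σ (+-identityˡ 0#)))) (x+x≡0 _))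

    σ-injective : ∀ {x y} → σ x ≡ σ y → x ≡ y
    σ-injective {x} {y} p = trans (sym (σ⁻¹σ x)) (trans (cong σ⁻¹ p) (σ⁻¹σ y))

    σ-nonzero : ∀ {x} → x ≢ 0# → σ x ≢ 0#
    σ-nonzero x≢0 p = x≢0 (σ-injective (trans p (sym σ-0)))

    inverse-aut : FieldAut
    inverse-aut = record
      { σ = σ⁻¹ ; σ⁻¹ = σ ; σσ⁻¹ = σ⁻¹σ ; σ⁻¹σ = σσ⁻¹
      ; σ-+ = λ x y → σ-injective (trans (σσ⁻¹ _) (sym (trans (σ-+ _ _) (cong₂ _+_ (σσ⁻¹ x) (σσ⁻¹ y)))))
      ; σ-* = λ x y → σ-injective (trans (σσ⁻¹ _) (sym (trans (σ-* _ _) (cong₂ _*_ (σσ⁻¹ x) (σσ⁻¹ y)))))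
      ; σ-1 = σ-injective (trans (σσ⁻¹ 1#) (sym σ-1))
      }

    σ-semilinear : ∀ {n} → IsSemilinear {n} σ (λ v i → σ (v i))
    σ-semilinear = record { f-cong = λ p i → cong σ (p i) ; f-⊕ = λ u v i → σ-+ (u i) (v i) ; f-· = λ a v i → σ-* a (v i) }

  ∘-semilinear : ∀ {l m n σ τ} {g : V m → V n} {f : V l → V m} →
                 IsSemilinear τ g → IsSemilinear σ f → IsSemilinear (λ a → τ (σ a)) (λ v → g (f v))
  ∘-semilinear isg isf = record
    { f-cong = λ p → G.f-cong (S.f-cong p)
    ; f-⊕ = λ u v → ≈-trans (G.f-cong (S.f-⊕ u v)) (G.f-⊕ _ _)
    ; f-· = λ a v → ≈-trans (G.f-cong (S.f-· a v)) (G.f-· _ _)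
    }
    where
    module G = IsSemilinear isg
    module S = IsSemilinear isf

  semilinear-σ : ∀ {m n σ τ} {f : V m → V n} → (∀ a → σ a ≡ τ a) → IsSemilinear σ f → IsSemilinear τ f
  semilinear-σ p isf = record { f-cong = f-cong ; f-⊕ = f-⊕ ; f-· = λ a v → ≈-trans (f-· a v) (·-cong (p a) ≈-refl) }
    where open IsSemilinear isf

  module CollineationProperties {n} (c : Collineation n) where
    open Collineation c using (aut; M; N; MN; NM)
    open Automorphism aut public

    act-semilinear : IsSemilinear σ (act c)
    act-semilinear = ∘-semilinear {τ = λ a → a} {g = apply M} {f = λ v i → σ (v i)} (apply-linear M) σ-semilinear

    act-kernel : ∀ v → act c v ≈ 0V → v ≈ 0V
    act-kernel v p i = σ-injective (trans (sym (NM (λ j → σ (v j)) i))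
      (trans (IsSemilinear.f-cong (apply-linear N) p i)
        (trans (sym (IsSemilinear.f-cong (apply-linear N) (λ j → zeroˡ 0#) i))
          (trans (IsSemilinear.f-· (apply-linear N) 0# 0V i) (trans (zeroˡ _) (sym σ-0))))))

  -- The matrix `M` is read off from `f` with the automorphism removed, and the columns of `N` are
  -- preimages of the basis vectors. The second inverse law follows from the first because the
  -- linear part is injective.
  toCollineation : ∀ {n} (A : FieldAut) {f : V n → V n} → IsSemilinear (FieldAut.σ A) f →
                   (∀ v → f v ≈ 0V → v ≈ 0V) → ∃[ c ] (∀ v → act {n} c v ≈ f v)
  toCollineation {n} A {f} isf kernel = record { aut = A ; M = M ; N = N ; MN = MN ; NM = NM } , acts
    where
    open Automorphism A
    module S = IsSemilinear isf
    h : V n → V n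
    h v = f (λ i → σ⁻¹ (v i))
    h-linear : IsLinear h
    h-linear = semilinear-σ σσ⁻¹ (∘-semilinear isf (Automorphism.σ-semilinear inverse-aut))
    h-kernel : ∀ v → h v ≈ 0V → v ≈ 0V
    h-kernel v p i = trans (sym (σσ⁻¹ (v i))) (trans (cong σ (kernel _ p i)) σ-0)
    M N : Matrix n n
    M i j = h (e j) i
    N i j = proj₁ (kernel-zero⇒surjective h-linear h-kernel (e j)) i
    M≈h : ∀ v → apply M v ≈ h v
    M≈h = matrix-of h-linear
    MN-linear : IsLinear (λ v → apply M (apply N v))
    MN-linear = ∘-semilinear (apply-linear M) (apply-linear N)
    N-e : ∀ j → apply N (e j) ≈ (λ i → N i j)
    N-e j i = trans (sumF-cong n (λ k → *-comm (N i k) (e j k))) (pick (N i) j)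
      where
      zeros : ∀ m (g : Fin m → Carrier) → sumF m (λ k → 0# * g k) ≡ 0#
      zeros m g = trans (sumF-* m 0# g) (zeroˡ _)
      pick : ∀ {m} (g : Fin m → Carrier) j → sumF m (λ k → e j k * g k) ≡ g j
      pick {suc m} g zero = trans (cong₂ _+_ (*-identityˡ (g zero)) (zeros m (λ k → g (suc k)))) (+-identityʳ (g zero))
      pick {suc m} g (suc j) = trans (cong₂ _+_ (zeroˡ (g zero)) (pick (λ k → g (suc k)) j)) (+-identityˡ (g (suc j)))
    MN : ∀ v → apply M (apply N v) ≈ v
    MN v i = functional-ext (coordinate-functional MN-linear i)
      (record { φ-cong = λ p → p i ; φ-⊕ = λ _ _ → refl ; φ-· = λ _ _ → refl })
      (λ j → trans (IsSemilinear.f-cong (apply-linear M) (N-e j) i)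
        (trans (M≈h (λ k → N k j) i) (proj₂ (kernel-zero⇒surjective h-linear h-kernel (e j)) i))) v
    NM : ∀ v → apply N (apply M v) ≈ v
    NM v = Semilinear.injective h-linear h-kernel (≈-trans (≈-sym (M≈h _)) (≈-trans (MN (apply M v)) (M≈h v)))
    acts : ∀ v → apply M (λ i → σ (v i)) ≈ f v
    acts v = ≈-trans (M≈h _) (S.f-cong (λ i → σ⁻¹σ (v i)))

-- Quadratic forms in characteristic 2 and their determination by the singular points.

module QuadraticForms {q : ℕ} (2∣q : 2 ∣ q) (F : FiniteField q) where
  open LinearAlgebra 2∣q F public

  module Form {n} {Q : V n → Carrier} (isQ : IsQuadraticForm n Q) where
    open ≡-Reasoning

    b : V n → V n → Carrier
    b = B Q

    Q-cong : ∀ {u v} → u ≈ v → Q u ≡ Q v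
    Q-cong {u} {v} = proj₁ isQ u v

    Q-· : ∀ a v → Q (a · v) ≡ a * a * Q v
    Q-· = proj₁ (proj₂ isQ)

    b-⊕ˡ : ∀ u v w → b (u ⊕ v) w ≡ b u w + b v w
    b-⊕ˡ = proj₁ (proj₂ (proj₂ isQ))

    b-·ˡ : ∀ a u w → b (a · u) w ≡ a * b u w
    b-·ˡ = proj₂ (proj₂ (proj₂ isQ))

    b-def : ∀ u v → b u v ≡ Q (u ⊕ v) + Q u + Q v
    b-def u v = cong₂ _+_ (cong (Q (u ⊕ v) +_) (-x≡x (Q u))) (-x≡x (Q v))

    Q-⊕ : ∀ u v → Q (u ⊕ v) ≡ Q u + Q v + b u v
    Q-⊕ u v = trans (solve 3 (λ x y z → x := y :+ z :+ (x :+ y :+ z)) refl (Q (u ⊕ v)) (Q u) (Q v))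
      (cong (Q u + Q v +_) (sym (b-def u v)))

    b-cong : ∀ {u u′ v v′} → u ≈ u′ → v ≈ v′ → b u v ≡ b u′ v′
    b-cong p r = cong₂ _+_ (cong₂ _+_ (Q-cong (⊕-cong p r)) (cong -_ (Q-cong p))) (cong -_ (Q-cong r))

    b-sym : ∀ u v → b u v ≡ b v u
    b-sym u v = trans (b-def u v) (trans (solve 3 (λ x y z → x :+ y :+ z := x :+ z :+ y) refl (Q (u ⊕ v)) (Q u) (Q v))
      (trans (cong (λ t → t + Q v + Q u) (Q-cong (λ i → +-comm (u i) (v i)))) (sym (b-def v u))))

    b-⊕ʳ : ∀ w u v → b w (u ⊕ v) ≡ b w u + b w v
    b-⊕ʳ w u v = trans (b-sym w (u ⊕ v)) (trans (b-⊕ˡ u v w) (cong₂ _+_ (b-sym u w) (b-sym v w)))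

    b-·ʳ : ∀ w a u → b w (a · u) ≡ a * b w u
    b-·ʳ w a u = trans (b-sym w (a · u)) (trans (b-·ˡ a u w) (cong (a *_) (b-sym u w)))

    Q-0 : ∀ {v} → v ≈ 0V → Q v ≡ 0#
    Q-0 {v} p = trans (Q-cong {v} {0# · v} (λ i → trans (p i) (sym (zeroˡ (v i)))))
      (trans (Q-· 0# v) (trans (*-assoc _ _ _) (zeroˡ _)))

    b-self : ∀ v → b v v ≡ 0#
    b-self v = trans (b-def v v) (trans (cong (λ t → t + Q v + Q v) (Q-0 (λ i → x+x≡0 (v i))))
      (solve 1 (λ x → :0 :+ x :+ x := :0) refl (Q v)))

    b-0ʳ : ∀ u {v} → v ≈ 0V → b u v ≡ 0#
    b-0ʳ u {v} p = trans (b-cong {u} {u} {v} {0# · v} ≈-refl (λ i → trans (p i) (sym (zeroˡ (v i)))))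
      (trans (b-·ʳ u 0# v) (zeroˡ _))

    b-functional : ∀ u → IsFunctional (b u)
    b-functional u = record { φ-cong = b-cong ≈-refl ; φ-⊕ = b-⊕ʳ u ; φ-· = b-·ʳ u }

    Q-+· : ∀ x t u → Q (x ⊕ t · u) ≡ Q x + t * t * Q u + t * b x u
    Q-+· x t u = trans (Q-⊕ x (t · u)) (cong₂ (λ y z → Q x + y + z) (Q-· t u) (b-·ʳ x t u))

    b-+·ʳ : ∀ w x t u → b w (x ⊕ t · u) ≡ b w x + t * b w u
    b-+·ʳ w x t u = trans (b-⊕ʳ w x (t · u)) (cong (b w x +_) (b-·ʳ w t u))

    b-+·ˡ : ∀ x t u w → b (x ⊕ t · u) w ≡ b x w + t * b u w
    b-+·ˡ x t u w = trans (b-⊕ˡ x (t · u) w) (cong (b x w +_) (b-·ˡ t u w))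

    Q-lin2 : ∀ a c u v → Q (a · u ⊕ c · v) ≡ a * a * Q u + c * c * Q v + a * c * b u v
    Q-lin2 a c u v = trans (Q-+· (a · u) c v) (cong₂ (λ y z → y + c * c * Q v + z) (Q-· a u)
      (trans (cong (c *_) (b-·ˡ a u v)) (solve 3 (λ a c x → c :* (a :* x) := a :* c :* x) refl a c (b u v))))

    b-lin2ʳ : ∀ w a c u v → b w (a · u ⊕ c · v) ≡ a * b w u + c * b w v
    b-lin2ʳ w a c u v = trans (b-+·ʳ w (a · u) c v) (cong (_+ c * b w v) (b-·ʳ w a u))

    nonzero-ofb : ∀ {u v} → b u v ≢ 0# → Nonzero u
    nonzero-ofb {u} {v} p u≈0 = p (trans (b-sym u v) (b-0ʳ v u≈0))

    nonzero-ofQ : ∀ {v} → Q v ≢ 0# → Nonzero v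
    nonzero-ofQ p v≈0 = p (Q-0 v≈0)

    -- Along a singular `u` the form is affine, Q(x + tu) = Q(x) + t b(x,u), so it has a zero as
    -- soon as the slope b(x,u) is nonzero. The last component lets `t` be eliminated later.
    make-singular : ∀ x u → Q u ≡ 0# → b x u ≢ 0# → ∃[ t ] (Q (x ⊕ t · u) ≡ 0# × t * b x u ≡ Q x)
    make-singular x u Qu≡0 c≢0 = Q x * inv c c≢0 , (begin
      Q (x ⊕ t · u) ≡⟨ Q-+· x t u ⟩
      Q x + t * t * Q u + t * c ≡⟨ cong₂ (λ y z → Q x + t * t * y + z) Qu≡0 t*c ⟩
      Q x + t * t * 0# + Q x ≡⟨ solve 2 (λ x t → x :+ t :* t :* :0 :+ x := :0) refl (Q x) t ⟩
      0# ∎) , t*c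
      where
      c = b x u
      t = Q x * inv c c≢0
      t*c : t * c ≡ Q x
      t*c = trans (solve 3 (λ x i c → x :* i :* c := x :* (c :* i)) refl (Q x) (inv c c≢0) c)
        (trans (cong (Q x *_) (inv-right c c≢0)) (*-identityʳ (Q x)))

    module Nondeg (nondeg : Nondegenerate n Q) where

      partner : ∀ {v} → Nonzero v → ∃[ w ] b v w ≡ 1#
      partner {v} v≢0 with Finₚ.any? (λ j → ¬? (b v (e j) ≟ 0#))
      ... | yes (j , p) = inv (b v (e j)) p · e j , trans (b-·ʳ v _ (e j)) (trans (*-comm _ _) (inv-right _ p))
      ... | no ¬any = contradiction (nondeg v (functional-ext (b-functional v)
              (record { φ-cong = λ _ → refl ; φ-⊕ = λ _ _ → sym (+-identityˡ 0#) ; φ-· = λ a _ → sym (zeroʳ a) })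
              (λ j → decidable-stable (b v (e j) ≟ 0#) (λ p → ¬any (j , p))))) v≢0

      private
        dual : V n → V n
        dual z j = b z (e j)

        dual-linear : IsLinear dual
        dual-linear = record { f-cong = λ p j → b-cong p ≈-refl ; f-⊕ = λ u v j → b-⊕ˡ u v (e j) ; f-· = λ a v j → b-·ˡ a v (e j) }

        dual-kernel : ∀ v → dual v ≈ 0V → v ≈ 0V
        dual-kernel v p = nondeg v (functional-ext (b-functional v)
          (record { φ-cong = λ _ → refl ; φ-⊕ = λ _ _ → sym (+-identityˡ 0#) ; φ-· = λ a _ → sym (zeroʳ a) }) p)

      b-ext : ∀ {u v} → (∀ w → b u w ≡ b v w) → u ≈ v
      b-ext p = Semilinear.injective dual-linear dual-kernel (λ j → p (e j))

      represent : ∀ {φ} → IsFunctional φ → ∃[ z ] (∀ w → b z w ≡ φ w)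
      represent {φ} isφ with kernel-zero⇒surjective dual-linear dual-kernel (λ j → φ (e j))
      ... | z , p = z , functional-ext (b-functional z) isφ p

      hyperbolic-partner : ∀ {u} → Nonzero u → Q u ≡ 0# → ∃[ v ] (b u v ≡ 1# × Q v ≡ 0#)
      hyperbolic-partner {u} u≢0 Qu≡0 = complete (partner u≢0)
        where
        complete : ∃[ w ] b u w ≡ 1# → ∃[ v ] (b u v ≡ 1# × Q v ≡ 0#)
        complete (w , buw≡1) = w ⊕ Q w · u ,
          trans (b-+·ʳ u w (Q w) u) (trans (cong₂ (λ y z → y + Q w * z) buw≡1 (b-self u))
            (solve 1 (λ t → :1 :+ t :* :0 := :1) refl (Q w))) ,
          trans (Q-+· w (Q w) u) (trans (cong₂ (λ y z → Q w + Q w * Q w * y + Q w * z) Qu≡0 (trans (b-sym w u) buw≡1))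
            (solve 1 (λ t → t :+ t :* t :* :0 :+ t :* :1 := :0) refl (Q w)))

  module SameZeros {n} {Q Q′ : V n → Carrier} (isQ : IsQuadraticForm n Q) (isQ′ : IsQuadraticForm n Q′)
    (zeros : ∀ v → Q v ≡ 0# → Q′ v ≡ 0#) (zeros′ : ∀ v → Q′ v ≡ 0# → Q v ≡ 0#) where
    open ≡-Reasoning
    private
      module S = Form isQ
      module S′ = Form isQ′

    -- If b(u,x) were nonzero, `x` could be moved along `u` to a singular `x₀` with the same pairing
    -- with `u` in both forms. Then b′(u,x₀) = 0 makes u + x₀ singular for `Q′`, hence for `Q`, and
    -- this forces b(u,x₀) = 0.
    orthogonal : ∀ u x → Q u ≡ 0# → S′.b u x ≡ 0# → S.b u x ≡ 0#
    orthogonal u x Qu≡0 b′≡0 = decidable-stable (S.b u x ≟ 0#) λ bux≢0 →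
      let bxu≢0 = λ p → bux≢0 (trans (S.b-sym u x) p)
          t , Qx₀≡0 , _ = S.make-singular x u Qu≡0 bxu≢0
          x₀ = x ⊕ t · u
          b′ux₀≡0 = trans (S′.b-+·ʳ u x t u) (trans (cong₂ (λ y z → y + t * z) b′≡0 (S′.b-self u))
            (solve 1 (λ t → :0 :+ t :* :0 := :0) refl t))
          Q′sum = trans (S′.Q-⊕ u x₀) (trans (cong₂ (λ y z → y + z + S′.b u x₀) (zeros u Qu≡0) (zeros x₀ Qx₀≡0))
            (trans (cong (0# + 0# +_) b′ux₀≡0) (solve 0 (:0 :+ :0 :+ :0 := :0) refl)))
      in bux≢0 (begin
        S.b u x ≡⟨ solve 2 (λ y t → y := y :+ t :* :0) refl _ t ⟩
        S.b u x + t * 0# ≡⟨ cong (λ z → S.b u x + t * z) (sym (S.b-self u)) ⟩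
        S.b u x + t * S.b u u ≡⟨ sym (S.b-+·ʳ u x t u) ⟩
        S.b u x₀ ≡⟨ S.b-def u x₀ ⟩
        Q (u ⊕ x₀) + Q u + Q x₀ ≡⟨ cong₂ _+_ (cong₂ _+_ (zeros′ _ Q′sum) Qu≡0) Qx₀≡0 ⟩
        0# + 0# + 0# ≡⟨ solve 0 (:0 :+ :0 :+ :0 := :0) refl ⟩
        0# ∎)

  module ProportionalForms {n} {Q Q′ : V n → Carrier} (isQ : IsQuadraticForm n Q) (isQ′ : IsQuadraticForm n Q′)
    (nondeg : Nondegenerate n Q)
    (zeros : ∀ v → Q v ≡ 0# → Q′ v ≡ 0#) (zeros′ : ∀ v → Q′ v ≡ 0# → Q v ≡ 0#) where
    open ≡-Reasoning
    open Form isQ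
    open Nondeg nondeg
    private
      module S′ = Form isQ′

    -- The factor between the forms is found one singular point at a time, off its perp; the local
    -- factors are compared afterwards.
    ScalesAt : V n → Carrier → Set
    ScalesAt u κ = ∀ x → b u x ≢ 0# → Q′ x ≡ κ * Q x

    -- By `orthogonal` the functional b′(u,·) is a multiple κb(u,·). Writing x = x₀ + tu with `x₀`
    -- singular gives Q(x) = t b(x,u) and Q′(x) = t b′(x,u), with the same `t`.
    scale-at : ∀ {u} → Nonzero u → Q u ≡ 0# → ∃[ κ ] ScalesAt u κ
    scale-at {u} u≢0 Qu≡0 = κ , λ x bux≢0 →
      let t , Qx₀≡0 , tb≡Qx = make-singular x u Qu≡0 (λ p → bux≢0 (trans (b-sym u x) p))
      in begin
        Q′ x ≡⟨ solve 3 (λ x t y → x := (x :+ t :* t :* :0 :+ t :* y) :+ t :* y) refl (Q′ x) t (S′.b x u) ⟩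
        (Q′ x + t * t * 0# + t * S′.b x u) + t * S′.b x u ≡⟨ cong (λ z → (Q′ x + t * t * z + t * S′.b x u) + t * S′.b x u) (sym (zeros u Qu≡0)) ⟩
        (Q′ x + t * t * Q′ u + t * S′.b x u) + t * S′.b x u ≡⟨ cong₂ _+_ (trans (sym (S′.Q-+· x t u)) (zeros _ Qx₀≡0)) (cong (t *_) (trans (S′.b-sym x u) (b′-scale x))) ⟩
        0# + t * (κ * b u x) ≡⟨ solve 3 (λ t k y → :0 :+ t :* (k :* y) := k :* (t :* y)) refl t κ (b u x) ⟩
        κ * (t * b u x) ≡⟨ cong (λ z → κ * (t * z)) (b-sym u x) ⟩
        κ * (t * b x u) ≡⟨ cong (κ *_) tb≡Qx ⟩
        κ * Q x ∎
      where
      w = proj₁ (partner u≢0)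
      κ = S′.b u w
      b′-scale : ∀ x → S′.b u x ≡ κ * b u x
      b′-scale x = begin
        S′.b u x ≡⟨ sum-zero (trans (sym (S′.b-+·ʳ u x c w)) b′≡0) ⟩
        c * κ ≡⟨ *-comm c κ ⟩
        κ * c ∎
        where
        c = b u x
        b≡0 : b u (x ⊕ c · w) ≡ 0#
        b≡0 = trans (b-+·ʳ u x c w) (trans (cong (λ z → c + c * z) (proj₂ (partner u≢0))) (solve 1 (λ c → c :+ c :* :1 := :0) refl c))
        b′≡0 : S′.b u (x ⊕ c · w) ≡ 0#
        b′≡0 = SameZeros.orthogonal isQ′ isQ zeros′ zeros u _ (zeros u Qu≡0) b≡0

    -- The test vector u + w is nonsingular because Q(u + w) = b(u,w), and it is perpendicular to
    -- neither `u` nor `w`, so both factors apply to it.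
    scale-unique : ∀ {u w κ ν} → Q u ≡ 0# → Q w ≡ 0# → b u w ≢ 0# → ScalesAt u κ → ScalesAt w ν → κ ≡ ν
    scale-unique {u} {w} {κ} {ν} Qu≡0 Qw≡0 buw≢0 atu atw = sum-zero (integral {Q y} Qy≢0 (begin
      Q y * (κ + ν) ≡⟨ solve 3 (λ y k l → y :* (k :+ l) := k :* y :+ l :* y) refl (Q y) κ ν ⟩
      κ * Q y + ν * Q y ≡⟨ cong₂ _+_ (sym (atu y (λ p → buw≢0 (trans (sym buy) p)))) (sym (atw y (λ p → buw≢0 (trans (sym bwy) p)))) ⟩
      Q′ y + Q′ y ≡⟨ x+x≡0 (Q′ y) ⟩
      0# ∎))
      where
      y = u ⊕ w
      Qy≢0 : Q y ≢ 0#
      Qy≢0 p = buw≢0 (trans (b-def u w) (trans (cong₂ _+_ (cong₂ _+_ p Qu≡0) Qw≡0) (solve 0 (:0 :+ :0 :+ :0 := :0) refl)))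
      buy : b u y ≡ b u w
      buy = trans (b-⊕ʳ u u w) (trans (cong (_+ b u w) (b-self u)) (+-identityˡ _))
      bwy : b w y ≡ b u w
      bwy = trans (b-⊕ʳ w u w) (trans (cong₂ _+_ (b-sym w u) (b-self w)) (+-identityʳ _))

    private
      1≢0 : ∀ {x} → x ≡ 1# → x ≢ 0#
      1≢0 p r = 0≢1 (trans (sym r) p)

    -- A vector perpendicular to the hyperbolic pair u, v is reached through a
    -- singular w that is perpendicular neither to it nor to v.
    module _ {u v κ} (buv≡1 : b u v ≡ 1#) (Qu≡0 : Q u ≡ 0#) (Qv≡0 : Q v ≡ 0#) (at-v : ScalesAt v κ)
      {x} (bux≡0 : b u x ≡ 0#) (bvx≡0 : b v x ≡ 0#) where

      private
        bvu≡1 : b v u ≡ 1#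
        bvu≡1 = trans (b-sym v u) buv≡1

        bxu≡0 : b x u ≡ 0#
        bxu≡0 = trans (b-sym x u) bux≡0

        bxv≡0 : b x v ≡ 0#
        bxv≡0 = trans (b-sym x v) bvx≡0

      project : ∃[ x′ ] b x x′ ≡ 1# → ∃[ x₁ ] (b u x₁ ≡ 0# × b v x₁ ≡ 0# × b x x₁ ≡ 1#)
      project (x′ , bxx′≡1) = x₁ ,
          trans (expand u) (trans (cong₂ (λ y z → d + c * y + d * z) (b-self u) buv≡1)
            (solve 2 (λ c d → d :+ c :* :0 :+ d :* :1 := :0) refl c d)) ,
          trans (expand v) (trans (cong₂ (λ y z → c + c * y + d * z) bvu≡1 (b-self v))
            (solve 2 (λ c d → c :+ c :* :1 :+ d :* :0 := :0) refl c d)) ,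
          trans (expand x) (trans (cong₂ _+_ (cong₂ (λ y z → y + c * z) bxx′≡1 bxu≡0) (cong (d *_) bxv≡0))
            (solve 2 (λ c d → :1 :+ c :* :0 :+ d :* :0 := :1) refl c d))
        where
        c = b v x′
        d = b u x′
        x₁ = (x′ ⊕ c · u) ⊕ d · v
        expand : ∀ y → b y x₁ ≡ b y x′ + c * b y u + d * b y v
        expand y = trans (b-+·ʳ y _ d v) (cong (_+ d * b y v) (b-+·ʳ y x′ c u))

      bridge : ∃[ x₁ ] (b u x₁ ≡ 0# × b v x₁ ≡ 0# × b x x₁ ≡ 1#) →
               ∃[ w ] (b w x ≡ 1# × b w v ≡ 1# × Q w ≡ 0#)
      bridge (x₁ , bux₁≡0 , bvx₁≡0 , bxx₁≡1) = w ,
          trans (b-sym w x) (trans (expand x) (trans (cong₂ _+_ (cong₂ (λ y z → y + 1# * z) bxx₁≡1 bxu≡0) (cong (ν *_) bxv≡0))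
            (solve 1 (λ d → :1 :+ :1 :* :0 :+ d :* :0 := :1) refl ν))) ,
          trans (b-sym w v) (trans (expand v) (trans (cong₂ _+_ (cong₂ (λ y z → y + 1# * z) bvx₁≡0 bvu≡1) (cong (ν *_) (b-self v)))
            (solve 1 (λ d → :0 :+ :1 :* :1 :+ d :* :0 := :1) refl ν))) ,
          (begin
            Q w ≡⟨ Q-+· (x₁ ⊕ 1# · u) ν v ⟩
            Q (x₁ ⊕ 1# · u) + ν * ν * Q v + ν * b (x₁ ⊕ 1# · u) v ≡⟨ cong₂ _+_ (cong₂ (λ y z → y + ν * ν * z) (Q-+· x₁ 1# u) Qv≡0) (cong (ν *_) (b-+·ˡ x₁ 1# u v)) ⟩
            (ν + 1# * 1# * Q u + 1# * b x₁ u) + ν * ν * 0# + ν * (b x₁ v + 1# * b u v) ≡⟨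
              cong₂ _+_ (cong₂ (λ y z → (ν + 1# * 1# * y + 1# * z) + ν * ν * 0#) Qu≡0 (trans (b-sym x₁ u) bux₁≡0))
                (cong₂ (λ y z → ν * (y + 1# * z)) (trans (b-sym x₁ v) bvx₁≡0) buv≡1) ⟩
            (ν + 1# * 1# * 0# + 1# * 0#) + ν * ν * 0# + ν * (0# + 1# * 1#) ≡⟨
              solve 1 (λ n → (n :+ :1 :* :1 :* :0 :+ :1 :* :0) :+ n :* n :* :0 :+ n :* (:0 :+ :1 :* :1) := :0) refl ν ⟩
            0# ∎)
        where
        ν = Q x₁
        -- The coefficient of `v` is Q(x₁): as u, v is a hyperbolic pair perpendicular to `x₁`, this
        -- makes Q(w) = Q(x₁) + Q(x₁) = 0. The summand `u` gives b(w,v) = 1.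
        w = (x₁ ⊕ 1# · u) ⊕ ν · v
        expand : ∀ y → b y w ≡ b y x₁ + 1# * b y u + ν * b y v
        expand y = trans (b-+·ʳ y (x₁ ⊕ 1# · u) ν v) (cong (_+ ν * b y v) (b-+·ʳ y x₁ 1# u))

      scale-across : Nonzero x → Q′ x ≡ κ * Q x
      scale-across x≢0 = finish (bridge (project (partner x≢0)))
        where
        finish : ∃[ w ] (b w x ≡ 1# × b w v ≡ 1# × Q w ≡ 0#) → Q′ x ≡ κ * Q x
        finish (w , bwx≡1 , bwv≡1 , Qw≡0) = transfer (scale-at (nonzero-ofb (1≢0 bwx≡1)) Qw≡0)
          where
          transfer : ∃[ ν ] ScalesAt w ν → Q′ x ≡ κ * Q x
          transfer (ν , at-w) = trans (at-w x (1≢0 bwx≡1))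
            (cong (_* Q x) (scale-unique Qw≡0 Qv≡0 (1≢0 bwv≡1) at-w at-v))

    proportional : ∀ {u} → Nonzero u → Q u ≡ 0# → ∃[ κ ] (κ ≢ 0# × (∀ x → Q′ x ≡ κ * Q x))
    proportional {u} u≢0 Qu≡0 = assemble (hyperbolic-partner u≢0 Qu≡0) (scale-at u≢0 Qu≡0)
      where
      assemble : ∃[ v ] (b u v ≡ 1# × Q v ≡ 0#) → ∃[ κ ] ScalesAt u κ → ∃[ κ ] (κ ≢ 0# × (∀ x → Q′ x ≡ κ * Q x))
      assemble (v , buv≡1 , Qv≡0) (κ , at-u) = κ , κ≢0 , scale
        where
        bvu≡1 : b v u ≡ 1#
        bvu≡1 = trans (b-sym v u) buv≡1
        at-v : ScalesAt v κ
        at-v = let ν , at = scale-at (nonzero-ofb (1≢0 bvu≡1)) Qv≡0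
               in subst (ScalesAt v) (scale-unique Qv≡0 Qu≡0 (1≢0 bvu≡1) at at-u) at
        scale : ∀ x → Q′ x ≡ κ * Q x
        scale x = cases (b u x ≟ 0#) (b v x ≟ 0#) (x ≈? 0V)
          where
          cases : Dec (b u x ≡ 0#) → Dec (b v x ≡ 0#) → Dec (x ≈ 0V) → Q′ x ≡ κ * Q x
          cases (no bux≢0) _ _ = at-u x bux≢0
          cases (yes _) (no bvx≢0) _ = at-v x bvx≢0
          cases (yes _) (yes _) (yes x≈0) = trans (S′.Q-0 x≈0) (trans (sym (zeroʳ κ)) (cong (κ *_) (sym (Q-0 x≈0))))
          cases (yes bux≡0) (yes bvx≡0) (no x≢0) = scale-across buv≡1 Qu≡0 Qv≡0 at-v bux≡0 bvx≡0 x≢0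
        -- With `κ` zero, `Q′` would vanish everywhere and so would `Q`, yet Q(u + v) = 1.
        κ≢0 : κ ≢ 0#
        κ≢0 κ≡0 = 0≢1 (begin
          0# ≡⟨ sym (zeros′ (u ⊕ v) (trans (scale (u ⊕ v)) (trans (cong (_* Q (u ⊕ v)) κ≡0) (zeroˡ _)))) ⟩
          Q (u ⊕ v) ≡⟨ Q-⊕ u v ⟩
          Q u + Q v + b u v ≡⟨ cong₂ _+_ (cong₂ _+_ Qu≡0 Qv≡0) buv≡1 ⟩
          0# + 0# + 1# ≡⟨ solve 0 (:0 :+ :0 :+ :1 := :1) refl ⟩
          1# ∎)

  record Semisimilitude {n} (Q : V n → Carrier) (A : FieldAut) (f : V n → V n) : Set where
    open FieldAut A
    field
      semilinear : IsSemilinear σ f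
      kernel : ∀ v → f v ≈ 0V → v ≈ 0V
      μ : Carrier
      μ≢0 : μ ≢ 0#
      Q-f : ∀ v → Q (f v) ≡ μ * σ (Q v)

  module SemisimilitudeProperties {n} {Q : V n → Carrier} (isQ : IsQuadraticForm n Q) {A : FieldAut} {f : V n → V n}
    (S : Semisimilitude Q A f) where
    open Semisimilitude S public
    open Automorphism A public
    open Semilinear semilinear public
    open Form isQ
    open ≡-Reasoning

    b-f : ∀ u v → b (f u) (f v) ≡ μ * σ (b u v)
    b-f u v = begin
      b (f u) (f v) ≡⟨ b-def (f u) (f v) ⟩
      Q (f u ⊕ f v) + Q (f u) + Q (f v) ≡⟨ cong₂ _+_ (cong₂ _+_ (trans (Q-cong (≈-sym (f-⊕ u v))) (Q-f (u ⊕ v))) (Q-f u)) (Q-f v) ⟩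
      μ * σ (Q (u ⊕ v)) + μ * σ (Q u) + μ * σ (Q v) ≡⟨ solve 4 (λ m x y z → m :* x :+ m :* y :+ m :* z := m :* (x :+ y :+ z)) refl μ _ _ _ ⟩
      μ * (σ (Q (u ⊕ v)) + σ (Q u) + σ (Q v)) ≡⟨ cong (μ *_) (sym (trans (σ-+ _ _) (cong (_+ σ (Q v)) (σ-+ _ _)))) ⟩
      μ * σ (Q (u ⊕ v) + Q u + Q v) ≡⟨ cong (λ t → μ * σ t) (sym (b-def u v)) ⟩
      μ * σ (b u v) ∎

    μσ-zero : ∀ {x} → x ≡ 0# → μ * σ x ≡ 0#
    μσ-zero p = trans (cong (λ t → μ * σ t) p) (trans (cong (μ *_) σ-0) (zeroʳ μ))

    μσ-zero⁻¹ : ∀ {x} → μ * σ x ≡ 0# → x ≡ 0#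
    μσ-zero⁻¹ p = σ-injective (trans (integral μ≢0 p) (sym σ-0))

    f-zero : ∀ {v} → v ≈ 0V → f v ≈ 0V
    f-zero {v} p = ≈-trans (f-cong (λ i → trans (p i) (sym (zeroˡ (v i)))))
      (≈-trans (f-· 0# v) (λ i → trans (cong (_* f v i) σ-0) (zeroˡ _)))

    surjective : ∀ y → ∃[ x ] f x ≈ y
    surjective = kernel-zero⇒surjective semilinear kernel

  -- The form σ⁻¹(Q(act c v)) is again quadratic and has the zeros of `Q`, so it is a multiple κQ;
  -- the multiplier of `act c` is σ(κ).
  semisimilitude : ∀ {n} {Q : V n → Carrier} (isQ : IsQuadraticForm n Q) → Nondegenerate n Q →
    ∀ {u} → Nonzero u → Q u ≡ 0# → (c : Collineation n) →
    (∀ v → Nonzero v → ((Q v ≡ 0#) ⟺ (Q (act {n} c v) ≡ 0#))) →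
    Semisimilitude Q (Collineation.aut c) (act c)
  semisimilitude {n} {Q} isQ nondeg u≢0 Qu≡0 c stab = record
    { semilinear = act-semilinear ; kernel = act-kernel
    ; μ = σ κ ; μ≢0 = σ-nonzero κ≢0
    ; Q-f = λ v → trans (sym (σσ⁻¹ (Q (f v)))) (trans (cong σ (scale v)) (σ-* κ (Q v))) }
    where
    open CollineationProperties c
    open Form isQ
    module I = Automorphism inverse-aut
    open IsSemilinear act-semilinear
    f = act c
    Q′ : V n → Carrier
    Q′ v = σ⁻¹ (Q (f v))
    b′ : ∀ u v → B Q′ u v ≡ σ⁻¹ (b (f u) (f v))
    b′ u v = begin
      Q′ (u ⊕ v) + - Q′ u + - Q′ v ≡⟨ cong₂ _+_ (cong₂ _+_ (cong σ⁻¹ (Q-cong (f-⊕ u v))) (-x≡x _)) (-x≡x _) ⟩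
      σ⁻¹ (Q (f u ⊕ f v)) + σ⁻¹ (Q (f u)) + σ⁻¹ (Q (f v)) ≡⟨ sym (trans (I.σ-+ _ _) (cong (_+ Q′ v) (I.σ-+ _ _))) ⟩
      σ⁻¹ (Q (f u ⊕ f v) + Q (f u) + Q (f v)) ≡⟨ cong σ⁻¹ (sym (b-def (f u) (f v))) ⟩
      σ⁻¹ (b (f u) (f v)) ∎
      where open ≡-Reasoning
    isQ′ : IsQuadraticForm n Q′
    isQ′ = (λ u v p → cong σ⁻¹ (Q-cong (f-cong p)))
         , (λ a v → trans (cong σ⁻¹ (trans (Q-cong (f-· a v)) (Q-· (σ a) (f v))))
             (trans (I.σ-* _ _) (cong (_* Q′ v) (trans (I.σ-* _ _) (cong₂ _*_ (σ⁻¹σ a) (σ⁻¹σ a))))))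
         , (λ u v w → trans (b′ (u ⊕ v) w) (trans (cong σ⁻¹ (trans (b-cong (f-⊕ u v) ≈-refl) (b-⊕ˡ _ _ _)))
             (trans (I.σ-+ _ _) (cong₂ _+_ (sym (b′ u w)) (sym (b′ v w))))))
         , (λ a u w → trans (b′ (a · u) w) (trans (cong σ⁻¹ (trans (b-cong (f-· a u) ≈-refl) (b-·ˡ _ _ _)))
             (trans (I.σ-* _ _) (cong₂ _*_ (σ⁻¹σ a) (sym (b′ u w))))))
    zeros : ∀ v → Q v ≡ 0# → Q′ v ≡ 0#
    zeros v p with v ≈? 0V
    ... | yes v≈0 = Form.Q-0 isQ′ v≈0
    ... | no v≢0 = trans (cong σ⁻¹ (proj₁ (stab v v≢0) p)) I.σ-0
    zeros′ : ∀ v → Q′ v ≡ 0# → Q v ≡ 0#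
    zeros′ v p with v ≈? 0V
    ... | yes v≈0 = Q-0 v≈0
    ... | no v≢0 = proj₂ (stab v v≢0) (I.σ-injective (trans p (sym I.σ-0)))
    κ,scale = ProportionalForms.proportional isQ isQ′ nondeg zeros zeros′ u≢0 Qu≡0
    κ = proj₁ κ,scale
    κ≢0 = proj₁ (proj₂ κ,scale)
    scale = proj₂ (proj₂ κ,scale)

-- The elliptic quadric, the lines of W(q) and its ovoids.

module EllipticSpace {q : ℕ} (2∣q : 2 ∣ q) (F : FiniteField q) where
  open QuadraticForms 2∣q F public

  -- Only the vectors decoded from `Fin (q ^ n)` are tried, which is why `R` has to respect `_≈_`.
  anyV? : ∀ {n} {R : V n → Set} → (∀ {u v} → u ≈ v → R u → R v) → (∀ v → Dec (R v)) → Dec (∃[ v ] R v)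
  anyV? {n} {R} R-cong R? = map′ (λ (i , r) → decode i , r)
    (λ (v , r) → code v , R-cong (≈-sym (decode-code v)) r) (Finₚ.any? (λ i → R? (decode i)))
    where
    decode : Fin (q ℕ.^ n) → V n
    decode i k = Inverse.to enumeration (finToFun i k)
    decode-code : ∀ v → decode (code v) ≈ v
    decode-code v k = trans (cong (Inverse.to enumeration) (Finₚ.finToFun-funToFin (λ j → index (v j)) k))
      (Inverse.strictlyInverseˡ enumeration (v k))

  InSpan2-left : ∀ {n} (u v : V n) → InSpan2 u v u
  InSpan2-left u v = 1# , 0# , λ i → solve 2 (λ x y → x := :1 :* x :+ :0 :* y) refl (u i) (v i)

  InSpan2-right : ∀ {n} (u v : V n) → InSpan2 u v v
  InSpan2-right u v = 0# , 1# , λ i → solve 2 (λ x y → y := :0 :* x :+ :1 :* y) refl (u i) (v i)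

  TotallySingular : ∀ {n} → (V n → Carrier) → V n → V n → Set
  TotallySingular Q u v = Indep2 u v × (∀ a b → Q (a · u ⊕ b · v) ≡ 0#)

  module Tangents {Q : V 4 → Carrier} (isQ : IsQuadraticForm 4 Q) (nondeg : Nondegenerate 4 Q)
    (no-line : ∀ u v → ¬ TotallySingular Q u v) where
    open Form isQ
    open Nondeg nondeg
    open ≡-Reasoning

    singular-proportional : ∀ {u v} → Nonzero u → Nonzero v → Q u ≡ 0# → Q v ≡ 0# → b u v ≡ 0# → Proportional u v
    singular-proportional {u} {v} u≢0 v≢0 Qu≡0 Qv≡0 buv≡0 = decidable-stable (Proportional? u v) λ ¬prop →
      no-line u v (Indep2-fromNonProportional u≢0 v≢0 ¬prop ,
        λ x y → trans (Q-lin2 x y u v) (trans (cong₂ _+_ (cong₂ (λ s t → x * x * s + y * y * t) Qu≡0 Qv≡0) (cong (x * y *_) buv≡0))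
          (solve 2 (λ x y → x :* x :* :0 :+ y :* y :* :0 :+ x :* y :* :0 := :0) refl x y)))

    isotropic-span : ∀ {u v w w′} → b u v ≡ 0# → InSpan2 u v w → InSpan2 u v w′ → b w w′ ≡ 0#
    isotropic-span {u} {v} {w} {w′} buv≡0 (x , y , p) (x′ , y′ , p′) = begin
      b w w′ ≡⟨ b-cong p p′ ⟩
      b (x · u ⊕ y · v) (x′ · u ⊕ y′ · v) ≡⟨ b-lin2ʳ _ x′ y′ u v ⟩
      x′ * b (x · u ⊕ y · v) u + y′ * b (x · u ⊕ y · v) v ≡⟨ cong₂ (λ s t → x′ * s + y′ * t) (against u) (against v) ⟩
      x′ * (x * b u u + y * b u v) + y′ * (x * b v u + y * b v v) ≡⟨
        cong₂ (λ s t → x′ * s + y′ * t) (cong₂ (λ s t → x * s + y * t) (b-self u) buv≡0)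
          (cong₂ (λ s t → x * s + y * t) (trans (b-sym v u) buv≡0) (b-self v)) ⟩
      x′ * (x * 0# + y * 0#) + y′ * (x * 0# + y * 0#) ≡⟨
        solve 4 (λ x y x′ y′ → x′ :* (x :* :0 :+ y :* :0) :+ y′ :* (x :* :0 :+ y :* :0) := :0) refl x y x′ y′ ⟩
      0# ∎
      where
      against : ∀ z → b (x · u ⊕ y · v) z ≡ x * b z u + y * b z v
      against z = trans (b-sym _ z) (b-lin2ʳ z x y u v)

    -- On a totally isotropic line Q is the square of a linear form.
    perp⇒WLine : ∀ {u v} → Indep2 u v → b u v ≡ 0# → WLine Q u v
    perp⇒WLine {u} {v} ind buv≡0 = ind , exactly-one (point (Q u ≟ 0#))
      where
      point : Dec (Q u ≡ 0#) → ∃[ w ] (Nonzero w × InSpan2 u v w × Q w ≡ 0#)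
      point (yes Qu≡0) = u , Indep2-nonzeroˡ ind , InSpan2-left u v , Qu≡0
      point (no Qu≢0) = √ (Q v) · u ⊕ √ (Q u) · v ,
        (λ w≈0 → √-nonzero Qu≢0 (proj₂ (ind _ _ w≈0))) , (_ , _ , ≈-refl) ,
        (begin
          Q (√ (Q v) · u ⊕ √ (Q u) · v) ≡⟨ Q-lin2 (√ (Q v)) (√ (Q u)) u v ⟩
          √ (Q v) * √ (Q v) * Q u + √ (Q u) * √ (Q u) * Q v + √ (Q v) * √ (Q u) * b u v ≡⟨
            cong₂ _+_ (cong₂ (λ s t → s * Q u + t * Q v) (√-square (Q v)) (√-square (Q u))) (cong (√ (Q v) * √ (Q u) *_) buv≡0) ⟩
          Q v * Q u + Q u * Q v + √ (Q v) * √ (Q u) * 0# ≡⟨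
            solve 3 (λ x y z → x :* y :+ y :* x :+ z :* :0 := :0) refl (Q v) (Q u) (√ (Q v) * √ (Q u)) ⟩
          0# ∎)
      exactly-one : ∃[ w ] (Nonzero w × InSpan2 u v w × Q w ≡ 0#) → ExactlyOneOnLine (λ w → Q w ≡ 0#) u v
      exactly-one (w , w≢0 , w∈ , Qw≡0) = w , w≢0 , w∈ , Qw≡0 , λ w′ w′≢0 w′∈ Qw′≡0 →
        singular-proportional w′≢0 w≢0 Qw′≡0 Qw≡0 (isotropic-span buv≡0 w′∈ w∈)

    -- A singular point on a line that is not isotropic is accompanied by a second one.
    WLine⇒perp : ∀ {u v} → WLine Q u v → b u v ≡ 0#
    WLine⇒perp {u} {v} (ind , w , w≢0 , (x , y , p) , Qw≡0 , unique) =
      decidable-stable (b u v ≟ 0#) λ buv≢0 → w≢0 (λ i →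
        trans (p i) (trans (cong₂ (λ s t → s * u i + t * v i)
          (decidable-stable (x ≟ 0#) λ x≢0 → second v (InSpan2-right u v) λ bvw≡0 → *-nonzero x≢0 buv≢0 (trans (sym bvw) bvw≡0))
          (decidable-stable (y ≟ 0#) λ y≢0 → second u (InSpan2-left u v) λ buw≡0 → *-nonzero y≢0 buv≢0 (trans (sym buw) buw≡0)))
          (solve 2 (λ s t → :0 :* s :+ :0 :* t := :0) refl (u i) (v i))))
      where
      bvw : b v w ≡ x * b u v
      bvw = trans (b-cong ≈-refl p) (trans (b-lin2ʳ v x y u v) (trans (cong₂ (λ s t → x * s + y * t) (b-sym v u) (b-self v))
        (solve 3 (λ x y s → x :* s :+ y :* :0 := x :* s) refl x y (b u v))))
      buw : b u w ≡ y * b u v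
      buw = trans (b-cong ≈-refl p) (trans (b-lin2ʳ u x y u v) (trans (cong (λ s → x * s + y * b u v) (b-self u))
        (solve 3 (λ x y s → x :* :0 :+ y :* s := y :* s) refl x y (b u v))))
      -- Moving `r` along the singular `w` gives another singular point of the line; it differs from
      -- `w` because its pairing with `w` is still b(r,w).
      second : ∀ r → InSpan2 u v r → b r w ≢ 0# → ⊥
      second r (x′ , y′ , p′) brw≢0 = let t , Qw′≡0 , _ = make-singular r w Qw≡0 brw≢0 in
        absurd t (unique (r ⊕ t · w) (nonzero-ofb (λ z → brw≢0 (trans (sym (b-against t)) z)))
          (x′ + t * x , y′ + t * y , λ i → trans (cong₂ (λ s z → s + t * z) (p′ i) (p i))
            (solve 7 (λ x y x′ y′ t u v → (x′ :* u :+ y′ :* v) :+ t :* (x :* u :+ y :* v) := (x′ :+ t :* x) :* u :+ (y′ :+ t :* y) :* v)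
              refl x y x′ y′ t (u i) (v i))) Qw′≡0)
        where
        b-against : ∀ t → b (r ⊕ t · w) w ≡ b r w
        b-against t = trans (b-+·ˡ r t w w) (trans (cong (λ s → b r w + t * s) (b-self w))
          (solve 2 (λ s t → s :+ t :* :0 := s) refl (b r w) t))
        absurd : ∀ t → ¬ Proportional (r ⊕ t · w) w
        absurd t (a , _ , eq) = brw≢0 (trans (sym (b-against t)) (trans (b-cong eq ≈-refl)
          (trans (b-·ˡ a w w) (trans (cong (a *_) (b-self w)) (zeroʳ a)))))

    private
      e-indep : Indep3 (e {4} zero) (e (suc zero)) (e (suc (suc zero)))
      e-indep a b c p =
        trans (solve 3 (λ a b c → a := a :* :1 :+ b :* :0 :+ c :* :0) refl a b c) (p zero) ,
        trans (solve 3 (λ a b c → b := a :* :0 :+ b :* :1 :+ c :* :0) refl a b c) (p (suc zero)) ,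
        trans (solve 3 (λ a b c → c := a :* :0 :+ b :* :0 :+ c :* :1) refl a b c) (p (suc (suc zero)))

    -- The perp of `z` meets the plane of the first three basis vectors in at least a line. Two
    -- independent vectors of it cannot both be proportional to `z`, and one that is not spans with
    -- `z` an isotropic line.
    tangent-through : ∀ {z} → Nonzero z → ∃[ z′ ] WLine Q z z′
    tangent-through {z} z≢0 = choose (kernel-pair e-indep (b-functional z))
      where
      choose : KernelPair _ _ _ (b z) → ∃[ z′ ] WLine Q z z′
      choose K with Proportional? z (KernelPair.x K) | Proportional? z (KernelPair.y K)
      ... | no ¬prop | _ = x , perp⇒WLine (Indep2-fromNonProportional z≢0 (Indep2-nonzeroˡ indep) ¬prop) φx≡0
        where open KernelPair K
      ... | yes _ | no ¬prop = y , perp⇒WLine (Indep2-fromNonProportional z≢0 (Indep2-nonzeroʳ indep) ¬prop) φy≡0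
        where open KernelPair K
      ... | yes z∝x | yes z∝y = contradiction x∝y (λ (a , a≢0 , p) → 0≢1 (sym (proj₁ (indep 1# a λ i →
          trans (cong (λ s → 1# * s + a * y i) (p i)) (solve 2 (λ a y → :1 :* (a :* y) :+ a :* y := :0) refl a (y i))))))
        where
        open KernelPair K
        x∝y : Proportional x y
        x∝y = Proportional-trans (Proportional-sym z∝x) z∝y

    -- The plane π_x is the perp of `x` in Π, so its own perp is the point `x` again. This
    -- determines the projection to Π of the points of the conic C_x.
    perp-perp : ∀ {p x} → Nonzero x → (∀ z → Nonzero z → Proportional z x ⊎ WLine Q x z → b p z ≡ 0#) → ∃[ c ] (p ≈ (c · x))
    perp-perp {p} {x} x≢0 perp = complete (partner x≢0)
      where
      vanish : ∀ z → b x z ≡ 0# → b p z ≡ 0#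
      vanish z bxz≡0 with z ≈? 0V | Proportional? z x
      ... | yes z≈0 | _ = b-0ʳ p z≈0
      ... | no z≢0 | yes prop = perp z z≢0 (inj₁ prop)
      ... | no z≢0 | no ¬prop = perp z z≢0 (inj₂ (perp⇒WLine
              (Indep2-fromNonProportional x≢0 z≢0 (λ prop → ¬prop (Proportional-sym prop))) bxz≡0))
      complete : ∃[ w ] b x w ≡ 1# → ∃[ c ] (p ≈ (c · x))
      complete (w , bxw≡1) = b p w , b-ext λ z → begin
        b p z ≡⟨ sum-zero (trans (sym (b-+·ʳ p z (b x z) w)) (vanish _ (orth z))) ⟩
        b x z * b p w ≡⟨ *-comm _ _ ⟩
        b p w * b x z ≡⟨ sym (b-·ˡ (b p w) x z) ⟩
        b (b p w · x) z ∎
        where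
        orth : ∀ z → b x (z ⊕ b x z · w) ≡ 0#
        orth z = trans (b-+·ʳ x z _ w) (trans (cong (λ s → b x z + b x z * s) bxw≡1)
          (solve 1 (λ s → s :+ s :* :1 := :0) refl (b x z)))

    module Ovoid {O : V 4 → Set} (ovoid : IsOvoid Q O) where
      O-nonzero : ∀ {v} → O v → Nonzero v
      O-nonzero {v} = proj₁ (proj₁ ovoid) v

      O-cong : ∀ {u v} → u ≈ v → O u → O v
      O-cong {u} {v} = proj₁ (proj₂ (proj₁ ovoid)) u v

      O-· : ∀ {a v} → a ≢ 0# → O v → O (a · v)
      O-· {a} {v} = proj₂ (proj₂ (proj₁ ovoid)) a v

      O-proportional : ∀ {u v} → Proportional u v → O v → O u
      O-proportional (a , a≢0 , p) o = O-cong (≈-sym p) (O-· a≢0 o)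

      -- Two distinct perpendicular points span a line of W(q), which carries only one point of the
      -- ovoid.
      O-unique : ∀ {u v} → O u → O v → b u v ≡ 0# → Proportional u v
      O-unique {u} {v} ou ov buv≡0 = decidable-stable (Proportional? u v) λ ¬prop →
        let ind = Indep2-fromNonProportional (O-nonzero ou) (O-nonzero ov) ¬prop
            w , _ , _ , _ , unique = proj₂ ovoid u v (perp⇒WLine ind buv≡0)
        in ¬prop (Proportional-trans (unique u (O-nonzero ou) (InSpan2-left u v) ou)
             (Proportional-sym (unique v (O-nonzero ov) (InSpan2-right u v) ov)))

      -- Membership is not assumed decidable, but a line of W(q) through `v` comes with an ovoid
      -- point `w`, and `v` lies in `O` only if it is proportional to `w`. That proportionality can
      -- be decided over a finite field.
      O-stable : ∀ {v} → Nonzero v → ¬ ¬ O v → O v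
      O-stable {v} v≢0 ¬¬o =
        let z′ , line = tangent-through v≢0
            w , _ , _ , ow , unique = proj₂ ovoid v z′ line
        in O-proportional (decidable-stable (Proportional? v w)
             (λ ¬prop → ¬¬o (λ o → ¬prop (unique v v≢0 (InSpan2-left v z′) o)))) ow

-- The orthogonal decomposition of the six-dimensional space into Π and Π^ζ.

module KleinQuadric {q : ℕ} (2∣q : 2 ∣ q) (F : FiniteField q) where
  open EllipticSpace 2∣q F public

  module Restriction {Q : V 6 → Carrier} (isQ : IsQuadraticForm 6 Q) {ι : V 4 → V 6} (ι-linear : IsLinear ι) where
    module S₆ = Form isQ
    module Lι = Semilinear ι-linear

    Q₄ : V 4 → Carrier
    Q₄ z = Q (ι z)

    b₄ : ∀ u v → B Q₄ u v ≡ S₆.b (ι u) (ι v)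
    b₄ u v = cong (λ t → t + - Q₄ u + - Q₄ v) (S₆.Q-cong (Lι.f-⊕ u v))

    isQ₄ : IsQuadraticForm 4 Q₄
    isQ₄ = (λ u v p → S₆.Q-cong (Lι.f-cong p))
         , (λ a v → trans (S₆.Q-cong (Lι.f-· a v)) (S₆.Q-· a _))
         , (λ u v w → trans (b₄ _ w) (trans (S₆.b-cong (Lι.f-⊕ u v) ≈-refl) (trans (S₆.b-⊕ˡ _ _ _) (sym (cong₂ _+_ (b₄ u w) (b₄ v w))))))
         , (λ a u w → trans (b₄ _ w) (trans (S₆.b-cong (Lι.f-· a u) ≈-refl) (trans (S₆.b-·ˡ a _ _) (sym (cong (a *_) (b₄ u w))))))

  -- The orthogonal splitting of V into Π, the image of ι, and Π^ζ = ⟨l₁, l₂⟩.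
  record Splitting (Q : V 6 → Carrier) (ι : V 4 → V 6) : Set where
    field
      P : V 6 → V 4
      P-linear : IsLinear P
      b-P : ∀ y z → B Q y (ι z) ≡ B (λ x → Q (ι x)) (P y) z
      l₁ l₂ : V 6
      l₁⊥ : ∀ z → B Q l₁ (ι z) ≡ 0#
      l₂⊥ : ∀ z → B Q l₂ (ι z) ≡ 0#
      -- These values make `Q` on Π^ζ the form s² + sr + δr² with δ = Q(l₂); `δ∉AS` says that it is
      -- anisotropic.
      Q-l₁ : Q l₁ ≡ 1#
      b-l : B Q l₁ l₂ ≡ 1#
      δ∉AS : ¬ IsAS (Q l₂)
      split : ∀ y → y ≈ (ι (P y) ⊕ B Q y l₂ · l₁ ⊕ B Q y l₁ · l₂)

  module ConstructSplitting {Q : V 6 → Carrier} (plus : PlusType6 Q) {ι : V 4 → V 6} (ι-linear : IsLinear ι)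
    (elliptic : Elliptic4 (λ x → Q (ι x))) where
    isQ = proj₁ plus
    open Restriction isQ ι-linear
    open S₆
    open Nondeg (proj₁ (proj₂ plus))
    private
      module S₄ = Form isQ₄
      module N₄ = S₄.Nondeg (proj₁ elliptic)

    b-functional-ι : ∀ y → IsFunctional (λ z → b y (ι z))
    b-functional-ι y = record
      { φ-cong = λ p → b-cong ≈-refl (Lι.f-cong p)
      ; φ-⊕ = λ u v → trans (b-cong ≈-refl (Lι.f-⊕ u v)) (b-⊕ʳ y _ _)
      ; φ-· = λ a v → trans (b-cong ≈-refl (Lι.f-· a v)) (b-·ʳ y a _) }

    -- Orthogonal projection onto Π: the functional B(y,·) on Π is represented by a vector of Π,
    -- since the restricted form is nondegenerate.
    P : V 6 → V 4
    P y = proj₁ (N₄.represent (b-functional-ι y))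

    P-b : ∀ y z → S₄.b (P y) z ≡ b y (ι z)
    P-b y = proj₂ (N₄.represent (b-functional-ι y))

    P-linear : IsLinear P
    P-linear = record
      { f-cong = λ {u} {v} p → N₄.b-ext λ z → trans (P-b u z) (trans (b-cong p ≈-refl) (sym (P-b v z)))
      ; f-⊕ = λ u v → N₄.b-ext λ z → trans (P-b (u ⊕ v) z) (trans (b-⊕ˡ u v _) (trans (cong₂ _+_ (sym (P-b u z)) (sym (P-b v z))) (sym (S₄.b-⊕ˡ (P u) (P v) z))))
      ; f-· = λ a v → N₄.b-ext λ z → trans (P-b (a · v) z) (trans (b-·ˡ a v _) (trans (cong (a *_) (sym (P-b v z))) (sym (S₄.b-·ˡ a (P v) z))))
      }
    module LP = Semilinear P-linear

    P-ι : ∀ z → P (ι z) ≈ z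
    P-ι z = N₄.b-ext λ w → trans (P-b _ w) (sym (b₄ z w))

    InL : V 6 → Set
    InL y = ∀ z → b y (ι z) ≡ 0#

    P-InL : ∀ {y} → InL y → P y ≈ 0V
    P-InL {y} y⊥ = N₄.b-ext λ z → trans (P-b y z) (trans (y⊥ z) (sym (trans (S₄.b-sym 0V z) (S₄.b-0ʳ z ≈-refl))))

    InL-P : ∀ {y} → P y ≈ 0V → InL y
    InL-P {y} p z = trans (sym (P-b y z)) (trans (S₄.b-sym (P y) z) (S₄.b-0ʳ z p))

    InL-· : ∀ a {y} → InL y → InL (a · y)
    InL-· a {y} y⊥ z = trans (b-·ˡ a y _) (trans (cong (a *_) (y⊥ z)) (zeroʳ a))

    residual-InL : ∀ y → InL (y ⊕ ι (P y))
    residual-InL y = InL-P (≈-trans (LP.f-⊕ y _) (λ i → trans (cong (P y i +_) (P-ι (P y) i)) (x+x≡0 (P y i))))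

    -- `P` lands in a smaller space. Padded with two zero coordinates it becomes an endomorphism of
    -- `V 6` that misses `e zero`, so it cannot have trivial kernel.
    nonzero-InL : ∃[ l ] (Nonzero l × InL l)
    nonzero-InL = found (anyV? {R = λ v → Nonzero v × P v ≈ 0V}
        (λ p (v≢0 , Pv≈0) → Nonzero-cong p v≢0 , ≈-trans (≈-sym (LP.f-cong p)) Pv≈0)
        (λ v → ¬? (v ≈? 0V) ×-dec P v ≈? 0V))
      where
      pad : V 6 → V 6
      pad v = 0# ◂ 0# ◂ P v
      pad-linear : IsLinear pad
      pad-linear = record
        { f-cong = λ p → λ { zero → refl ; (suc zero) → refl ; (suc (suc i)) → LP.f-cong p i }
        ; f-⊕ = λ u v → λ { zero → sym (+-identityˡ 0#) ; (suc zero) → sym (+-identityˡ 0#) ; (suc (suc i)) → LP.f-⊕ u v i }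
        ; f-· = λ a v → λ { zero → sym (zeroʳ a) ; (suc zero) → sym (zeroʳ a) ; (suc (suc i)) → LP.f-· a v i }
        }
      found : Dec (∃[ v ] (Nonzero v × P v ≈ 0V)) → ∃[ l ] (Nonzero l × InL l)
      found (yes (l , l≢0 , p)) = l , l≢0 , InL-P p
      found (no none) = contradiction (proj₂ (kernel-zero⇒surjective pad-linear
          (λ v p → decidable-stable (v ≈? 0V) (λ v≢0 → none (v , v≢0 , λ i → p (suc (suc i))))) (e zero)) zero) 0≢1

    L-partner : ∀ {l} → Nonzero l → InL l → ∃[ m ] (InL m × b l m ≡ 1#)
    L-partner {l} l≢0 l⊥ = residual (partner l≢0)
      where
      residual : ∃[ m ] b l m ≡ 1# → ∃[ m ] (InL m × b l m ≡ 1#)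
      residual (m , blm≡1) = m ⊕ ι (P m) , residual-InL m ,
        trans (b-⊕ʳ l m _) (trans (cong₂ _+_ blm≡1 (l⊥ (P m))) (+-identityʳ 1#))

    module Basis {l m} (l⊥ : InL l) (m⊥ : InL m) (blm≡1 : b l m ≡ 1#) where
      open ≡-Reasoning

      assembled : V 4 → Carrier → Carrier → V 6
      assembled z a c = ι z ⊕ a · l ⊕ c · m

      b-assembled : ∀ y z a c → b y (assembled z a c) ≡ b y (ι z) + a * b y l + c * b y m
      b-assembled y z a c = trans (b-+·ʳ y _ c m) (cong (_+ c * b y m) (b-+·ʳ y _ a l))

      b-l-assembled : ∀ z a c → b l (assembled z a c) ≡ c
      b-l-assembled z a c = trans (b-assembled l z a c) (trans (cong₂ _+_ (cong₂ (λ s t → s + a * t) (l⊥ z) (b-self l)) (cong (c *_) blm≡1))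
        (solve 2 (λ a c → :0 :+ a :* :0 :+ c :* :1 := c) refl a c))

      b-m-assembled : ∀ z a c → b m (assembled z a c) ≡ a
      b-m-assembled z a c = trans (b-assembled m z a c) (trans (cong₂ _+_ (cong₂ (λ s t → s + a * t) (m⊥ z) (trans (b-sym m l) blm≡1)) (cong (c *_) (b-self m)))
        (solve 2 (λ a c → :0 :+ a :* :1 :+ c :* :0 := a) refl a c))

      P-assembled : ∀ z a c → P (assembled z a c) ≈ z
      P-assembled z a c = ≈-trans (LP.f-⊕ _ _) (≈-trans (⊕-cong (≈-trans (LP.f-⊕ _ _) (⊕-cong (P-ι z)
        (≈-trans (LP.f-· a l) (·-cong refl (P-InL l⊥))))) (≈-trans (LP.f-· c m) (·-cong refl (P-InL m⊥))))
        (λ i → solve 3 (λ z a c → z :+ a :* :0 :+ c :* :0 := z) refl (z i) a c))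

      assemble : V 6 → V 6
      assemble w = assembled (λ i → w (suc (suc i))) (w zero) (w (suc zero))

      assemble-linear : IsLinear assemble
      assemble-linear = record
        { f-cong = λ p → ⊕-cong (⊕-cong (Lι.f-cong (λ i → p (suc (suc i)))) (·-cong (p zero) ≈-refl)) (·-cong (p (suc zero)) ≈-refl)
        ; f-⊕ = λ u v i → trans (cong (λ t → t + (u zero + v zero) * l i + (u (suc zero) + v (suc zero)) * m i) (Lι.f-⊕ _ _ i))
            (solve 8 (λ x y a a′ c c′ l m → (x :+ y) :+ (a :+ a′) :* l :+ (c :+ c′) :* m := (x :+ a :* l :+ c :* m) :+ (y :+ a′ :* l :+ c′ :* m)) refl
              _ _ (u zero) (v zero) (u (suc zero)) (v (suc zero)) (l i) (m i))
        ; f-· = λ t u i → trans (cong (λ s → s + t * u zero * l i + t * u (suc zero) * m i) (Lι.f-· t _ i))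
            (solve 6 (λ x t a c l m → t :* x :+ t :* a :* l :+ t :* c :* m := t :* (x :+ a :* l :+ c :* m)) refl
              _ t (u zero) (u (suc zero)) (l i) (m i))
        }

      assemble-kernel : ∀ w → assemble w ≈ 0V → w ≈ 0V
      assemble-kernel w p zero = trans (sym (b-m-assembled _ (w zero) (w (suc zero)))) (b-0ʳ m p)
      assemble-kernel w p (suc zero) = trans (sym (b-l-assembled _ (w zero) (w (suc zero)))) (b-0ʳ l p)
      assemble-kernel w p (suc (suc i)) = trans (sym (P-assembled _ (w zero) (w (suc zero)) i))
        (trans (LP.f-cong p i) (P-InL {0V} (λ z → trans (b-sym _ _) (b-0ʳ _ ≈-refl)) i))

      -- The map from coordinates to vectors is injective, since `P` and the pairings with `l` and
      -- `m` recover the coordinates. An injective endomorphism of `V 6` reaches every `y`.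
      split : ∀ y → y ≈ assembled (P y) (b y m) (b y l)
      split y = recover (kernel-zero⇒surjective assemble-linear assemble-kernel y)
        where
        recover : ∃[ w ] assemble w ≈ y → y ≈ assembled (P y) (b y m) (b y l)
        recover (w , p) = ≈-trans (≈-sym p) (⊕-cong (⊕-cong
          (Lι.f-cong (≈-trans (≈-sym (P-assembled _ (w zero) (w (suc zero)))) (LP.f-cong p)))
          (·-cong (trans (sym (b-m-assembled _ (w zero) (w (suc zero)))) (trans (b-cong ≈-refl p) (b-sym m y))) ≈-refl))
          (·-cong (trans (sym (b-l-assembled _ (w zero) (w (suc zero)))) (trans (b-cong ≈-refl p) (b-sym l y))) ≈-refl))

      -- A singular `l` in Π^ζ is refuted: `P` identifies l^ζ modulo `l` with Π, preserving `Q`. A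
      -- totally singular plane of the Klein quadric contains a line inside l^ζ avoiding `l`, and
      -- the image of that line would be a totally singular line of the elliptic quadric.
      module SingularVector (Ql≡0 : Q l ≡ 0#) where

        modulo-l : ∀ {v} → b l v ≡ 0# → v ≈ (ι (P v) ⊕ b v m · l)
        modulo-l {v} blv≡0 = ≈-trans (split v) λ i → trans
          (cong (λ t → (ι (P v) ⊕ b v m · l) i + t * m i) (trans (b-sym v l) blv≡0))
          (solve 2 (λ x m → x :+ :0 :* m := x) refl _ (m i))

        Q-modulo-l : ∀ {v} → b l v ≡ 0# → Q v ≡ Q₄ (P v)
        Q-modulo-l {v} blv≡0 = trans (Q-cong (modulo-l blv≡0)) (trans (Q-+· _ (b v m) l)
          (trans (cong₂ (λ s t → Q₄ (P v) + b v m * b v m * s + b v m * t) Ql≡0 (trans (b-sym _ l) (l⊥ (P v))))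
            (solve 2 (λ x t → x :+ t :* t :* :0 :+ t :* :0 := x) refl _ (b v m))))

        project-line : ∀ {v w} → Indep2 v w → b l v ≡ 0# → b l w ≡ 0# → (∀ x y → Q (x · v ⊕ y · w) ≡ 0#) →
          (∀ x y c → (x · v ⊕ y · w) ≈ (c · l) → c ≡ 0#) → TotallySingular Q₄ (P v) (P w)
        project-line {v} {w} ind blv blw tot avoid =
          (λ x y p → let c≈ = mod-l x y p in
            ind x y (≈-trans c≈ (λ i → trans (cong (_* l i) (avoid x y _ c≈)) (zeroˡ (l i))))) ,
          λ x y → trans (S₄.Q-cong (≈-sym (LP.f-lin2 x y v w))) (trans (sym (Q-modulo-l (perp x y))) (tot x y))
          where
          perp : ∀ x y → b l (x · v ⊕ y · w) ≡ 0#
          perp x y = trans (b-lin2ʳ l x y v w) (trans (cong₂ (λ s t → x * s + y * t) blv blw)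
            (solve 2 (λ x y → x :* :0 :+ y :* :0 := :0) refl x y))
          mod-l : ∀ x y → (x · P v ⊕ y · P w) ≈ 0V → (x · v ⊕ y · w) ≈ (b (x · v ⊕ y · w) m · l)
          mod-l x y p = ≈-trans (modulo-l (perp x y)) (λ i → trans
            (cong (_+ (b (x · v ⊕ y · w) m · l) i) (linear-zero ι-linear (≈-trans (LP.f-lin2 x y v w) p) i))
            (+-identityˡ _))

        not-singular : ⊥
        not-singular = impossible (proj₂ (proj₂ plus))
          where
          impossible : ∃[ u₁ ] ∃[ u₂ ] ∃[ u₃ ] (Indep3 u₁ u₂ u₃ × (∀ a b c → Q (a · u₁ ⊕ b · u₂ ⊕ c · u₃) ≡ 0#)) → ⊥
          impossible (u₁ , u₂ , u₃ , ind , tot) = cases (b l u₁ ≟ 0#) (b l u₂ ≟ 0#) (b l u₃ ≟ 0#)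
            where
            C = comb u₁ u₂ u₃
            span-lin2 : ∀ {v w} x y → InSpan3 u₁ u₂ u₃ v → InSpan3 u₁ u₂ u₃ w → InSpan3 u₁ u₂ u₃ (x · v ⊕ y · w)
            span-lin2 x y (_ , _ , _ , p) (_ , _ , _ , r) = _ , _ , _ ,
              ≈-trans (⊕-cong (·-cong refl p) (·-cong refl r)) (comb-lin2 x y)
            Q-span : ∀ {v} → InSpan3 u₁ u₂ u₃ v → Q v ≡ 0#
            Q-span (a , c , d , p) = trans (Q-cong p) (tot a c d)
            b-span : ∀ {v w} → InSpan3 u₁ u₂ u₃ v → InSpan3 u₁ u₂ u₃ w → b v w ≡ 0#
            b-span {v} {w} v∈ w∈ = trans (b-def v w) (trans (cong₂ _+_ (cong₂ _+_
              (trans (Q-cong {v ⊕ w} {1# · v ⊕ 1# · w} (λ i → sym (cong₂ _+_ (*-identityˡ (v i)) (*-identityˡ (w i)))))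
                (Q-span (span-lin2 1# 1# v∈ w∈))) (Q-span v∈)) (Q-span w∈)) (solve 0 (:0 :+ :0 :+ :0 := :0) refl))
            elim : ∀ {φ} (K : KernelPair u₁ u₂ u₃ φ) → (∀ v → InSpan3 u₁ u₂ u₃ v → φ v ≡ 0# → b l v ≡ 0#) →
                   (∀ x y c → (x · KernelPair.x K ⊕ y · KernelPair.y K) ≈ (c · l) → c ≡ 0#) → ⊥
            elim K perp avoid = proj₂ (proj₂ elliptic) (P x , P y , project-line indep
                (perp x x-span φx≡0) (perp y y-span φy≡0) (λ s t → Q-span (span-lin2 s t x-span y-span)) avoid)
              where open KernelPair K
            -- If the plane is not contained in l^ζ, its intersection with l^ζ is the line sought;
            -- it misses `l` because the plane is totally isotropic while `u` is not perpendicular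
            -- to `l`.
            meets : ∀ {u} → InSpan3 u₁ u₂ u₃ u → b l u ≢ 0# → ⊥
            meets {u} u∈ blu≢0 = elim K (λ _ _ p → p) λ x y c p → integral blu≢0 (begin
                b l u * c ≡⟨ *-comm _ c ⟩
                c * b l u ≡⟨ sym (b-·ˡ c l u) ⟩
                b (c · l) u ≡⟨ b-cong (≈-sym p) ≈-refl ⟩
                b (x · KernelPair.x K ⊕ y · KernelPair.y K) u ≡⟨ b-span (span-lin2 x y (KernelPair.x-span K) (KernelPair.y-span K)) u∈ ⟩
                0# ∎)
              where K = kernel-pair ind (b-functional l)
            in₁ : InSpan3 u₁ u₂ u₃ u₁
            in₁ = 1# , 0# , 0# , λ i → solve 3 (λ x y z → x := :1 :* x :+ :0 :* y :+ :0 :* z) refl (u₁ i) (u₂ i) (u₃ i)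
            in₂ : InSpan3 u₁ u₂ u₃ u₂
            in₂ = 0# , 1# , 0# , λ i → solve 3 (λ x y z → y := :0 :* x :+ :1 :* y :+ :0 :* z) refl (u₁ i) (u₂ i) (u₃ i)
            in₃ : InSpan3 u₁ u₂ u₃ u₃
            in₃ = 0# , 0# , 1# , λ i → solve 3 (λ x y z → z := :0 :* x :+ :0 :* y :+ :1 :* z) refl (u₁ i) (u₂ i) (u₃ i)
            cases : Dec (b l u₁ ≡ 0#) → Dec (b l u₂ ≡ 0#) → Dec (b l u₃ ≡ 0#) → ⊥
            cases (no p) _ _ = meets in₁ p
            cases (yes _) (no p) _ = meets in₂ p
            cases (yes _) (yes _) (no p) = meets in₃ p
            -- The plane lies in l^ζ and may contain `l`; cutting it with m^ζ avoids `l`, as b(m,l)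
            -- = 1.
            cases (yes p₁) (yes p₂) (yes p₃) = elim K (λ v v∈ _ → perp v∈) λ x y c p → begin
                c ≡⟨ sym (*-identityʳ c) ⟩
                c * 1# ≡⟨ cong (c *_) (sym (trans (b-sym m l) blm≡1)) ⟩
                c * b m l ≡⟨ sym (b-·ʳ m c l) ⟩
                b m (c · l) ≡⟨ b-cong ≈-refl (≈-sym p) ⟩
                b m (x · KernelPair.x K ⊕ y · KernelPair.y K) ≡⟨ b-lin2ʳ m x y _ _ ⟩
                x * b m (KernelPair.x K) + y * b m (KernelPair.y K) ≡⟨ cong₂ (λ s t → x * s + y * t) (KernelPair.φx≡0 K) (KernelPair.φy≡0 K) ⟩
                x * 0# + y * 0# ≡⟨ solve 2 (λ x y → x :* :0 :+ y :* :0 := :0) refl x y ⟩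
                0# ∎
              where
              K = kernel-pair ind (b-functional m)
              perp : ∀ {v} → InSpan3 u₁ u₂ u₃ v → b l v ≡ 0#
              perp (x , y , z , p) = trans (b-cong ≈-refl p) (trans (functional-comb (b-functional l) u₁ u₂ u₃ x y z)
                (trans (cong₂ _+_ (cong₂ (λ s t → x * s + y * t) p₁ p₂) (cong (z *_) p₃))
                  (solve 3 (λ x y z → x :* :0 :+ y :* :0 :+ z :* :0 := :0) refl x y z)))

    anisotropic : ∀ {l} → Nonzero l → InL l → Q l ≢ 0#
    anisotropic l≢0 l⊥ Ql≡0 = let _ , m⊥ , blm≡1 = L-partner l≢0 l⊥ in
      Basis.SingularVector.not-singular l⊥ m⊥ blm≡1 Ql≡0

    splitting : Splitting Q ι
    splitting = build nonzero-InL
      where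
      build : ∃[ l ] (Nonzero l × InL l) → Splitting Q ι
      build (l , l≢0 , l⊥) = complete (L-partner (nonzero-ofQ (λ p → 0≢1 (trans (sym p) Ql₁≡1))) l₁⊥)
        where
        Ql≢0 = anisotropic l≢0 l⊥
        a = inv (√ (Q l)) (√-nonzero Ql≢0)
        l₁ = a · l
        l₁⊥ : InL l₁
        l₁⊥ = InL-· a l⊥
        Ql₁≡1 : Q l₁ ≡ 1#
        Ql₁≡1 = trans (Q-· a l) (trans (cong (a * a *_) (sym (√-square (Q l))))
          (trans (solve 2 (λ a s → a :* a :* (s :* s) := (s :* a) :* (s :* a)) refl a (√ (Q l)))
            (trans (cong₂ _*_ (inv-right _ _) (inv-right _ _)) (*-identityˡ 1#))))
        complete : ∃[ m ] (InL m × b l₁ m ≡ 1#) → Splitting Q ι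
        complete (l₂ , l₂⊥ , bl≡1) = record
          { P = P ; P-linear = P-linear ; b-P = λ y z → sym (P-b y z) ; l₁ = l₁ ; l₂ = l₂ ; l₁⊥ = l₁⊥ ; l₂⊥ = l₂⊥
          ; Q-l₁ = Ql₁≡1 ; b-l = bl≡1 ; split = Basis.split l₁⊥ l₂⊥ bl≡1
          -- If Q(l₂) = t² + t, then l₂ + tl₁ would be singular and nonzero.
          ; δ∉AS = λ (t , eq) → anisotropic {l₂ ⊕ t · l₁} (nonzero-ofb (λ p → 0≢1 (trans (sym p) (trans (b-+·ˡ l₂ t l₁ l₁)
              (trans (cong₂ (λ x y → x + t * y) (trans (b-sym l₂ l₁) bl≡1) (b-self l₁)) (solve 1 (λ t → :1 :+ t :* :0 := :1) refl t))))))
              (λ z → trans (b-+·ˡ l₂ t l₁ _) (trans (cong₂ (λ x y → x + t * y) (l₂⊥ z) (l₁⊥ z)) (solve 1 (λ t → :0 :+ t :* :0 := :0) refl t)))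
              (trans (Q-+· l₂ t l₁) (trans (cong₂ (λ x y → x + t * t * y + t * b l₂ l₁) (sym eq) Ql₁≡1)
                (trans (cong (λ x → (t * t + t) + t * t * 1# + t * x) (trans (b-sym l₂ l₁) bl≡1))
                  (solve 1 (λ t → (t :* t :+ t) :+ t :* t :* :1 :+ t :* :1 := :0) refl t)))) }

-- Axes of a point set, and the isometries that move one axis to another.

module Axes {q : ℕ} (2∣q : 2 ∣ q) (F : FiniteField q) where
  open KleinQuadric 2∣q F public

  -- For x ⊥ X and x + l singular with l ∈ X, this says that the point x
  -- belongs to the set O from which H arises as H_O with X = Π^ζ.
  OnTrace : ∀ {n} → (V n → Carrier) → (V n → Set) → V n → V n → Set
  OnTrace Q H x l = (Q l ≢ 0# × H (x ⊕ l)) ⊎ (Q l ≡ 0# × ¬ H (x ⊕ l))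

  -- An isometry only for Q(v) = 1.
  transvection : ∀ {n} → (V n → Carrier) → V n → V n → V n
  transvection Q n y = y ⊕ B Q y n · n

  -- The properties of Π^ζ that survive transport by a semisimilitude, stated in terms of `Q` and
  -- `H` alone. The last field says that the points of X^ζ from which `H` arises include no two
  -- distinct perpendicular ones; each of them is tested through a single singular lift x + l.
  record Axis {n} (Q : V n → Carrier) (H : V n → Set) (X : V n → Set) : Set where
    field
      X-cong : ∀ {u v} → u ≈ v → X u → X v
      X-lin2 : ∀ a c {u v} → X u → X v → X (a · u ⊕ c · v)
      X-anisotropic : ∀ {v} → X v → Q v ≡ 0# → v ≈ 0V
      reflects : ∀ {v y} → X v → Q v ≡ 1# → H y → H (transvection Q v y)
      no-secant : ∀ {x x′ l l′} → Nonzero x → Nonzero x′ → X l → X l′ →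
        (∀ v → X v → B Q x v ≡ 0#) → (∀ v → X v → B Q x′ v ≡ 0#) →
        Q (x ⊕ l) ≡ 0# → Q (x′ ⊕ l′) ≡ 0# → B Q x x′ ≡ 0# →
        OnTrace Q H x l → OnTrace Q H x′ l′ → Proportional x x′

    X-· : ∀ a {v} → X v → X (a · v)
    X-· a {v} xv = X-cong (λ i → solve 2 (λ a v → a :* v :+ :0 :* v := a :* v) refl a (v i)) (X-lin2 a 0# xv xv)

    X-⊕ : ∀ {u v} → X u → X v → X (u ⊕ v)
    X-⊕ {u} {v} xu xv = X-cong (λ i → solve 2 (λ u v → :1 :* u :+ :1 :* v := u :+ v) refl (u i) (v i)) (X-lin2 1# 1# xu xv)

    X-0 : ∀ {v} → X v → X 0V
    X-0 {v} xv = X-cong (λ i → zeroˡ (v i)) (X-· 0# xv)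

  -- A basis in which `Q` becomes s² + sr + δr². Frames with the same `δ` identify their axes
  -- isometrically.
  record Frame {n} (Q : V n → Carrier) (δ : Carrier) (X : V n → Set) (x₁ x₂ : V n) : Set where
    field
      in₁ : X x₁
      in₂ : X x₂
      Q₁ : Q x₁ ≡ 1#
      Q₂ : Q x₂ ≡ δ
      b₁₂ : B Q x₁ x₂ ≡ 1#
      nondegenerate : ∀ {v} → X v → B Q v x₁ ≡ 0# → B Q v x₂ ≡ 0# → v ≈ 0V

  module AxisTheory {n} {Q : V n → Carrier} (isQ : IsQuadraticForm n Q) {H : V n → Set}
    (H-cong : ∀ {u v} → u ≈ v → H u → H v) (H-stable : ∀ {v} → ¬ ¬ H v → H v) (H-singular : ∀ {v} → H v → Q v ≡ 0#) where
    open Form isQ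
    open ≡-Reasoning

    t : V n → V n → V n
    t = transvection Q

    t-cong : ∀ {u u′ y y′} → u ≈ u′ → y ≈ y′ → t u y ≈ t u′ y′
    t-cong p r = ⊕-cong r (·-cong (b-cong r p) p)

    t-linear : ∀ v → IsLinear (t v)
    t-linear v = record
      { f-cong = t-cong ≈-refl
      ; f-⊕ = λ x y i → trans (cong (λ s → (x i + y i) + s * v i) (b-⊕ˡ x y v))
          (solve 5 (λ x y s r v → (x :+ y) :+ (s :+ r) :* v := (x :+ s :* v) :+ (y :+ r :* v)) refl (x i) (y i) (b x v) (b y v) (v i))
      ; f-· = λ a y i → trans (cong (λ s → a * y i + s * v i) (b-·ˡ a y v))
          (solve 4 (λ a y s v → a :* y :+ a :* s :* v := a :* (y :+ s :* v)) refl a (y i) (b y v) (v i))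
      }

    b-t : ∀ v y → b (t v y) v ≡ b y v
    b-t v y = trans (b-+·ˡ y (b y v) v v) (trans (cong (λ s → b y v + b y v * s) (b-self v))
      (solve 1 (λ s → s :+ s :* :0 := s) refl (b y v)))

    t-involutive : ∀ v y → t v (t v y) ≈ y
    t-involutive v y i = trans (cong (λ s → t v y i + s * v i) (b-t v y))
      (solve 3 (λ y s v → (y :+ s :* v) :+ s :* v := y) refl (y i) (b y v) (v i))

    Q-t : ∀ {v} → Q v ≡ 1# → ∀ y → Q (t v y) ≡ Q y
    Q-t {v} Qv≡1 y = trans (Q-+· y (b y v) v) (trans (cong (λ s → Q y + b y v * b y v * s + b y v * b y v) Qv≡1)
      (solve 2 (λ x s → x :+ s :* s :* :1 :+ s :* s := x) refl (Q y) (b y v)))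

    record HIsometry (g : V n → V n) : Set where
      field
        g-linear : IsLinear g
        Q-g : ∀ y → Q (g y) ≡ Q y
        H-g : ∀ {y} → H y → H (g y)
        H-g⁻¹ : ∀ {y} → H (g y) → H y
        g-surjective : ∀ y → ∃[ x ] g x ≈ y
      open Semilinear g-linear public

      b-g : ∀ x y → b (g x) (g y) ≡ b x y
      b-g x y = trans (b-def _ _) (trans (cong₂ _+_ (cong₂ _+_ (trans (Q-cong (≈-sym (f-⊕ x y))) (Q-g (x ⊕ y))) (Q-g x)) (Q-g y)) (sym (b-def x y)))

      g-t : ∀ v y → g (t v y) ≈ t (g v) (g y)
      g-t v y = ≈-trans (f-⊕ _ _) (⊕-cong ≈-refl (≈-trans (f-· _ v) (·-cong (sym (b-g y v)) ≈-refl)))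

    involution-HIsometry : ∀ {g} → IsLinear g → (∀ y → g (g y) ≈ y) → (∀ y → Q (g y) ≡ Q y) →
      (∀ {y} → H y → H (g y)) → HIsometry g
    involution-HIsometry {g} lin inv Q-g H-g = record
      { g-linear = lin ; Q-g = Q-g ; H-g = H-g ; H-g⁻¹ = λ {y} h → H-cong (inv y) (H-g h) ; g-surjective = λ y → g y , inv y }

    _∘ᴴ_ : ∀ {g f} → HIsometry g → HIsometry f → HIsometry (λ y → g (f y))
    G ∘ᴴ F = record
      { g-linear = ∘-semilinear (HIsometry.g-linear G) (HIsometry.g-linear F)
      ; Q-g = λ y → trans (HIsometry.Q-g G _) (HIsometry.Q-g F y)
      ; H-g = λ h → HIsometry.H-g G (HIsometry.H-g F h)
      ; H-g⁻¹ = λ h → HIsometry.H-g⁻¹ F (HIsometry.H-g⁻¹ G h)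
      ; g-surjective = λ y → let x , p = HIsometry.g-surjective G y ; w , r = HIsometry.g-surjective F x
                             in w , ≈-trans (HIsometry.f-cong G r) p
      }

    Center : V n → Set
    Center v = Q v ≡ 1# × (∀ {y} → H y → H (t v y))

    Center-cong : ∀ {u v} → u ≈ v → Center u → Center v
    Center-cong p (Qu≡1 , h) = trans (Q-cong (≈-sym p)) Qu≡1 , λ hy → H-cong (t-cong p ≈-refl) (h hy)

    Center-HIsometry : ∀ {v} → Center v → HIsometry (t v)
    Center-HIsometry {v} (Qv≡1 , h) = involution-HIsometry (t-linear v) (t-involutive v) (Q-t Qv≡1) h

    -- Conjugating the transvection at `v` by `g` gives the transvection at g(v).
    Center-image : ∀ {g v} → HIsometry g → Center v → Center (g v)
    Center-image {g} {v} G (Qv≡1 , h) = trans (Q-g v) Qv≡1 , λ {y} hy →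
      let x , p = g-surjective y in
      H-cong (≈-trans (g-t v x) (t-cong ≈-refl p)) (H-g (h (H-g⁻¹ (H-cong (≈-sym p) hy))))
      where open HIsometry G

    -- If u and v are centers with c = b(u,v) ≠ 0, so is the multiple of u + v that
    -- exchanges them: the center w = xu + yv gives the center
    -- t_w(u) = (x² + y²)u + cy²v, and this map on coordinates is injective, so
    -- some iterate w starting from v satisfies t_w(u) = v.
    module Exchange {u v : V n} (cu : Center u) (cv : Center v) (c≢0 : b u v ≢ 0#) where
      private
        c = b u v

      vec : V 2 → V n
      vec w = w zero · u ⊕ w (suc zero) · v

      ψ : V 2 → V 2
      ψ w = (w zero * w zero + w (suc zero) * w (suc zero)) ◂ (c * (w (suc zero) * w (suc zero))) ◂ λ ()

      ψ-injective : ∀ {w w′} → ψ w ≈ ψ w′ → w ≈ w′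
      ψ-injective {w} {w′} p = λ { zero → first ; (suc zero) → second }
        where
        second : w (suc zero) ≡ w′ (suc zero)
        second = square-injective (sum-zero (integral c≢0 (trans (distribˡ c _ _) (trans (cong (_+ c * (w′ (suc zero) * w′ (suc zero))) (p (suc zero))) (x+x≡0 _)))))
        first : w zero ≡ w′ zero
        first = square-injective (sum-zero (begin
          w zero * w zero + w′ zero * w′ zero ≡⟨ solve 3 (λ x y z → x :+ y := (x :+ z) :+ (y :+ z)) refl _ _ (w (suc zero) * w (suc zero)) ⟩
          (w zero * w zero + w (suc zero) * w (suc zero)) + (w′ zero * w′ zero + w (suc zero) * w (suc zero)) ≡⟨
            cong₂ _+_ (p zero) (cong (λ s → w′ zero * w′ zero + s * s) second) ⟩
          (w′ zero * w′ zero + w′ (suc zero) * w′ (suc zero)) + (w′ zero * w′ zero + w′ (suc zero) * w′ (suc zero)) ≡⟨ x+x≡0 _ ⟩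
          0# ∎))

      step : ∀ w → Center (vec w) → Center (vec (ψ w))
      step w cw = Center-cong image (Center-image (Center-HIsometry cw) cu)
        where
        x = w zero
        y = w (suc zero)
        b-u-vec : b u (vec w) ≡ y * c
        b-u-vec = trans (b-lin2ʳ u x y u v) (trans (cong (λ s → x * s + y * c) (b-self u))
          (solve 3 (λ x y c → x :* :0 :+ y :* c := y :* c) refl x y c))
        norm : x * x + y * y + x * y * c ≡ 1#
        norm = begin
          x * x + y * y + x * y * c ≡⟨ solve 3 (λ x y c → x :* x :+ y :* y :+ x :* y :* c := x :* x :* :1 :+ y :* y :* :1 :+ x :* y :* c) refl x y c ⟩
          x * x * 1# + y * y * 1# + x * y * c ≡⟨ cong (_+ x * y * c) (cong₂ (λ s r → x * x * s + y * y * r) (sym (proj₁ cu)) (sym (proj₁ cv))) ⟩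
          x * x * Q u + y * y * Q v + x * y * c ≡⟨ sym (Q-lin2 x y u v) ⟩
          Q (vec w) ≡⟨ proj₁ cw ⟩
          1# ∎
        image : t (vec w) u ≈ vec (ψ w)
        image i = begin
          u i + b u (vec w) * (x * u i + y * v i) ≡⟨ cong (λ s → u i + s * (x * u i + y * v i)) b-u-vec ⟩
          u i + y * c * (x * u i + y * v i) ≡⟨ solve 5 (λ u v x y c → u :+ y :* c :* (x :* u :+ y :* v) := (:1 :+ x :* y :* c) :* u :+ c :* (y :* y) :* v) refl (u i) (v i) x y c ⟩
          -- The condition Q(w) = 1 replaces `1#` by x² + y² + xyc; the two terms xyc cancel, and
          -- only squares of `x` and `y` remain, which makes `ψ` injective.
          (1# + x * y * c) * u i + c * (y * y) * v i ≡⟨ cong (λ s → (s + x * y * c) * u i + c * (y * y) * v i) (sym norm) ⟩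
          ((x * x + y * y + x * y * c) + x * y * c) * u i + c * (y * y) * v i ≡⟨
            solve 5 (λ u v x y c → ((x :* x :+ y :* y :+ x :* y :* c) :+ x :* y :* c) :* u :+ c :* (y :* y) :* v := (x :* x :+ y :* y) :* u :+ c :* (y :* y) :* v) refl (u i) (v i) x y c ⟩
          (x * x + y * y) * u i + c * (y * y) * v i ∎

      start : V 2
      start = 0# ◂ 1# ◂ λ ()

      iterate : ∀ d → Center (vec (fold start ψ d))
      iterate zero = Center-cong (λ i → solve 2 (λ u v → v := :0 :* u :+ :1 :* v) refl (u i) (v i)) cv
      iterate (suc d) = step (fold start ψ d) (iterate d)

      exchange : ∃[ g ] (HIsometry g × g u ≈ v × (∀ z → b z u ≡ b z v → g z ≈ z))
      exchange = conclude (Recurrence.recurrent _≈_ code code-injective ψ ψ-injective start)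
        where
        conclude : ∃[ d ] (start ≈ ψ (fold start ψ d)) → ∃[ g ] (HIsometry g × g u ≈ v × (∀ z → b z u ≡ b z v → g z ≈ z))
        conclude (d , p) = t w , Center-HIsometry (iterate d) , moves , fixes
          where
          x = fold start ψ d zero
          y = fold start ψ d (suc zero)
          w = vec (fold start ψ d)
          -- The first coordinate of `start` is zero, so x² + y² = 0. Hence w = y(u + v) with cy² =
          -- 1, and `t w` fixes whatever pairs equally with `u` and `v`.
          x≡y : x ≡ y
          x≡y = square-injective (sum-zero (sym (p zero)))
          b-w : ∀ z → b z w ≡ y * (b z u + b z v)
          b-w z = trans (b-lin2ʳ z x y u v) (trans (cong (λ s → s * b z u + y * b z v) x≡y) (sym (distribˡ y _ _)))
          moves : t w u ≈ v
          moves i = begin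
            u i + b u w * (x * u i + y * v i) ≡⟨ cong₂ (λ s r → u i + s * (r * u i + y * v i)) (trans (b-w u) (cong (λ s → y * (s + c)) (b-self u))) x≡y ⟩
            u i + y * (0# + c) * (y * u i + y * v i) ≡⟨ solve 4 (λ u v y c → u :+ y :* (:0 :+ c) :* (y :* u :+ y :* v) := u :+ c :* (y :* y) :* (u :+ v)) refl (u i) (v i) y c ⟩
            u i + c * (y * y) * (u i + v i) ≡⟨ cong (λ s → u i + s * (u i + v i)) (sym (p (suc zero))) ⟩
            u i + 1# * (u i + v i) ≡⟨ solve 2 (λ u v → u :+ :1 :* (u :+ v) := v) refl (u i) (v i) ⟩
            v i ∎
          fixes : ∀ z → b z u ≡ b z v → t w z ≈ z
          fixes z r i = trans (cong (λ s → z i + s * w i) (trans (b-w z) (trans (cong (λ s → y * (s + b z v)) r) (trans (cong (y *_) (x+x≡0 _)) (zeroʳ y)))))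
            (solve 2 (λ z w → z :+ :0 :* w := z) refl (z i) (w i))

    open Exchange using (exchange) public

    Q-perp : ∀ {u v} → b u v ≡ 0# → Q (u ⊕ v) ≡ Q u + Q v
    Q-perp {u} {v} p = trans (Q-⊕ u v) (trans (cong (Q u + Q v +_) p) (+-identityʳ _))

    equal-of-perp-singular : ∀ {u v} → b u v ≡ 0# → Q (u ⊕ v) ≡ 0# → Q u ≡ Q v
    equal-of-perp-singular p r = sum-zero (trans (sym (Q-perp p)) r)

    Perp : (V n → Set) → V n → Set
    Perp X c = ∀ v → X v → b c v ≡ 0#

    Perp-⊕ : ∀ {X c d} → Perp X c → Perp X d → Perp X (c ⊕ d)
    Perp-⊕ p r v xv = trans (b-⊕ˡ _ _ v) (trans (cong₂ _+_ (p v xv) (r v xv)) (+-identityˡ 0#))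

    normaliser : ∀ {v} → Q v ≢ 0# → ∃[ κ ] κ * κ * Q v ≡ 1#
    normaliser {v} Qv≢0 = κ , (begin
      κ * κ * Q v ≡⟨ cong (κ * κ *_) (sym (√-square (Q v))) ⟩
      κ * κ * (√ (Q v) * √ (Q v)) ≡⟨ solve 2 (λ a s → a :* a :* (s :* s) := (s :* a) :* (s :* a)) refl κ (√ (Q v)) ⟩
      (√ (Q v) * κ) * (√ (Q v) * κ) ≡⟨ cong₂ _*_ (inv-right _ _) (inv-right _ _) ⟩
      1# * 1# ≡⟨ *-identityˡ 1# ⟩
      1# ∎)
      where κ = inv (√ (Q v)) (√-nonzero Qv≢0)

    module FrameProperties {X x₁ x₂ δ} (A : Axis Q H X) (Fr : Frame Q δ X x₁ x₂) where
      open Axis A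
      open Frame Fr

      coordinates : ∀ {v} → X v → v ≈ (b v x₂ · x₁ ⊕ b v x₁ · x₂)
      coordinates {v} xv = ⊕-zero (nondegenerate (X-⊕ xv (X-lin2 _ _ in₁ in₂)) zero₁ zero₂)
        where
        s = b v x₂
        r = b v x₁
        expand : ∀ z → b (v ⊕ (s · x₁ ⊕ r · x₂)) z ≡ b v z + (s * b z x₁ + r * b z x₂)
        expand z = trans (b-⊕ˡ v _ z) (cong (b v z +_) (trans (b-sym _ z) (b-lin2ʳ z s r x₁ x₂)))
        zero₁ : b (v ⊕ (s · x₁ ⊕ r · x₂)) x₁ ≡ 0#
        zero₁ = trans (expand x₁) (trans (cong₂ (λ p q → r + (s * p + r * q)) (b-self x₁) b₁₂)
          (solve 2 (λ s r → r :+ (s :* :0 :+ r :* :1) := :0) refl s r))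
        zero₂ : b (v ⊕ (s · x₁ ⊕ r · x₂)) x₂ ≡ 0#
        zero₂ = trans (expand x₂) (trans (cong₂ (λ p q → s + (s * p + r * q)) (trans (b-sym x₂ x₁) b₁₂) (b-self x₂))
          (solve 2 (λ s r → s :+ (s :* :1 :+ r :* :0) := :0) refl s r))

      Perp-spans : ∀ {y} → b y x₁ ≡ 0# → b y x₂ ≡ 0# → Perp X y
      Perp-spans {y} p₁ p₂ v xv = trans (b-cong ≈-refl (coordinates xv)) (trans (b-lin2ʳ y _ _ x₁ x₂)
        (trans (cong₂ (λ p q → b v x₂ * p + b v x₁ * q) p₁ p₂) (solve 2 (λ s r → s :* :0 :+ r :* :0 := :0) refl (b v x₂) (b v x₁))))

      Q-coordinates : ∀ s r → Q (s · x₁ ⊕ r · x₂) ≡ s * s + r * r * δ + s * r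
      Q-coordinates s r = trans (Q-lin2 s r x₁ x₂) (trans (cong₂ _+_ (cong₂ (λ p q → s * s * p + r * r * q) Q₁ Q₂) (cong (s * r *_) b₁₂))
        (solve 3 (λ s r d → s :* s :* :1 :+ r :* r :* d :+ s :* r :* :1 := s :* s :+ r :* r :* d :+ s :* r) refl s r δ))

      b-coordinates₁ : ∀ s r → b (s · x₁ ⊕ r · x₂) x₁ ≡ r
      b-coordinates₁ s r = trans (b-sym _ x₁) (trans (b-lin2ʳ x₁ s r x₁ x₂) (trans (cong₂ (λ p q → s * p + r * q) (b-self x₁) b₁₂)
        (solve 2 (λ s r → s :* :0 :+ r :* :1 := r) refl s r)))

      b-coordinates₂ : ∀ s r → b (s · x₁ ⊕ r · x₂) x₂ ≡ s
      b-coordinates₂ s r = trans (b-sym _ x₂) (trans (b-lin2ʳ x₂ s r x₁ x₂) (trans (cong₂ (λ p q → s * p + r * q) (trans (b-sym x₂ x₁) b₁₂) (b-self x₂))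
        (solve 2 (λ s r → s :* :1 :+ r :* :0 := s) refl s r)))

      component-zero : ∀ {c a} → Perp X c → X a → (c ⊕ a) ≈ 0V → a ≈ 0V
      component-zero {c} {a} c⊥ xa p = nondegenerate xa (zero-at in₁) (zero-at in₂)
        where
        zero-at : ∀ {v} → X v → b a v ≡ 0#
        zero-at {v} xv = trans (b-cong (≈-sym (⊕-zero p)) ≈-refl) (c⊥ v xv)

      component-proportional : ∀ {c a} → Perp X c → X a → Proportional c (c ⊕ a) → a ≈ 0V
      component-proportional {c} {a} c⊥ xa (s , s≢0 , p) = nondegenerate xa (zero-at in₁) (zero-at in₂)
        where
        zero-at : ∀ {v} → X v → b a v ≡ 0#
        zero-at {v} xv = integral s≢0 (begin
          s * b a v ≡⟨ cong (s *_) (sym (trans (b-⊕ˡ c a v) (trans (cong (_+ b a v) (c⊥ v xv)) (+-identityˡ _)))) ⟩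
          s * b (c ⊕ a) v ≡⟨ sym (b-·ˡ s _ v) ⟩
          b (s · (c ⊕ a)) v ≡⟨ b-cong (≈-sym p) ≈-refl ⟩
          b c v ≡⟨ c⊥ v xv ⟩
          0# ∎)

    axis-center : ∀ {X v} → Axis Q H X → X v → Q v ≡ 1# → Center v
    axis-center A xv Qv≡1 = Qv≡1 , Axis.reflects A xv Qv≡1

    -- As Q(l) = Q(l′), the transvection at the normalised multiple of l + l′ takes `l` to `l′`, and
    -- it fixes `c`. For given `c`, membership in `H` thus depends on the component along the axis
    -- only through its norm.
    rotate : ∀ {X l l′ c} → Axis Q H X → Perp X c → X l → X l′ → Q l ≡ Q l′ → H (c ⊕ l) → H (c ⊕ l′)
    rotate {X} {l} {l′} {c} A c⊥ xl xl′ Ql≡Ql′ h = cases (l ≈? l′)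
      where
      open Axis A
      v = l ⊕ l′
      b-l-v : b l v ≡ Q v
      b-l-v = trans (b-⊕ʳ l l l′) (trans (cong (_+ b l l′) (b-self l)) (sym (trans (Q-⊕ l l′)
        (trans (cong (λ s → s + Q l′ + b l l′) Ql≡Ql′) (cong (_+ b l l′) (x+x≡0 (Q l′)))))))
      reflect : ∃[ κ ] κ * κ * Q v ≡ 1# → H (c ⊕ l′)
      reflect (κ , κκQ≡1) = H-cong image (reflects (X-· κ (X-⊕ xl xl′)) (trans (Q-· κ v) κκQ≡1) h)
        where
        b-κv : b (c ⊕ l) (κ · v) ≡ κ * Q v
        b-κv = trans (b-·ʳ _ κ v) (cong (κ *_) (trans (b-⊕ˡ c l v) (trans (cong₂ _+_ (c⊥ v (X-⊕ xl xl′)) b-l-v) (+-identityˡ _))))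
        image : t (κ · v) (c ⊕ l) ≈ (c ⊕ l′)
        image i = begin
          (c i + l i) + b (c ⊕ l) (κ · v) * (κ * (l i + l′ i)) ≡⟨ cong (λ s → (c i + l i) + s * (κ * (l i + l′ i))) b-κv ⟩
          (c i + l i) + κ * Q v * (κ * (l i + l′ i)) ≡⟨ solve 5 (λ c l m k q → (c :+ l) :+ k :* q :* (k :* (l :+ m)) := (c :+ l) :+ k :* k :* q :* (l :+ m)) refl (c i) (l i) (l′ i) κ (Q v) ⟩
          (c i + l i) + κ * κ * Q v * (l i + l′ i) ≡⟨ cong (λ s → (c i + l i) + s * (l i + l′ i)) κκQ≡1 ⟩
          (c i + l i) + 1# * (l i + l′ i) ≡⟨ solve 3 (λ c l m → (c :+ l) :+ :1 :* (l :+ m) := c :+ m) refl (c i) (l i) (l′ i) ⟩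
          c i + l′ i ∎
      cases : Dec (l ≈ l′) → H (c ⊕ l′)
      cases (yes p) = H-cong (⊕-cong ≈-refl p) h
      cases (no l≉l′) = reflect (normaliser (λ Qv≡0 → l≉l′ (⊕-zero (X-anisotropic (X-⊕ xl xl′) Qv≡0))))

    -- The point `c` belongs to the trace by way of c + l. If c + a were not in `H`, it would be a
    -- singular point of the trace perpendicular to `c`, hence proportional to it, although Q(c) ≠
    -- 0.
    flip : ∀ {X l a c} → Axis Q H X → Perp X c → Q c ≢ 0# → X l → Perp X a → b c a ≡ 0# → Q l ≡ Q c → Q a ≡ Q c →
           Nonzero (c ⊕ a) → H (c ⊕ l) → H (c ⊕ a)
    flip {X} {l} {a} {c} A c⊥ Qc≢0 xl a⊥ bca≡0 Ql≡Qc Qa≡Qc c+a≢0 h = H-stable λ ¬h →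
      contradict (no-secant (nonzero-ofQ Qc≢0) c+a≢0 xl (X-0 xl) c⊥ (Perp-⊕ {X} c⊥ a⊥) (H-singular h)
        (trans (Q-cong ⊕0) Q-c+a) (trans (b-⊕ʳ c c a) (trans (cong₂ _+_ (b-self c) bca≡0) (+-identityˡ 0#)))
        (inj₁ ((λ Ql≡0 → Qc≢0 (trans (sym Ql≡Qc) Ql≡0)) , h))
        (inj₂ (Q-0 ≈-refl , λ h′ → ¬h (H-cong ⊕0 h′))))
      where
      open Axis A
      ⊕0 : ((c ⊕ a) ⊕ 0V) ≈ (c ⊕ a)
      ⊕0 i = +-identityʳ _
      Q-c+a : Q (c ⊕ a) ≡ 0#
      Q-c+a = trans (Q-perp bca≡0) (trans (cong (Q c +_) Qa≡Qc) (x+x≡0 (Q c)))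
      contradict : ¬ Proportional c (c ⊕ a)
      contradict (s , _ , p) = Qc≢0 (trans (Q-cong p) (trans (Q-· s _) (trans (cong (s * s *_) Q-c+a) (zeroʳ _))))

    module PerpendicularAxes {X Y δ x₁ x₂ y₁ y₂} (AX : Axis Q H X) (AY : Axis Q H Y)
      (FX : Frame Q δ X x₁ x₂) (FY : Frame Q δ Y y₁ y₂) (X⊥Y : ∀ {u v} → X u → Y v → b u v ≡ 0#) where
      private
        module X = Axis AX
        module Y = Axis AY
        module FX = Frame FX
        module FY = Frame FY
        module PX = FrameProperties AX FX
        module PY = FrameProperties AY FY

      X⇒Perp : ∀ {u} → X u → Perp Y u
      X⇒Perp xu v yv = X⊥Y xu yv

      Y⇒Perp : ∀ {u} → Y u → Perp X u
      Y⇒Perp yu v xv = trans (b-sym _ v) (X⊥Y xv yu)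

      -- All three components nonsingular: by the two no-secant properties,
      -- neither c + a′ ∈ H nor c + a′ ∉ H is possible for a′ ∈ ⟨a⟩ with Q(a′) = Q(c).
      mixed-absurd : ∀ {c a l} → Perp X c → Perp Y c → Y a → X l → Q c ≢ 0# → Q a ≢ 0# → Q l ≢ 0# → ¬ H ((c ⊕ a) ⊕ l)
      mixed-absurd {c} {a} {l} c⊥X c⊥Y ya xl Qc≢0 Qa≢0 Ql≢0 h = excluded present
        where
        -- Scales `a` to the norm of `c`, so that c + a′ is singular.
        κ = √ (Q c * inv (Q a) Qa≢0)
        a′ = κ · a
        ya′ : Y a′
        ya′ = Y.X-· κ ya
        Qa′≡Qc : Q a′ ≡ Q c
        Qa′≡Qc = trans (Q-· κ a) (trans (cong (_* Q a) (√-square _))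
          (trans (solve 3 (λ c i a → c :* i :* a := c :* (a :* i)) refl (Q c) _ (Q a)) (trans (cong (Q c *_) (inv-right _ Qa≢0)) (*-identityʳ _))))
        Q-c+a′ : Q (c ⊕ a′) ≡ 0#
        Q-c+a′ = trans (Q-perp (c⊥Y _ ya′)) (trans (cong (Q c +_) Qa′≡Qc) (x+x≡0 (Q c)))
        swap : ((c ⊕ a) ⊕ l) ≈ ((c ⊕ l) ⊕ a)
        swap i = solve 3 (λ c a l → (c :+ a) :+ l := (c :+ l) :+ a) refl (c i) (a i) (l i)
        c+a⊥X : Perp X (c ⊕ a)
        c+a⊥X = Perp-⊕ {X} c⊥X (Y⇒Perp ya)
        c+l⊥Y : Perp Y (c ⊕ l)
        c+l⊥Y = Perp-⊕ {Y} c⊥Y (X⇒Perp xl)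
        Q-c+a : Q (c ⊕ a) ≡ Q l
        Q-c+a = equal-of-perp-singular (c+a⊥X l xl) (H-singular h)
        Q-c+l : Q (c ⊕ l) ≡ Q a
        Q-c+l = equal-of-perp-singular (c+l⊥Y a ya) (trans (Q-cong (≈-sym swap)) (H-singular h))
        -- Seen from `Y`, both `c` and c + l are trace points, through the lifts c + a′ and c + l +
        -- a. They are perpendicular, and proportional only if l = 0.
        present : ¬ H (c ⊕ a′)
        present h′ = Ql≢0 (Q-0 (PX.component-proportional c⊥X xl (Y.no-secant (nonzero-ofQ Qc≢0)
          (nonzero-ofQ (λ p → Qa≢0 (trans (sym Q-c+l) p))) ya′ ya c⊥Y c+l⊥Y Q-c+a′
          (trans (Q-cong (≈-sym swap)) (H-singular h))
          (trans (b-⊕ʳ c c l) (trans (cong₂ _+_ (b-self c) (c⊥X l xl)) (+-identityˡ 0#)))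
          (inj₁ ((λ p → Qc≢0 (trans (sym Qa′≡Qc) p)) , h′)) (inj₁ (Qa≢0 , H-cong swap h)))))
        -- Seen from `X`, c + a′ is then a singular trace point, and c + a is a nonsingular one
        -- through its lift by `l`; they are perpendicular and cannot be proportional.
        excluded : ¬ ¬ H (c ⊕ a′)
        excluded ¬h′ = contradict (X.no-secant
          (λ p → Qc≢0 (trans (sym Qa′≡Qc) (Q-0 (PY.component-zero c⊥Y ya′ p))))
          (nonzero-ofQ (λ p → Ql≢0 (trans (sym Q-c+a) p))) (X.X-0 xl) xl (Perp-⊕ {X} c⊥X (Y⇒Perp ya′)) c+a⊥X
          (trans (Q-cong (λ i → +-identityʳ _)) Q-c+a′) (H-singular h) orth
          (inj₂ (Q-0 ≈-refl , λ h′ → ¬h′ (H-cong (λ i → +-identityʳ _) h′))) (inj₁ (Ql≢0 , h)))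
          where
          contradict : ¬ Proportional (c ⊕ a′) (c ⊕ a)
          contradict (s , s≢0 , p) = *-nonzero (*-nonzero s≢0 s≢0) Ql≢0
            (trans (cong (s * s *_) (sym Q-c+a)) (trans (sym (Q-· s _)) (trans (Q-cong (≈-sym p)) Q-c+a′)))
          orth : b (c ⊕ a′) (c ⊕ a) ≡ 0#
          orth = trans (b-⊕ˡ c a′ _) (trans (cong₂ _+_ (trans (b-⊕ʳ c c a) (cong₂ _+_ (b-self c) (c⊥Y a ya)))
            (trans (b-⊕ʳ a′ c a) (cong₂ _+_ (trans (b-sym a′ c) (c⊥Y _ ya′)) (trans (b-·ˡ κ a a) (trans (cong (κ *_) (b-self a)) (zeroʳ κ))))))
            (solve 0 ((:0 :+ :0) :+ (:0 :+ :0) := :0) refl))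

      -- If Q(c) = 0, then `a` and `l` have equal norm and two rotations suffice. If Q(a) or Q(l)
      -- vanishes, that component is zero by anisotropy and the claim is an instance of `flip`. By
      -- `mixed-absurd` nothing else occurs.
      exchange-components : ∀ {c a l a′ l′} → Perp X c → Perp Y c → Y a → X l → Y a′ → X l′ → Q a′ ≡ Q l → Q l′ ≡ Q a →
        H ((c ⊕ a) ⊕ l) → H ((c ⊕ l′) ⊕ a′)
      exchange-components {c} {a} {l} {a′} {l′} c⊥X c⊥Y ya xl ya′ xl′ Qa′≡Ql Ql′≡Qa h = cases (Q c ≟ 0#) (Q a ≟ 0#) (Q l ≟ 0#)
        where
        total : Q c + Q a + Q l ≡ 0#
        total = trans (sym (trans (Q-perp (Perp-⊕ {X} c⊥X (Y⇒Perp ya) l xl)) (cong (_+ Q l) (Q-perp (c⊥Y a ya))))) (H-singular h)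
        cases : Dec (Q c ≡ 0#) → Dec (Q a ≡ 0#) → Dec (Q l ≡ 0#) → H ((c ⊕ l′) ⊕ a′)
        cases (yes Qc≡0) _ _ = rotate AY (Perp-⊕ {Y} c⊥Y (X⇒Perp xl′)) ya ya′ (trans Qa≡Ql (sym Qa′≡Ql))
            (H-cong (λ i → solve 3 (λ c a l → (c :+ a) :+ l := (c :+ l) :+ a) refl (c i) (a i) (l′ i))
              (rotate AX (Perp-⊕ {X} c⊥X (Y⇒Perp ya)) xl xl′ (trans (sym Qa≡Ql) (sym Ql′≡Qa)) h))
          where
          Qa≡Ql : Q a ≡ Q l
          Qa≡Ql = sum-zero (trans (cong (_+ Q l) (trans (sym (+-identityˡ (Q a))) (cong (_+ Q a) (sym Qc≡0)))) total)
        cases (no Qc≢0) (yes Qa≡0) _ = H-cong (λ i → cong (_+ a′ i) (trans (sym (+-identityʳ (c i))) (cong (c i +_) (sym (l′≈0 i)))))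
            (flip AX c⊥X Qc≢0 xl (Y⇒Perp ya′) (c⊥Y a′ ya′) (sym Qc≡Ql) (trans Qa′≡Ql (sym Qc≡Ql))
              (λ p → Qc≢0 (trans Qc≡Ql (trans (sym Qa′≡Ql) (Q-0 (PY.component-zero c⊥Y ya′ p)))))
              (H-cong (λ i → cong (_+ l i) (trans (cong (c i +_) (a≈0 i)) (+-identityʳ (c i)))) h))
          where
          a≈0 = Y.X-anisotropic ya Qa≡0
          l′≈0 = X.X-anisotropic xl′ (trans Ql′≡Qa Qa≡0)
          Qc≡Ql : Q c ≡ Q l
          Qc≡Ql = sum-zero (trans (cong (_+ Q l) (trans (sym (+-identityʳ (Q c))) (cong (Q c +_) (sym Qa≡0)))) total)
        cases (no Qc≢0) (no Qa≢0) (yes Ql≡0) = H-cong (λ i → trans (sym (+-identityʳ _)) (cong (c i + l′ i +_) (sym (a′≈0 i))))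
            (flip AY c⊥Y Qc≢0 ya (X⇒Perp xl′) (c⊥X l′ xl′) (sym Qc≡Qa) (trans Ql′≡Qa (sym Qc≡Qa))
              (λ p → Qc≢0 (trans Qc≡Qa (trans (sym Ql′≡Qa) (Q-0 (PX.component-zero c⊥X xl′ p)))))
              (H-cong (λ i → trans (cong (c i + a i +_) (l≈0 i)) (+-identityʳ _)) h))
          where
          l≈0 = X.X-anisotropic xl Ql≡0
          a′≈0 = Y.X-anisotropic ya′ (trans Qa′≡Ql Ql≡0)
          Qc≡Qa : Q c ≡ Q a
          Qc≡Qa = sum-zero (trans (sym (+-identityʳ _)) (trans (cong (Q c + Q a +_) (sym Ql≡0)) total))
        cases (no Qc≢0) (no Qa≢0) (no Ql≢0) = contradiction h (mixed-absurd c⊥X c⊥Y ya xl Qc≢0 Qa≢0 Ql≢0)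

      private
        p r : V n
        p = x₁ ⊕ y₁
        r = x₂ ⊕ y₂

        Qp≡0 : Q p ≡ 0#
        Qp≡0 = trans (Q-perp (X⊥Y FX.in₁ FY.in₁)) (trans (cong₂ _+_ FX.Q₁ FY.Q₁) (x+x≡0 1#))

        Qr≡0 : Q r ≡ 0#
        Qr≡0 = trans (Q-perp (X⊥Y FX.in₂ FY.in₂)) (trans (cong₂ _+_ FX.Q₂ FY.Q₂) (x+x≡0 δ))

        brp≡0 : b r p ≡ 0#
        brp≡0 = trans (b-⊕ʳ r x₁ y₁) (trans (cong₂ _+_
          (trans (b-⊕ˡ x₂ y₂ x₁) (cong₂ _+_ (trans (b-sym x₂ x₁) FX.b₁₂) (trans (b-sym y₂ x₁) (X⊥Y FX.in₁ FY.in₂))))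
          (trans (b-⊕ˡ x₂ y₂ y₁) (cong₂ _+_ (X⊥Y FX.in₂ FY.in₁) (trans (b-sym y₂ y₁) FY.b₁₂))))
          (solve 0 ((:1 :+ :0) :+ (:0 :+ :1) := :0) refl))

      -- The Siegel transformation of the line ⟨p, r⟩, which is totally singular because the two
      -- frames contribute equal values that cancel in characteristic 2. It exchanges corresponding
      -- frame vectors and fixes every vector perpendicular to both axes.
      swap-axes : V n → V n
      swap-axes z = z ⊕ b z r · p ⊕ b z p · r

      private
        b-swap : ∀ z w → b w (swap-axes z) ≡ b w z + b z r * b w p + b z p * b w r
        b-swap z w = trans (b-+·ʳ w _ (b z p) r) (cong (_+ b z p * b w r) (b-+·ʳ w z (b z r) p))

        b-swap-p : ∀ z → b (swap-axes z) p ≡ b z p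
        b-swap-p z = trans (b-sym _ p) (trans (b-swap z p) (trans (cong₂ _+_ (cong₂ (λ s q → s + b z r * q) (b-sym p z) (b-self p)) (cong (b z p *_) (trans (b-sym p r) brp≡0)))
          (solve 2 (λ s q → s :+ q :* :0 :+ s :* :0 := s) refl (b z p) (b z r))))

        b-swap-r : ∀ z → b (swap-axes z) r ≡ b z r
        b-swap-r z = trans (b-sym _ r) (trans (b-swap z r) (trans (cong₂ _+_ (cong₂ (λ s q → s + b z r * q) (b-sym r z) brp≡0) (cong (b z p *_) (b-self r)))
          (solve 2 (λ s q → q :+ q :* :0 :+ s :* :0 := q) refl (b z p) (b z r))))

        Q-swap : ∀ z → Q (swap-axes z) ≡ Q z
        Q-swap z = begin
          Q (swap-axes z) ≡⟨ Q-+· _ (b z p) r ⟩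
          Q (z ⊕ b z r · p) + b z p * b z p * Q r + b z p * b (z ⊕ b z r · p) r ≡⟨
            cong₂ _+_ (cong₂ (λ s q → s + b z p * b z p * q) (Q-+· z (b z r) p) Qr≡0) (cong (b z p *_) (b-+·ˡ z (b z r) p r)) ⟩
          (Q z + b z r * b z r * Q p + b z r * b z p) + b z p * b z p * 0# + b z p * (b z r + b z r * b p r) ≡⟨
            cong₂ (λ s q → (Q z + b z r * b z r * s + b z r * b z p) + b z p * b z p * 0# + b z p * (b z r + b z r * q)) Qp≡0 (trans (b-sym p r) brp≡0) ⟩
          (Q z + b z r * b z r * 0# + b z r * b z p) + b z p * b z p * 0# + b z p * (b z r + b z r * 0#) ≡⟨
            solve 3 (λ x s q → (x :+ q :* q :* :0 :+ q :* s) :+ s :* s :* :0 :+ s :* (q :+ q :* :0) := x) refl (Q z) (b z p) (b z r) ⟩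
          Q z ∎

        swap-linear : IsLinear swap-axes
        swap-linear = record
          { f-cong = λ q → ⊕-cong (⊕-cong q (·-cong (b-cong q ≈-refl) ≈-refl)) (·-cong (b-cong q ≈-refl) ≈-refl)
          ; f-⊕ = λ z w i → trans (cong₂ (λ s q → (z i + w i) + s * p i + q * r i) (b-⊕ˡ z w r) (b-⊕ˡ z w p))
              (solve 8 (λ z w s s′ q q′ p r → (z :+ w) :+ (s :+ s′) :* p :+ (q :+ q′) :* r := (z :+ s :* p :+ q :* r) :+ (w :+ s′ :* p :+ q′ :* r)) refl
                (z i) (w i) (b z r) (b w r) (b z p) (b w p) (p i) (r i))
          ; f-· = λ a z i → trans (cong₂ (λ s q → a * z i + s * p i + q * r i) (b-·ˡ a z r) (b-·ˡ a z p))
              (solve 6 (λ a z s q p r → a :* z :+ a :* s :* p :+ a :* q :* r := a :* (z :+ s :* p :+ q :* r)) refl a (z i) (b z r) (b z p) (p i) (r i))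
          }

        swap-involutive : ∀ z → swap-axes (swap-axes z) ≈ z
        swap-involutive z i = trans (cong₂ (λ s q → swap-axes z i + s * p i + q * r i) (b-swap-r z) (b-swap-p z))
          (solve 5 (λ z s q p r → (z :+ s :* p :+ q :* r) :+ s :* p :+ q :* r := z) refl (z i) (b z r) (b z p) (p i) (r i))

        H-swap : ∀ {z} → H z → H (swap-axes z)
        -- Splits z = c + a + l along `Y` and `X` and exchanges the coordinates of `a` and `l`. Both
        -- frames give the norm s² + sr + δr², so the norms are exchanged as required.
        H-swap {z} h = H-cong after (exchange-components c⊥X c⊥Y (Y.X-lin2 _ _ FY.in₁ FY.in₂) (X.X-lin2 _ _ FX.in₁ FX.in₂)
            (Y.X-lin2 _ _ FY.in₁ FY.in₂) (X.X-lin2 _ _ FX.in₁ FX.in₂)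
            (trans (PY.Q-coordinates sx rx) (sym (PX.Q-coordinates sx rx)))
            (trans (PX.Q-coordinates sy ry) (sym (PY.Q-coordinates sy ry))) (H-cong before h))
          where
          sx = b z x₂
          rx = b z x₁
          sy = b z y₂
          ry = b z y₁
          l a : V n
          l = sx · x₁ ⊕ rx · x₂
          a = sy · y₁ ⊕ ry · y₂
          c : V n
          c = (z ⊕ l) ⊕ a
          b-c : ∀ w → b c w ≡ b z w + b l w + b a w
          b-c w = trans (b-⊕ˡ _ a w) (cong (_+ b a w) (b-⊕ˡ z l w))
          cancel : ∀ x → x + x + 0# ≡ 0#
          cancel = solve 1 (λ x → x :+ x :+ :0 := :0) refl
          cancel′ : ∀ x → x + 0# + x ≡ 0#
          cancel′ = solve 1 (λ x → x :+ :0 :+ x := :0) refl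
          la⊥ : ∀ {u} → X u → b a u ≡ 0#
          la⊥ xu = trans (b-sym a _) (X⊥Y xu (Y.X-lin2 _ _ FY.in₁ FY.in₂))
          c⊥X : Perp X c
          c⊥X = PX.Perp-spans
            (trans (b-c x₁) (trans (cong₂ (λ s q → rx + s + q) (PX.b-coordinates₁ sx rx) (la⊥ FX.in₁)) (cancel rx)))
            (trans (b-c x₂) (trans (cong₂ (λ s q → sx + s + q) (PX.b-coordinates₂ sx rx) (la⊥ FX.in₂)) (cancel sx)))
          c⊥Y : Perp Y c
          c⊥Y = PY.Perp-spans
            (trans (b-c y₁) (trans (cong₂ (λ s q → ry + s + q) (X⊥Y (X.X-lin2 _ _ FX.in₁ FX.in₂) FY.in₁) (PY.b-coordinates₁ sy ry)) (cancel′ ry)))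
            (trans (b-c y₂) (trans (cong₂ (λ s q → sy + s + q) (X⊥Y (X.X-lin2 _ _ FX.in₁ FX.in₂) FY.in₂) (PY.b-coordinates₂ sy ry)) (cancel′ sy)))
          before : z ≈ ((c ⊕ a) ⊕ l)
          before i = solve 3 (λ z l a → z := (((z :+ l) :+ a) :+ a) :+ l) refl (z i) (l i) (a i)
          after : ((c ⊕ (sy · x₁ ⊕ ry · x₂)) ⊕ (sx · y₁ ⊕ rx · y₂)) ≈ swap-axes z
          after i = trans
            (solve 9 (λ z sx rx sy ry x₁ x₂ y₁ y₂ →
              (((z :+ (sx :* x₁ :+ rx :* x₂)) :+ (sy :* y₁ :+ ry :* y₂)) :+ (sy :* x₁ :+ ry :* x₂)) :+ (sx :* y₁ :+ rx :* y₂) :=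
              z :+ (sx :+ sy) :* (x₁ :+ y₁) :+ (rx :+ ry) :* (x₂ :+ y₂)) refl (z i) sx rx sy ry (x₁ i) (x₂ i) (y₁ i) (y₂ i))
            (cong₂ (λ s q → z i + s * p i + q * r i) (sym (b-⊕ʳ z x₂ y₂)) (sym (b-⊕ʳ z x₁ y₁)))

      swap-HIsometry : HIsometry swap-axes
      swap-HIsometry = involution-HIsometry swap-linear swap-involutive Q-swap H-swap

      swap-y₁ : swap-axes y₁ ≈ x₁
      swap-y₁ i = trans (cong₂ (λ s q → y₁ i + s * p i + q * r i)
          (trans (b-⊕ʳ y₁ x₂ y₂) (cong₂ _+_ (Y⇒Perp FY.in₁ x₂ FX.in₂) FY.b₁₂))
          (trans (b-⊕ʳ y₁ x₁ y₁) (cong₂ _+_ (Y⇒Perp FY.in₁ x₁ FX.in₁) (b-self y₁))))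
        (solve 3 (λ x y r → y :+ (:0 :+ :1) :* (x :+ y) :+ (:0 :+ :0) :* r := x) refl (x₁ i) (y₁ i) (r i))

      swap-y₂ : swap-axes y₂ ≈ x₂
      swap-y₂ i = trans (cong₂ (λ s q → y₂ i + s * p i + q * r i)
          (trans (b-⊕ʳ y₂ x₂ y₂) (cong₂ _+_ (Y⇒Perp FY.in₂ x₂ FX.in₂) (b-self y₂)))
          (trans (b-⊕ʳ y₂ x₁ y₁) (cong₂ _+_ (Y⇒Perp FY.in₂ x₁ FX.in₁) (trans (b-sym y₂ y₁) FY.b₁₂))))
        (solve 3 (λ x y p → y :+ (:0 :+ :0) :* p :+ (:0 :+ :1) :* (x :+ y) := x) refl (x₂ i) (y₂ i) (p i))

    module ConjugateAxes {X Y δ x₁ x₂ y₁ y₂} (AX : Axis Q H X) (AY : Axis Q H Y)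
      (FX : Frame Q δ X x₁ x₂) (FY : Frame Q δ Y y₁ y₂) (δ∉AS : ¬ IsAS δ) where
      private
        module X = Axis AX
        module Y = Axis AY
        module FX = Frame FX
        module FY = Frame FY
        module PX = FrameProperties AX FX
        module PY = FrameProperties AY FY

      Conjugation : Set
      Conjugation = ∃[ g ] (HIsometry g × g y₁ ≈ x₁ × g y₂ ≈ x₂)

      Reach : V n → V n → Set
      Reach u v = ∃[ g ] (HIsometry g × g u ≈ v)

      reach : ∀ {u v} → Center u → Center v → b u v ≢ 0# → Reach u v
      reach cu cv buv≢0 = let g , G , moves , _ = exchange cu cv buv≢0 in g , G , moves

      _then_ : ∀ {u v w} → Reach u v → Reach v w → Reach u w
      (g , G , p) then (f , Fᴴ , r) = (λ y → f (g y)) , (Fᴴ ∘ᴴ G) , ≈-trans (HIsometry.f-cong Fᴴ p) r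

      -- The vectors `x₂` and `y₂` have norm `δ`; the factor `κ` rescales them to centers.
      module Scaled {κ} (κκδ≡1 : κ * κ * δ ≡ 1#) where

        κ≢0 : κ ≢ 0#
        κ≢0 κ≡0 = 0≢1 (trans (sym (trans (cong (λ s → s * s * δ) κ≡0) (solve 1 (λ d → :0 :* :0 :* d := :0) refl δ))) κκδ≡1)

        center-x₁ : Center x₁
        center-x₁ = axis-center AX FX.in₁ FX.Q₁

        center-y₁ : Center y₁
        center-y₁ = axis-center AY FY.in₁ FY.Q₁

        center-x₂ : Center (κ · x₂)
        center-x₂ = axis-center AX (X.X-· κ FX.in₂) (trans (Q-· κ x₂) (trans (cong (κ * κ *_) FX.Q₂) κκδ≡1))

        center-y₂ : Center (κ · y₂)
        center-y₂ = axis-center AY (Y.X-· κ FY.in₂) (trans (Q-· κ y₂) (trans (cong (κ * κ *_) FY.Q₂) κκδ≡1))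

        b-κʳ : ∀ {u v} → b u v ≢ 0# → b u (κ · v) ≢ 0#
        b-κʳ {u} {v} p r = *-nonzero κ≢0 p (trans (sym (b-·ʳ u κ v)) r)

        b-κˡ : ∀ {u v} → b u v ≢ 0# → b (κ · u) v ≢ 0#
        b-κˡ {u} {v} p r = *-nonzero κ≢0 p (trans (sym (b-·ˡ κ u v)) r)

        b-1 : ∀ {u v} → b u v ≡ 1# → b u v ≢ 0#
        b-1 p r = 0≢1 (trans (sym r) p)

        x₂-to-x₁ : Reach (κ · x₂) x₁
        x₂-to-x₁ = reach center-x₂ center-x₁ (b-κˡ (b-1 (trans (b-sym x₂ x₁) FX.b₁₂)))

        y₁-to-y₂ : Reach y₁ (κ · y₂)
        y₁-to-y₂ = reach center-y₁ center-y₂ (b-κʳ (b-1 FY.b₁₂))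

        -- Both g(y₂) and `x₂` pair to 1 with `x₁`, so the isometry exchanging their multiples by
        -- `κ` leaves `x₁` fixed.
        complete : ∀ {g} → HIsometry g → g y₁ ≈ x₁ → b x₂ (g y₂) ≢ 0# → Conjugation
        complete {g} G p b≢0 = conclude (exchange center-gy₂ center-x₂ (b-κˡ (b-κʳ (λ r → b≢0 (trans (b-sym x₂ _) r)))))
          where
          module G = HIsometry G
          center-gy₂ : Center (κ · g y₂)
          center-gy₂ = Center-cong (G.f-· κ y₂) (Center-image G center-y₂)
          b-x₁-gy₂ : b x₁ (g y₂) ≡ 1#
          b-x₁-gy₂ = trans (b-cong (≈-sym p) ≈-refl) (trans (G.b-g y₁ y₂) FY.b₁₂)
          conclude : ∃[ f ] (HIsometry f × f (κ · g y₂) ≈ (κ · x₂) × (∀ z → b z (κ · g y₂) ≡ b z (κ · x₂) → f z ≈ z)) → Conjugation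
          conclude (f , Fᴴ , moves , fixes) = (λ y → f (g y)) , (Fᴴ ∘ᴴ G) ,
            ≈-trans (HIsometry.f-cong Fᴴ p) (fixes x₁ (trans (b-·ʳ x₁ κ _) (trans (cong (κ *_) (trans b-x₁-gy₂ (sym FX.b₁₂))) (sym (b-·ʳ x₁ κ x₂))))) ,
            ⊕-zero (·-zero κ≢0 (λ i → trans (distribˡ κ _ _) (trans (cong (_+ κ * x₂ i)
              (trans (sym (HIsometry.f-· Fᴴ κ (g y₂) i)) (moves i))) (x+x≡0 _))))

        extend : Reach y₁ x₁ → Conjugation
        extend (g , G , p) = cases (b x₂ (g y₂) ≟ 0#)
          where
          module G = HIsometry G
          b-gy₂-x₁ : b (g y₂) x₁ ≡ 1#
          b-gy₂-x₁ = trans (b-cong ≈-refl (≈-sym p)) (trans (G.b-g y₂ y₁) (trans (b-sym y₂ y₁) FY.b₁₂))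
          cases : Dec (b x₂ (g y₂) ≡ 0#) → Conjugation
          cases (no b≢0) = complete G p b≢0
          -- The transvection at `x₁` fixes `x₁` and adds `x₁` to g(y₂), which changes the pairing
          -- with `x₂` from 0 to 1.
          cases (yes b≡0) = complete (Center-HIsometry center-x₁ ∘ᴴ G)
            (≈-trans (t-cong ≈-refl p) (λ i → trans (cong (λ s → x₁ i + s * x₁ i) (b-self x₁)) (solve 1 (λ x → x :+ :0 :* x := x) refl (x₁ i))))
            (λ r → 0≢1 (trans (sym r) (trans (b-+·ʳ x₂ (g y₂) _ x₁) (trans (cong₂ _+_ b≡0 (cong₂ _*_ b-gy₂-x₁ (trans (b-sym x₂ x₁) FX.b₁₂)))
              (solve 0 (:0 :+ :1 :* :1 := :1) refl)))))

        -- Each frame gives a pair of nonperpendicular centers, so one nonperpendicular pair between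
        -- the frames already links `y₁` to `x₁` by a chain of exchanges. If all four pairings
        -- vanish, the axes are perpendicular and `swap-axes` matches the frames at once.
        conjugation : Conjugation
        conjugation = cases (b y₁ x₁ ≟ 0#) (b y₁ x₂ ≟ 0#) (b y₂ x₁ ≟ 0#) (b y₂ x₂ ≟ 0#)
          where
          cases : Dec (b y₁ x₁ ≡ 0#) → Dec (b y₁ x₂ ≡ 0#) → Dec (b y₂ x₁ ≡ 0#) → Dec (b y₂ x₂ ≡ 0#) → Conjugation
          cases (no p) _ _ _ = extend (reach center-y₁ center-x₁ p)
          cases (yes _) (no p) _ _ = extend (reach center-y₁ center-x₂ (b-κʳ p) then x₂-to-x₁)
          cases (yes _) (yes _) (no p) _ = extend (y₁-to-y₂ then reach center-y₂ center-x₁ (b-κˡ p))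
          cases (yes _) (yes _) (yes _) (no p) = extend ((y₁-to-y₂ then reach center-y₂ center-x₂ (b-κˡ (b-κʳ p))) then x₂-to-x₁)
          cases (yes p₁₁) (yes p₁₂) (yes p₂₁) (yes p₂₂) = swap-axes , swap-HIsometry , swap-y₁ , swap-y₂
            where
            X⊥Y : ∀ {u v} → X u → Y v → b u v ≡ 0#
            X⊥Y {u} {v} xu yv = PY.Perp-spans (against y₁ p₁₁ p₁₂) (against y₂ p₂₁ p₂₂) v yv
              where
              against : ∀ y → b y x₁ ≡ 0# → b y x₂ ≡ 0# → b u y ≡ 0#
              against y p₁ p₂ = trans (b-sym u y) (PX.Perp-spans p₁ p₂ u xu)
            open PerpendicularAxes AX AY FX FY X⊥Y

      conjugation : Conjugation
      conjugation = let κ , eq = normaliser {x₂} (λ p → δ∉AS (0# , trans (solve 0 (:0 :* :0 :+ :0 := :0) refl) (trans (sym p) FX.Q₂)))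
                    in Scaled.conjugation {κ} (trans (cong (κ * κ *_) (sym FX.Q₂)) eq)

-- Collineations as semisimilitudes, and their action on axes and frames.

module Hyperovals {q : ℕ} (2∣q : 2 ∣ q) (F : FiniteField q) where
  open Axes 2∣q F public

  Intertwines : ∀ {n} → (V n → Carrier) → (V n → Set) → (V n → Set) → Set
  Intertwines {n} Q S₁ S₂ = ∃[ A ] ∃[ f ] (Semisimilitude {n} Q A f × (∀ v → S₁ v ⟺ S₂ (f v)))

  intertwines : ∀ {n} {Q : V n → Carrier} {S₁ S₂} → IsQuadraticForm n Q → Nondegenerate n Q →
    ∀ {u} → Nonzero u → Q u ≡ 0# → MapsStabilizing n Q S₁ S₂ → Intertwines Q S₁ S₂
  intertwines {S₁ = S₁} {S₂} isQ nondeg u≢0 Qu≡0 (c , stab , maps) = _ , act c , semisimilitude isQ nondeg u≢0 Qu≡0 c stab , maps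

  maps-stabilizing : ∀ {n} {Q : V n → Carrier} {S₁ S₂} → IsQuadraticForm n Q → (∀ {u v} → u ≈ v → S₂ u → S₂ v) →
    Intertwines Q S₁ S₂ → MapsStabilizing n Q S₁ S₂
  maps-stabilizing {n} {Q} {S₁} {S₂} isQ S₂-cong (A , f , S , maps) = build (toCollineation A semilinear kernel)
    where
    open SemisimilitudeProperties isQ S
    build : ∃[ c ] (∀ v → act {n} c v ≈ f v) → MapsStabilizing n Q S₁ S₂
    build (c , acts) = c ,
      (λ v _ → (λ p → trans (Form.Q-cong isQ (acts v)) (trans (Q-f v) (μσ-zero p))) ,
               (λ p → μσ-zero⁻¹ (trans (sym (Q-f v)) (trans (sym (Form.Q-cong isQ (acts v))) p)))) ,
      λ v → (λ s → S₂-cong (≈-sym (acts v)) (proj₁ (maps v) s)) , (λ s → proj₂ (maps v) (S₂-cong (acts v) s))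

  module AxisImage {n} {Q : V n → Carrier} (isQ : IsQuadraticForm n Q) {A : FieldAut} {f : V n → V n}
    (S : Semisimilitude Q A f) where
    open Form isQ
    open SemisimilitudeProperties isQ S
    open ≡-Reasoning

    Image : (V n → Set) → V n → Set
    Image X y = ∃[ x ] (X x × f x ≈ y)

    module _ {H₁ H₂ X : V n → Set} (H₂-cong : ∀ {u v} → u ≈ v → H₂ u → H₂ v) (maps : ∀ v → H₁ v ⟺ H₂ (f v))
      (AX : Axis Q H₁ X) where
      private module X = Axis AX

      -- `f` carries the transvection at a normalised multiple κx to the one at v = f(x): from
      -- κ²Q(x) = 1 and μσ(Q(x)) = 1 follows σ(κ)² = μ, which is exactly the multiplier relating
      -- b(f(w),f(x)) to σ(b(w,x)).
      image-reflects : ∀ {v y} → Image X v → Q v ≡ 1# → H₂ y → H₂ (transvection Q v y)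
      image-reflects {v} {y} (x , xx , fx≈v) Qv≡1 h = at (surjective y)
        where
        ν = Q x
        μσν≡1 : μ * σ ν ≡ 1#
        μσν≡1 = trans (sym (Q-f x)) (trans (Q-cong fx≈v) Qv≡1)
        ν≢0 : ν ≢ 0#
        ν≢0 p = 0≢1 (trans (sym (μσ-zero p)) μσν≡1)
        κ = inv (√ ν) (√-nonzero ν≢0)
        κκν≡1 : κ * κ * ν ≡ 1#
        κκν≡1 = trans (cong (κ * κ *_) (sym (√-square ν))) (trans (solve 2 (λ k s → k :* k :* (s :* s) := (s :* k) :* (s :* k)) refl κ (√ ν))
          (trans (cong₂ _*_ (inv-right _ _) (inv-right _ _)) (*-identityˡ 1#)))
        σκσκ : σ κ * σ κ ≡ μ
        σκσκ = begin
          σ κ * σ κ ≡⟨ sym (*-identityʳ _) ⟩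
          σ κ * σ κ * 1# ≡⟨ cong (σ κ * σ κ *_) (sym μσν≡1) ⟩
          σ κ * σ κ * (μ * σ ν) ≡⟨ solve 3 (λ k m n → k :* k :* (m :* n) := m :* (k :* k :* n)) refl (σ κ) μ (σ ν) ⟩
          μ * (σ κ * σ κ * σ ν) ≡⟨ cong (μ *_) (sym (trans (σ-* _ _) (cong (_* σ ν) (σ-* κ κ)))) ⟩
          μ * σ (κ * κ * ν) ≡⟨ cong (λ s → μ * σ s) κκν≡1 ⟩
          μ * σ 1# ≡⟨ trans (cong (μ *_) σ-1) (*-identityʳ μ) ⟩
          μ ∎
        at : ∃[ w ] f w ≈ y → H₂ (transvection Q v y)
        at (w , fw≈y) = H₂-cong moved (proj₁ (maps _) (X.reflects (X.X-· κ xx) (trans (Q-· κ x) κκν≡1)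
            (proj₂ (maps w) (H₂-cong (≈-sym fw≈y) h))))
          where
          moved : f (transvection Q (κ · x) w) ≈ transvection Q v y
          moved i = begin
            f (w ⊕ b w (κ · x) · (κ · x)) i ≡⟨ trans (f-⊕ _ _ i) (cong (f w i +_) (trans (f-· _ _ i) (cong (σ (b w (κ · x)) *_) (f-· κ x i)))) ⟩
            f w i + σ (b w (κ · x)) * (σ κ * f x i) ≡⟨ cong (λ s → f w i + s * (σ κ * f x i)) (trans (cong σ (b-·ʳ w κ x)) (σ-* _ _)) ⟩
            f w i + σ κ * σ (b w x) * (σ κ * f x i) ≡⟨ solve 4 (λ y k c x → y :+ k :* c :* (k :* x) := y :+ k :* k :* c :* x) refl (f w i) (σ κ) (σ (b w x)) (f x i) ⟩
            f w i + σ κ * σ κ * σ (b w x) * f x i ≡⟨ cong (λ s → f w i + s * f x i) (trans (cong (_* σ (b w x)) σκσκ) (sym (b-f w x))) ⟩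
            f w i + b (f w) (f x) * f x i ≡⟨ cong₂ _+_ (fw≈y i) (cong₂ _*_ (b-cong fw≈y fx≈v) (fx≈v i)) ⟩
            y i + b y v * v i ∎

      axis-image : Axis Q H₂ (Image X)
      axis-image = record
        { X-cong = λ p (x , xx , r) → x , xx , ≈-trans r p
        ; X-lin2 = λ a c (x , xx , p) (y , xy , r) → (σ⁻¹ a · x ⊕ σ⁻¹ c · y) , X.X-lin2 _ _ xx xy ,
            ≈-trans (f-lin2 _ _ x y) (⊕-cong (·-cong (σσ⁻¹ a) p) (·-cong (σσ⁻¹ c) r))
        ; X-anisotropic = λ { (x , xx , p) Q≡0 → ≈-trans (≈-sym p) (f-zero (X.X-anisotropic xx
              (μσ-zero⁻¹ (trans (sym (Q-f x)) (trans (Q-cong p) Q≡0))))) }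
        ; reflects = image-reflects
        ; no-secant = λ {x} {x′} {l} {l′} → no-secant′ x x′ l l′
        }
        where
        no-secant′ : ∀ x x′ l l′ → Nonzero x → Nonzero x′ → Image X l → Image X l′ →
          (∀ v → Image X v → b x v ≡ 0#) → (∀ v → Image X v → b x′ v ≡ 0#) →
          Q (x ⊕ l) ≡ 0# → Q (x′ ⊕ l′) ≡ 0# → b x x′ ≡ 0# → OnTrace Q H₂ x l → OnTrace Q H₂ x′ l′ → Proportional x x′
        no-secant′ x x′ l l′ x≢0 x′≢0 (m , xm , p) (m′ , xm′ , p′) x⊥ x′⊥ Q≡0 Q′≡0 bxx′ T T′ =
          at (surjective x) (surjective x′)
          where
          at : ∃[ w ] f w ≈ x → ∃[ w ] f w ≈ x′ → Proportional x x′
          at (w , r) (w′ , r′) = carry (X.no-secant (nonzero r x≢0) (nonzero r′ x′≢0) xm xm′ (perp r x⊥) (perp r′ x′⊥)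
              (singular r p Q≡0) (singular r′ p′ Q′≡0) (μσ-zero⁻¹ (trans (sym (b-f w w′)) (trans (b-cong r r′) bxx′)))
              (trace r p T) (trace r′ p′ T′))
            where
            nonzero : ∀ {w x} → f w ≈ x → Nonzero x → Nonzero w
            nonzero r x≢0 w≈0 = x≢0 (≈-trans (≈-sym r) (f-zero w≈0))
            perp : ∀ {w x} → f w ≈ x → (∀ v → Image X v → b x v ≡ 0#) → ∀ v → X v → b w v ≡ 0#
            perp {w} r x⊥ v xv = μσ-zero⁻¹ (trans (sym (b-f w v)) (trans (b-cong r ≈-refl) (x⊥ (f v) (v , xv , ≈-refl))))
            sum : ∀ {w x m l} → f w ≈ x → f m ≈ l → f (w ⊕ m) ≈ (x ⊕ l)
            sum {w} {x} {m} r p = ≈-trans (f-⊕ w m) (⊕-cong r p)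
            singular : ∀ {w x m l} → f w ≈ x → f m ≈ l → Q (x ⊕ l) ≡ 0# → Q (w ⊕ m) ≡ 0#
            singular r p Q≡0 = μσ-zero⁻¹ (trans (sym (Q-f _)) (trans (Q-cong (sum r p)) Q≡0))
            trace : ∀ {w x m l} → f w ≈ x → f m ≈ l → OnTrace Q H₂ x l → OnTrace Q H₁ w m
            trace r p (inj₁ (Ql≢0 , h)) = inj₁ ((λ Qm≡0 → Ql≢0 (trans (Q-cong (≈-sym p)) (trans (Q-f _) (μσ-zero Qm≡0)))) ,
              proj₂ (maps _) (H₂-cong (≈-sym (sum r p)) h))
            trace r p (inj₂ (Ql≡0 , ¬h)) = inj₂ (μσ-zero⁻¹ (trans (sym (Q-f _)) (trans (Q-cong p) Ql≡0)) ,
              λ h → ¬h (H₂-cong (sum r p) (proj₁ (maps _) h)))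
            carry : Proportional w w′ → Proportional x x′
            carry (a , a≢0 , s) = σ a , σ-nonzero a≢0 , ≈-trans (≈-sym r) (≈-trans (f-cong s) (≈-trans (f-· a w′) (·-cong refl r′)))

      -- The frame is corrected by a scalar c and a shift t with σ(t)² + σ(t) = δ + σ(δ).
      frame-image : ∀ {δ x₁ x₂} → ¬ IsAS δ → Frame Q δ X x₁ x₂ →
        ∃[ k₁ ] ∃[ k₂ ] (X k₁ × X k₂ × Q k₁ ≢ 0# × Frame Q δ (Image X) (f k₁) (f k₂))
      frame-image {δ} {x₁} {x₂} δ∉AS Fr = shifted (AS-index δ∉AS σδ∉AS)
        where
        open Frame Fr
        σδ∉AS : ¬ IsAS (σ δ)
        σδ∉AS (s , eq) = δ∉AS (σ⁻¹ s , σ-injective (trans (σ-+ _ _) (trans (cong₂ _+_ (trans (σ-* _ _) (cong₂ _*_ (σσ⁻¹ s) (σσ⁻¹ s))) (σσ⁻¹ s)) eq)))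
        r = inv (√ μ) (√-nonzero μ≢0)
        -- Chosen so that f(cx) has norm σ(Q(x)): the multiplier cancels and only the automorphism
        -- remains to be corrected.
        c = σ⁻¹ r
        μrr≡1 : μ * (r * r) ≡ 1#
        μrr≡1 = trans (cong (_* (r * r)) (sym (√-square μ))) (trans (solve 2 (λ s r → s :* s :* (r :* r) := (s :* r) :* (s :* r)) refl (√ μ) r)
          (trans (cong₂ _*_ (inv-right _ _) (inv-right _ _)) (*-identityˡ 1#)))
        scale : ∀ x → μ * σ (c * c * x) ≡ σ x
        scale x = begin
          μ * σ (c * c * x) ≡⟨ cong (μ *_) (trans (σ-* _ _) (cong (_* σ x) (trans (σ-* c c) (cong₂ _*_ (σσ⁻¹ r) (σσ⁻¹ r))))) ⟩
          μ * (r * r * σ x) ≡⟨ sym (*-assoc μ (r * r) (σ x)) ⟩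
          μ * (r * r) * σ x ≡⟨ cong (_* σ x) μrr≡1 ⟩
          1# * σ x ≡⟨ *-identityˡ (σ x) ⟩
          σ x ∎
        c≢0 : c ≢ 0#
        c≢0 c≡0 = 0≢1 (trans (sym (trans (cong (λ s → μ * σ (s * s * 1#)) c≡0) (μσ-zero (solve 0 (:0 :* :0 :* :1 := :0) refl)))) (trans (scale 1#) σ-1))
        shifted : IsAS (δ + σ δ) → ∃[ k₁ ] ∃[ k₂ ] (X k₁ × X k₂ × Q k₁ ≢ 0# × Frame Q δ (Image X) (f k₁) (f k₂))
        shifted (s , ss+s) = k₁ , k₂ , xk₁ , xk₂ , Qk₁≢0 , record
          { in₁ = k₁ , xk₁ , ≈-refl
          ; in₂ = k₂ , xk₂ , ≈-refl
          ; Q₁ = trans (Q-f k₁) (trans (cong (λ z → μ * σ z) (trans (Q-· c x₁) (cong (c * c *_) Q₁))) (trans (scale 1#) σ-1))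
          ; Q₂ = begin
              Q (f k₂) ≡⟨ Q-f k₂ ⟩
              μ * σ (Q k₂) ≡⟨ cong (λ z → μ * σ z) (trans (Q-· c _) (cong (c * c *_) Q-shift)) ⟩
              μ * σ (c * c * (δ + t * t + t)) ≡⟨ scale _ ⟩
              σ (δ + t * t + t) ≡⟨ trans (σ-+ _ _) (cong (_+ σ t) (trans (σ-+ _ _) (cong (σ δ +_) (σ-* t t)))) ⟩
              σ δ + σ t * σ t + σ t ≡⟨ cong (λ z → σ δ + z * z + z) (σσ⁻¹ s) ⟩
              σ δ + s * s + s ≡⟨ +-assoc _ _ _ ⟩
              σ δ + (s * s + s) ≡⟨ cong (σ δ +_) ss+s ⟩
              σ δ + (δ + σ δ) ≡⟨ solve 2 (λ d e → e :+ (d :+ e) := d) refl δ (σ δ) ⟩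
              δ ∎
          ; b₁₂ = trans (b-f k₁ k₂) (trans (cong (λ z → μ * σ z) (trans (b-·ˡ c x₁ k₂) (trans (cong (c *_) (b-·ʳ x₁ c _))
              (trans (cong (λ z → c * (c * z)) b-shift) (sym (*-assoc c c 1#)))))) (trans (scale 1#) σ-1))
          ; nondegenerate = λ {v} (x , xx , p) e₁ e₂ → ≈-trans (≈-sym p) (f-zero
              (let z₁ = back x k₁ p e₁ ; z₂ = back x k₂ p e₂
                   y₁ = integral c≢0 (trans (sym (b-·ʳ x c x₁)) z₁)
                   y₂ = integral c≢0 (trans (sym (b-·ʳ x c _)) z₂)
               in nondegenerate xx y₁ (trans (solve 2 (λ y t → y := y :+ t :* :0) refl _ t)
                    (trans (cong (λ z → b x x₂ + t * z) (sym y₁)) (trans (sym (b-+·ʳ x x₂ t x₁)) y₂)))))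
          }
          where
          t = σ⁻¹ s
          k₁ k₂ : V n
          k₁ = c · x₁
          k₂ = c · (x₂ ⊕ t · x₁)
          xk₁ : X k₁
          xk₁ = X.X-· c in₁
          xk₂ : X k₂
          xk₂ = X.X-· c (X.X-⊕ in₂ (X.X-· t in₁))
          Qk₁≢0 : Q k₁ ≢ 0#
          Qk₁≢0 p = *-nonzero c≢0 c≢0 (trans (sym (*-identityʳ _)) (trans (cong (c * c *_) (sym Q₁)) (trans (sym (Q-· c x₁)) p)))
          Q-shift : Q (x₂ ⊕ t · x₁) ≡ δ + t * t + t
          Q-shift = trans (Q-+· x₂ t x₁) (trans (cong₂ _+_ (cong₂ (λ y z → y + t * t * z) Q₂ Q₁) (cong (t *_) (trans (b-sym x₂ x₁) b₁₂)))
            (solve 2 (λ d t → d :+ t :* t :* :1 :+ t :* :1 := d :+ t :* t :+ t) refl δ t))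
          b-shift : b x₁ (x₂ ⊕ t · x₁) ≡ 1#
          b-shift = trans (b-+·ʳ x₁ x₂ t x₁) (trans (cong₂ (λ y z → y + t * z) b₁₂ (b-self x₁)) (solve 1 (λ t → :1 :+ t :* :0 := :1) refl t))
          back : ∀ x k {v} → f x ≈ v → b v (f k) ≡ 0# → b x k ≡ 0#
          back x k p e = μσ-zero⁻¹ (trans (sym (b-f x k)) (trans (b-cong p ≈-refl) e))

-- The hyperoval H_O described by the projection to Π, and the two implications.

module Correspondence {q : ℕ} (2∣q : 2 ∣ q) (F : FiniteField q) where
  open Hyperovals 2∣q F public

  module Hyperoval {Q : V 6 → Carrier} (isQ : IsQuadraticForm 6 Q) (nondeg : Nondegenerate 6 Q)
    {ι : V 4 → V 6} (ι-linear : IsLinear ι) (elliptic : Elliptic4 (λ x → Q (ι x))) (S : Splitting Q ι) where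
    open Splitting S
    open Restriction isQ ι-linear
    open Form isQ
    open Nondeg nondeg using (b-ext)
    open ≡-Reasoning
    module S₄ = Form isQ₄
    module N₄ = S₄.Nondeg (proj₁ elliptic)
    module LP = Semilinear P-linear
    module T₄ = Tangents isQ₄ (proj₁ elliptic) (λ u v ts → proj₂ (proj₂ elliptic) (u , v , ts))

    δ : Carrier
    δ = Q l₂

    P-ι : ∀ z → P (ι z) ≈ z
    P-ι z = N₄.b-ext λ w → trans (sym (b-P (ι z) w)) (sym (b₄ z w))

    ι-nonzero : ∀ {z} → Nonzero z → Nonzero (ι z)
    ι-nonzero z≢0 p = z≢0 (≈-trans (≈-sym (P-ι _)) (linear-zero P-linear p))

    InL : V 6 → Set
    InL y = P y ≈ 0V

    L-perp : ∀ {l} → InL l → ∀ z → b l (ι z) ≡ 0#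
    L-perp {l} p z = trans (b-P l z) (trans (S₄.b-sym (P l) z) (S₄.b-0ʳ z p))

    perp-L : ∀ {l} → (∀ z → b l (ι z) ≡ 0#) → InL l
    perp-L {l} l⊥ = N₄.b-ext λ z → trans (sym (b-P l z)) (trans (l⊥ z) (sym (trans (S₄.b-sym 0V z) (S₄.b-0ʳ z ≈-refl))))

    L-lin2 : ∀ a c {u v} → InL u → InL v → InL (a · u ⊕ c · v)
    L-lin2 a c {u} {v} p r i = trans (LP.f-lin2 a c u v i) (trans (cong₂ (λ x y → a * x + c * y) (p i) (r i))
      (solve 2 (λ a c → a :* :0 :+ c :* :0 := :0) refl a c))

    L-coordinates : ∀ {y} → InL y → y ≈ (b y l₂ · l₁ ⊕ b y l₁ · l₂)
    L-coordinates {y} p i = trans (split y i) (trans (cong (λ x → x + b y l₂ * l₁ i + b y l₁ * l₂ i) (linear-zero ι-linear p i))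
      (solve 2 (λ x y → :0 :+ x :+ y := x :+ y) refl _ _))

    Π-coordinates : ∀ {y} → b y l₁ ≡ 0# → b y l₂ ≡ 0# → y ≈ ι (P y)
    Π-coordinates {y} p r i = trans (split y i) (trans (cong₂ (λ s t → ι (P y) i + s * l₁ i + t * l₂ i) r p)
      (solve 3 (λ x y z → x :+ :0 :* y :+ :0 :* z := x) refl (ι (P y) i) (l₁ i) (l₂ i)))

    Q-L : ∀ s r → Q (s · l₁ ⊕ r · l₂) ≡ s * s + r * r * δ + s * r
    Q-L s r = trans (Q-lin2 s r l₁ l₂) (trans (cong₂ (λ x y → s * s * x + r * r * δ + s * r * y) Q-l₁ b-l)
      (solve 3 (λ s r d → s :* s :* :1 :+ r :* r :* d :+ s :* r :* :1 := s :* s :+ r :* r :* d :+ s :* r) refl s r δ))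

    norm-zero : ∀ {s r} → s * s + r * r * δ + s * r ≡ 0# → s ≡ 0# × r ≡ 0#
    norm-zero {s} {r} p = cases (r ≟ 0#)
      where
      cases : Dec (r ≡ 0#) → s ≡ 0# × r ≡ 0#
      cases (yes r≡0) = square-zero (trans (solve 2 (λ s d → s :* s := s :* s :+ :0 :* :0 :* d :+ s :* :0) refl s δ)
        (trans (cong (λ r → s * s + r * r * δ + s * r) (sym r≡0)) p)) , r≡0
      cases (no r≢0) = contradiction (s * i , sum-zero (begin
          (s * i) * (s * i) + s * i + δ ≡⟨ cong₂ (λ x y → (s * i) * (s * i) + x + y) (trans (sym (*-identityʳ _)) (cong (s * i *_) (sym ri))) (trans (sym (*-identityʳ _)) (cong (δ *_) (trans (sym (*-identityʳ 1#)) (cong₂ _*_ (sym ri) (sym ri))))) ⟩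
          (s * i) * (s * i) + s * i * (r * i) + δ * ((r * i) * (r * i)) ≡⟨ solve 4 (λ s r i d → (s :* i) :* (s :* i) :+ s :* i :* (r :* i) :+ d :* ((r :* i) :* (r :* i)) := (s :* s :+ r :* r :* d :+ s :* r) :* (i :* i)) refl s r i δ ⟩
          (s * s + r * r * δ + s * r) * (i * i) ≡⟨ cong (_* (i * i)) p ⟩
          0# * (i * i) ≡⟨ zeroˡ _ ⟩
          0# ∎)) δ∉AS
        where
        i = inv r r≢0
        ri = inv-right r r≢0

    L-anisotropic : ∀ {y} → InL y → Q y ≡ 0# → y ≈ 0V
    L-anisotropic {y} p Qy≡0 = let s≡0 , r≡0 = norm-zero (trans (sym (trans (Q-cong (L-coordinates p)) (Q-L (b y l₂) (b y l₁)))) Qy≡0) in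
      ≈-trans (L-coordinates p) (λ i → trans (cong₂ (λ s r → s * l₁ i + r * l₂ i) s≡0 r≡0)
        (solve 2 (λ x y → :0 :* x :+ :0 :* y := :0) refl (l₁ i) (l₂ i)))

    residual : V 6 → V 6
    residual y = y ⊕ ι (P y)

    residual-InL : ∀ y → InL (residual y)
    residual-InL y = ≈-trans (LP.f-⊕ y _) (λ i → trans (cong (P y i +_) (P-ι (P y) i)) (x+x≡0 (P y i)))

    P-sum : ∀ {z l} → InL l → P (ι z ⊕ l) ≈ z
    P-sum {z} p = ≈-trans (LP.f-⊕ _ _) (λ i → trans (cong₂ _+_ (P-ι z i) (p i)) (+-identityʳ (z i)))

    Q-sum : ∀ {z l} → InL l → Q (ι z ⊕ l) ≡ Q₄ z + Q l
    Q-sum {z} {l} p = trans (Q-⊕ (ι z) l) (trans (cong (Q₄ z + Q l +_) (trans (b-sym (ι z) l) (L-perp p z))) (+-identityʳ _))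

    Q-residual : ∀ y → Q y ≡ Q₄ (P y) + Q (residual y)
    Q-residual y = trans (Q-cong (λ i → solve 2 (λ x y → x := y :+ (x :+ y)) refl (y i) (ι (P y) i))) (Q-sum (residual-InL y))

    in-Π : ∀ {y} → Q y ≡ 0# → Q₄ (P y) ≡ 0# → y ≈ ι (P y)
    in-Π {y} Qy≡0 Q₄≡0 = ⊕-zero (L-anisotropic (residual-InL y)
      (trans (sym (+-identityˡ _)) (trans (cong (_+ Q (residual y)) (sym Q₄≡0)) (trans (sym (Q-residual y)) Qy≡0))))

    l₁-InL : InL l₁
    l₁-InL = perp-L l₁⊥

    l₂-InL : InL l₂
    l₂-InL = perp-L l₂⊥

    L-frame : Frame Q δ InL l₁ l₂
    L-frame = record
      { in₁ = l₁-InL ; in₂ = l₂-InL ; Q₁ = Q-l₁ ; Q₂ = refl ; b₁₂ = b-l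
      ; nondegenerate = λ {v} p e₁ e₂ → ≈-trans (L-coordinates p) (λ i → trans (cong₂ (λ s r → s * l₁ i + r * l₂ i) e₂ e₁)
          (solve 2 (λ x y → :0 :* x :+ :0 :* y := :0) refl (l₁ i) (l₂ i))) }

    module Points {O : V 4 → Set} (ovoid : IsOvoid Q₄ O) where
      open T₄.Ovoid ovoid public

      -- H_O in terms of the projection P y of y on Π.
      InH : V 6 → Set
      InH y = Nonzero y × Q y ≡ 0# × ((Q₄ (P y) ≢ 0# × O (P y)) ⊎ (Q₄ (P y) ≡ 0# × ¬ O (P y)))

      InH-cong : ∀ {u v} → u ≈ v → InH u → InH v
      InH-cong {u} {v} p (u≢0 , Qu≡0 , alt) = Nonzero-cong p u≢0 , trans (Q-cong (≈-sym p)) Qu≡0 , move alt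
        where
        Pp : P u ≈ P v
        Pp = LP.f-cong p
        move : (Q₄ (P u) ≢ 0# × O (P u)) ⊎ (Q₄ (P u) ≡ 0# × ¬ O (P u)) → (Q₄ (P v) ≢ 0# × O (P v)) ⊎ (Q₄ (P v) ≡ 0# × ¬ O (P v))
        move (inj₁ (Q≢0 , o)) = inj₁ ((λ r → Q≢0 (trans (S₄.Q-cong Pp) r)) , O-cong Pp o)
        move (inj₂ (Q≡0 , ¬o)) = inj₂ (trans (S₄.Q-cong (≈-sym Pp)) Q≡0 , λ o → ¬o (O-cong (≈-sym Pp) o))

      -- The vanishing of `Q₄ (P y)` is decidable and `O` is stable, so `InH` inherits stability;
      -- the axis arguments by contradiction depend on it.
      InH-stable : ∀ {y} → ¬ ¬ InH y → InH y
      InH-stable {y} ¬¬h = (λ y≈0 → ¬¬h (λ (y≢0 , _) → y≢0 y≈0)) ,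
          decidable-stable (Q y ≟ 0#) (λ Q≢0 → ¬¬h (λ (_ , Q≡0 , _) → Q≢0 Q≡0)) , cases (Q₄ (P y) ≟ 0#)
        where
        cases : Dec (Q₄ (P y) ≡ 0#) → (Q₄ (P y) ≢ 0# × O (P y)) ⊎ (Q₄ (P y) ≡ 0# × ¬ O (P y))
        cases (yes Q₄≡0) = inj₂ (Q₄≡0 , λ o → ¬¬h (λ { (_ , _ , inj₁ (Q₄≢0 , _)) → Q₄≢0 Q₄≡0 ; (_ , _ , inj₂ (_ , ¬o)) → ¬o o }))
        cases (no Q₄≢0) = inj₁ (Q₄≢0 , O-stable (S₄.nonzero-ofQ Q₄≢0) (λ ¬o → ¬¬h
          (λ { (_ , _ , inj₁ (_ , o)) → ¬o o ; (_ , _ , inj₂ (Q₄≡0 , _)) → Q₄≢0 Q₄≡0 })))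

      InH-conic : ∀ {z l} → O z → Q₄ z ≢ 0# → InL l → Q l ≡ Q₄ z → InH (ι z ⊕ l)
      InH-conic {z} {l} o Q₄≢0 p Ql≡Q₄z =
        (λ s≈0 → S₄.nonzero-ofQ Q₄≢0 (≈-trans (≈-sym (P-sum p)) (linear-zero P-linear s≈0))) ,
        trans (Q-sum p) (trans (cong (Q₄ z +_) Ql≡Q₄z) (x+x≡0 _)) ,
        inj₁ ((λ r → Q₄≢0 (trans (S₄.Q-cong (≈-sym (P-sum p))) r)) , O-cong (≈-sym (P-sum p)) o)

      conic-O : ∀ {y z} → P y ≈ z → Q₄ z ≢ 0# → InH y → O z
      conic-O p Q₄≢0 (_ , _ , inj₁ (_ , o)) = O-cong p o
      conic-O p Q₄≢0 (_ , _ , inj₂ (Q₄≡0 , _)) = contradiction (trans (S₄.Q-cong (≈-sym p)) Q₄≡0) Q₄≢0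

      InH-quadric : ∀ {y z} → P y ≈ z → Q y ≡ 0# → Q₄ z ≡ 0# → Nonzero z → ¬ O z → InH y
      InH-quadric {y} {z} p Qy≡0 Q₄≡0 z≢0 ¬o =
        (λ y≈0 → z≢0 (≈-trans (≈-sym p) (linear-zero P-linear y≈0))) , Qy≡0 ,
        inj₂ (trans (S₄.Q-cong p) Q₄≡0 , λ o → ¬o (O-cong p o))

      quadric-¬O : ∀ {y z} → P y ≈ z → Q₄ z ≡ 0# → InH y → ¬ O z
      quadric-¬O p Q₄≡0 (_ , _ , inj₁ (Q₄≢0 , _)) = contradiction (trans (S₄.Q-cong p) Q₄≡0) Q₄≢0
      quadric-¬O p Q₄≡0 (_ , _ , inj₂ (_ , ¬o)) o = ¬o (O-cong (≈-sym p) o)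

      -- Agrees definitionally with `H Q E O` when `ι` is `apply E`.
      HO : V 6 → Set
      HO y = (∃[ x ] (O x × Q₄ x ≢ 0# × Nonzero y × Q y ≡ 0# × (∀ z → πplane Q₄ x z → b y (ι z) ≡ 0#)))
           ⊎ (∃[ x ] (Nonzero x × y ≈ ι x × Q₄ x ≡ 0# × ¬ O x))

      HO⇒InH : ∀ {y} → HO y → InH y
      HO⇒InH {y} (inj₂ (x , x≢0 , p , Q₄≡0 , ¬o)) =
        InH-quadric (≈-trans (LP.f-cong p) (P-ι x)) (trans (Q-cong p) Q₄≡0) Q₄≡0 x≢0 ¬o
      HO⇒InH {y} (inj₁ (x , o , Q₄≢0 , y≢0 , Qy≡0 , perp)) = y≢0 , Qy≡0 ,
          inj₁ (multiple (T₄.perp-perp (O-nonzero o) (λ z z≢0 alt → trans (sym (b-P y z)) (perp z (z≢0 , alt)))))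
        where
        multiple : ∃[ c ] (P y ≈ (c · x)) → Q₄ (P y) ≢ 0# × O (P y)
        multiple (c , p) = (λ r → *-nonzero (*-nonzero c≢0 c≢0) Q₄≢0 (trans (sym (S₄.Q-· c x)) (trans (S₄.Q-cong (≈-sym p)) r))) ,
            O-cong (≈-sym p) (O-· c≢0 o)
          where
          c≢0 : c ≢ 0#
          c≢0 c≡0 = y≢0 (L-anisotropic (≈-trans p (λ i → trans (cong (_* x i) c≡0) (zeroˡ (x i)))) Qy≡0)

      InH⇒HO : ∀ {y} → InH y → HO y
      InH⇒HO {y} (y≢0 , Qy≡0 , inj₁ (Q₄≢0 , o)) = inj₁ (P y , o , Q₄≢0 , y≢0 , Qy≡0 , λ z πz → trans (b-P y z) (perp πz))
        where
        perp : ∀ {z} → πplane Q₄ (P y) z → S₄.b (P y) z ≡ 0#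
        perp {z} (_ , inj₁ (a , _ , p)) = trans (S₄.b-cong ≈-refl p) (trans (S₄.b-·ʳ (P y) a (P y)) (trans (cong (a *_) (S₄.b-self (P y))) (zeroʳ a)))
        perp (_ , inj₂ line) = T₄.WLine⇒perp line
      InH⇒HO {y} (y≢0 , Qy≡0 , inj₂ (Q₄≡0 , ¬o)) = inj₂ (P y ,
        (λ Py≈0 → y≢0 (≈-trans (in-Π Qy≡0 Q₄≡0) (linear-zero ι-linear Py≈0))) , in-Π Qy≡0 Q₄≡0 , Q₄≡0 , ¬o)

      private
        t-P : ∀ {v} → InL v → ∀ y → P (transvection Q v y) ≈ P y
        t-P {v} p y = ≈-trans (LP.f-⊕ y _) (λ i → trans (cong (P y i +_) (trans (LP.f-· _ v i) (trans (cong (b y v *_) (p i)) (zeroʳ _)))) (+-identityʳ _))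

      -- Transvections centered on Π^ζ do not change the projection to Π, which decides membership
      -- of a nonzero singular vector. A vector perpendicular to Π^ζ lies in Π, and `OnTrace` puts
      -- it in `O`; the absence of secants is then `O-unique`.
      L-axis : Axis Q InH InL
      L-axis = record
        { X-cong = λ p r → ≈-trans (LP.f-cong (≈-sym p)) r
        ; X-lin2 = L-lin2
        ; X-anisotropic = L-anisotropic
        ; reflects = reflects
        ; no-secant = λ x≢0 x′≢0 xl xl′ x⊥ x′⊥ Q≡0 Q′≡0 bxx′ T T′ →
            lift x⊥ x′⊥ (O-unique (trace x≢0 xl x⊥ Q≡0 T) (trace x′≢0 xl′ x′⊥ Q′≡0 T′) (project x′⊥ bxx′))
        }
        where
        module A = AxisTheory isQ {InH} InH-cong InH-stable (λ (_ , Q≡0 , _) → Q≡0)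
        reflects : ∀ {v y} → InL v → Q v ≡ 1# → InH y → InH (transvection Q v y)
        reflects {v} {y} p Qv≡1 (y≢0 , Qy≡0 , alt) = nonzero , trans (A.Q-t Qv≡1 y) Qy≡0 , transfer alt
          where
          nonzero : Nonzero (transvection Q v y)
          nonzero r = y≢0 (≈-trans (≈-sym (A.t-involutive v y)) (linear-zero (A.t-linear v) r))
          transfer : (Q₄ (P y) ≢ 0# × O (P y)) ⊎ (Q₄ (P y) ≡ 0# × ¬ O (P y)) →
                     (Q₄ (P (transvection Q v y)) ≢ 0# × O (P (transvection Q v y))) ⊎ (Q₄ (P (transvection Q v y)) ≡ 0# × ¬ O (P (transvection Q v y)))
          transfer (inj₁ (Q≢0 , o)) = inj₁ ((λ r → Q≢0 (trans (S₄.Q-cong (≈-sym (t-P p y))) r)) , O-cong (≈-sym (t-P p y)) o)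
          transfer (inj₂ (Q≡0 , ¬o)) = inj₂ (trans (S₄.Q-cong (t-P p y)) Q≡0 , λ o → ¬o (O-cong (t-P p y) o))
        in-Π′ : ∀ {x} → (∀ v → InL v → b x v ≡ 0#) → x ≈ ι (P x)
        in-Π′ x⊥ = Π-coordinates (x⊥ l₁ l₁-InL) (x⊥ l₂ l₂-InL)
        trace : ∀ {x l} → Nonzero x → InL l → (∀ v → InL v → b x v ≡ 0#) → Q (x ⊕ l) ≡ 0# → OnTrace Q InH x l → O (P x)
        trace {x} {l} x≢0 p x⊥ Q≡0 T = cases T
          where
          P≈ : P (x ⊕ l) ≈ P x
          P≈ = ≈-trans (LP.f-⊕ x l) (λ i → trans (cong (P x i +_) (p i)) (+-identityʳ _))
          Q₄≡Ql : Q₄ (P x) ≡ Q l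
          Q₄≡Ql = trans (Q-cong (≈-sym (in-Π′ x⊥))) (A.equal-of-perp-singular (x⊥ l p) Q≡0)
          cases : OnTrace Q InH x l → O (P x)
          cases (inj₁ (Ql≢0 , h)) = conic-O P≈ (λ r → Ql≢0 (trans (sym Q₄≡Ql) r)) h
          cases (inj₂ (Ql≡0 , ¬h)) = O-stable Px≢0 (λ ¬o → ¬h (InH-quadric P≈ Q≡0 (trans Q₄≡Ql Ql≡0) Px≢0 ¬o))
            where
            Px≢0 : Nonzero (P x)
            Px≢0 r = x≢0 (≈-trans (in-Π′ x⊥) (linear-zero ι-linear r))
        project : ∀ {x x′} → (∀ v → InL v → b x′ v ≡ 0#) → b x x′ ≡ 0# → S₄.b (P x) (P x′) ≡ 0#
        project {x} {x′} x′⊥ bxx′ = trans (sym (b-P x (P x′))) (trans (b-cong ≈-refl (≈-sym (in-Π′ x′⊥))) bxx′)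
        lift : ∀ {x x′} → (∀ v → InL v → b x v ≡ 0#) → (∀ v → InL v → b x′ v ≡ 0#) → Proportional (P x) (P x′) → Proportional x x′
        lift x⊥ x′⊥ (a , a≢0 , p) = a , a≢0 , ≈-trans (in-Π′ x⊥) (≈-trans (Lι.f-cong p)
          (≈-trans (Lι.f-· a _) (·-cong refl (≈-sym (in-Π′ x′⊥)))))

    module Pair {O₁ O₂ : V 4 → Set} (ovoid₁ : IsOvoid Q₄ O₁) (ovoid₂ : IsOvoid Q₄ O₂) where
      private
        module P₁ = Points ovoid₁
        module P₂ = Points ovoid₂

      -- A semisimilitude of V taking H_{O₁} to H_{O₂} and Π to Π.
      module Restrict {A : FieldAut} {f : V 6 → V 6} (sim : Semisimilitude Q A f) (maps : ∀ y → P₁.InH y ⟺ P₂.InH (f y))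
        {k} (k-InL : InL k) (Qk≢0 : Q k ≢ 0#) (fk≈l₁ : f k ≈ l₁) (f-Π : ∀ z → f (ι z) ≈ ι (P (f (ι z)))) where
        open SemisimilitudeProperties isQ sim

        θ : V 4 → V 4
        θ z = P (f (ι z))

        Q₄-θ : ∀ z → Q₄ (θ z) ≡ μ * σ (Q₄ z)
        Q₄-θ z = trans (Q-cong (≈-sym (f-Π z))) (Q-f (ι z))

        θ-kernel : ∀ z → θ z ≈ 0V → z ≈ 0V
        θ-kernel z p = ≈-trans (≈-sym (P-ι z)) (linear-zero P-linear (kernel (ι z) (≈-trans (f-Π z) (linear-zero ι-linear p))))

        θ-semisimilitude : Semisimilitude Q₄ A θ
        θ-semisimilitude = record
          { semilinear = ∘-semilinear P-linear (∘-semilinear semilinear ι-linear)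
          ; kernel = θ-kernel ; μ = μ ; μ≢0 = μ≢0 ; Q-f = Q₄-θ }

        -- Scales `k` to the norm of `z`, so that `conic-point z` is singular. For nonsingular `z`
        -- it lies on the conic C_z, and membership of `z` in the ovoid can be read from it.
        c : V 4 → Carrier
        c z = √ (Q₄ z * inv (Q k) Qk≢0)

        conic-point : V 4 → V 6
        conic-point z = ι z ⊕ c z · k

        c-InL : ∀ z → InL (c z · k)
        c-InL z = ≈-trans (LP.f-· (c z) k) (λ i → trans (cong (c z *_) (k-InL i)) (zeroʳ _))

        Q-c : ∀ z → Q (c z · k) ≡ Q₄ z
        Q-c z = trans (Q-· (c z) k) (trans (cong (_* Q k) (√-square _))
          (trans (solve 3 (λ a i k → a :* i :* k := a :* (k :* i)) refl (Q₄ z) (inv (Q k) Qk≢0) (Q k)) (trans (cong (Q₄ z *_) (inv-right _ Qk≢0)) (*-identityʳ _))))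

        P-f-conic : ∀ z → P (f (conic-point z)) ≈ θ z
        P-f-conic z = ≈-trans (LP.f-cong (f-⊕ (ι z) (c z · k))) (≈-trans (LP.f-⊕ _ _) (λ i → trans
          (cong (θ z i +_) (trans (LP.f-cong (≈-trans (f-· (c z) k) (·-cong refl fk≈l₁)) i) (trans (LP.f-· (σ (c z)) l₁ i)
            (trans (cong (σ (c z) *_) (l₁-InL i)) (zeroʳ _))))) (+-identityʳ _)))

        θ-nonzero : ∀ {z} → Nonzero z → Nonzero (θ z)
        θ-nonzero z≢0 p = z≢0 (θ-kernel _ p)

        θ-zero : ∀ {z} → z ≈ 0V → θ z ≈ 0V
        θ-zero p = linear-zero P-linear (f-zero (linear-zero ι-linear p))

        -- On the quadric, `InH` records the complement of the ovoid, so each implication comes out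
        -- doubly negated and `O-stable` removes the negations. Off the quadric the conic point is
        -- followed through `f`.
        θ-maps : ∀ z → O₁ z ⟺ O₂ (θ z)
        θ-maps z = (λ o → forward o (Q₄ z ≟ 0#)) , (λ o → backward o (Q₄ z ≟ 0#))
          where
          forward : O₁ z → Dec (Q₄ z ≡ 0#) → O₂ (θ z)
          forward o (yes Q₄≡0) = P₂.O-stable (θ-nonzero (P₁.O-nonzero o)) λ ¬o →
            P₁.quadric-¬O (P-ι z) Q₄≡0 (proj₂ (maps (ι z)) (P₂.InH-quadric ≈-refl (trans (Q-f (ι z)) (μσ-zero Q₄≡0))
              (trans (Q₄-θ z) (μσ-zero Q₄≡0)) (θ-nonzero (P₁.O-nonzero o)) ¬o)) o
          forward o (no Q₄≢0) = P₂.conic-O (P-f-conic z) (λ r → Q₄≢0 (μσ-zero⁻¹ (trans (sym (Q₄-θ z)) r)))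
            (proj₁ (maps (conic-point z)) (P₁.InH-conic o Q₄≢0 (c-InL z) (Q-c z)))
          backward : O₂ (θ z) → Dec (Q₄ z ≡ 0#) → O₁ z
          backward o (yes Q₄≡0) = P₁.O-stable z≢0 λ ¬o →
            P₂.quadric-¬O ≈-refl (trans (Q₄-θ z) (μσ-zero Q₄≡0)) (proj₁ (maps (ι z)) (P₁.InH-quadric (P-ι z) Q₄≡0 Q₄≡0 z≢0 ¬o)) o
            where
            z≢0 : Nonzero z
            z≢0 p = P₂.O-nonzero o (θ-zero p)
          backward o (no Q₄≢0) = P₁.conic-O (P-sum (c-InL z)) Q₄≢0 (proj₂ (maps (conic-point z))
            (P₂.InH-cong (≈-sym conic-image) (P₂.InH-conic o θ≢0 image-InL image-Q)))
            where
            θ≢0 : Q₄ (θ z) ≢ 0#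
            θ≢0 r = Q₄≢0 (μσ-zero⁻¹ (trans (sym (Q₄-θ z)) r))
            f-ck≈ : f (c z · k) ≈ (σ (c z) · l₁)
            f-ck≈ = ≈-trans (f-· (c z) k) (·-cong refl fk≈l₁)
            conic-image : f (conic-point z) ≈ (ι (θ z) ⊕ f (c z · k))
            conic-image = ≈-trans (f-⊕ (ι z) (c z · k)) (⊕-cong (f-Π z) ≈-refl)
            image-InL : InL (f (c z · k))
            image-InL = ≈-trans (LP.f-cong f-ck≈) (≈-trans (LP.f-· _ l₁) (λ i → trans (cong (σ (c z) *_) (l₁-InL i)) (zeroʳ _)))
            image-Q : Q (f (c z · k)) ≡ Q₄ (θ z)
            image-Q = trans (Q-f _) (trans (cong (λ s → μ * σ s) (Q-c z)) (sym (Q₄-θ z)))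

      restrict : Intertwines Q P₁.InH P₂.InH → Intertwines Q₄ O₁ O₂
      restrict (A , f , sim , maps) = with-frame (I.frame-image P₂.InH-cong maps P₁.L-axis δ∉AS L-frame)
        where
        module I = AxisImage isQ sim
        module S₁ = SemisimilitudeProperties isQ sim
        module AT = AxisTheory isQ {P₂.InH} P₂.InH-cong P₂.InH-stable (λ (_ , Q≡0 , _) → Q≡0)
        with-frame : ∃[ k₁ ] ∃[ k₂ ] (InL k₁ × InL k₂ × Q k₁ ≢ 0# × Frame Q δ (I.Image InL) (f k₁) (f k₂)) → Intertwines Q₄ O₁ O₂
        with-frame (k₁ , k₂ , k₁-InL , k₂-InL , Qk₁≢0 , frame) =
            corrected (AT.ConjugateAxes.conjugation P₂.L-axis (I.axis-image P₂.InH-cong maps P₁.L-axis) L-frame frame δ∉AS)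
          where
          corrected : ∃[ g ] (AT.HIsometry g × g (f k₁) ≈ l₁ × g (f k₂) ≈ l₂) → Intertwines Q₄ O₁ O₂
          corrected (g , G , gfk₁≈l₁ , gfk₂≈l₂) = A , R.θ , R.θ-semisimilitude , R.θ-maps
            where
            module G = AT.HIsometry G
            g-kernel : ∀ y → g y ≈ 0V → y ≈ 0V
            g-kernel y p = nondeg y (λ w → trans (sym (G.b-g y w)) (trans (b-sym (g y) (g w)) (b-0ʳ (g w) p)))
            gf-semisimilitude : Semisimilitude Q A (λ y → g (f y))
            gf-semisimilitude = record
              { semilinear = ∘-semilinear G.g-linear S₁.semilinear
              ; kernel = λ y p → S₁.kernel y (g-kernel (f y) p)
              ; μ = S₁.μ ; μ≢0 = S₁.μ≢0 ; Q-f = λ y → trans (G.Q-g (f y)) (S₁.Q-f y) }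
            -- As g ∘ f sends `k₁`, `k₂` to `l₁`, `l₂` and preserves perpendicularity, the image of
            -- Π is perpendicular to Π^ζ, hence contained in Π.
            perp : ∀ z {k l} → InL k → g (f k) ≈ l → b (g (f (ι z))) l ≡ 0#
            perp z {k} {l} k-InL p = trans (b-cong ≈-refl (≈-sym p)) (trans (G.b-g _ _) (trans (S₁.b-f (ι z) k)
              (S₁.μσ-zero (trans (b-sym (ι z) k) (L-perp k-InL z)))))
            module R = Restrict gf-semisimilitude
              (λ y → (λ h → G.H-g (proj₁ (maps y) h)) , (λ h → proj₂ (maps y) (G.H-g⁻¹ h)))
              k₁-InL Qk₁≢0 gfk₁≈l₁ (λ z → Π-coordinates (perp z k₁-InL gfk₁≈l₁) (perp z k₂-InL gfk₂≈l₂))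

      -- On Π^ζ the extension is l₁ ↦ √μ l₁, l₂ ↦ √μ (t l₁ + l₂) with t² + t = δ + σ(δ).
      extend : Intertwines Q₄ O₁ O₂ → Intertwines Q P₁.InH P₂.InH
      extend (A , θ , sim , maps) = extension (AS-index δ∉AS σδ∉AS)
        where
        open SemisimilitudeProperties isQ₄ sim
        σδ∉AS : ¬ IsAS (σ δ)
        σδ∉AS (s , eq) = δ∉AS (σ⁻¹ s , σ-injective (trans (σ-+ _ _) (trans (cong₂ _+_ (trans (σ-* _ _) (cong₂ _*_ (σσ⁻¹ s) (σσ⁻¹ s))) (σσ⁻¹ s)) eq)))
        r = √ μ
        extension : IsAS (δ + σ δ) → Intertwines Q P₁.InH P₂.InH
        extension (t , tt+t) = A , f , f-semisimilitude , f-maps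
          where
          coefficient₁ coefficient₂ : V 6 → Carrier
          coefficient₁ y = r * (σ (b y l₂) + t * σ (b y l₁))
          coefficient₂ y = r * σ (b y l₁)
          onL : V 6 → V 6
          onL y = coefficient₁ y · l₁ ⊕ coefficient₂ y · l₂
          f : V 6 → V 6
          f y = ι (θ (P y)) ⊕ onL y
          onL-InL : ∀ y → InL (onL y)
          onL-InL y = L-lin2 (coefficient₁ y) (coefficient₂ y) l₁-InL l₂-InL
          P-f : ∀ y → P (f y) ≈ θ (P y)
          P-f y = P-sum (onL-InL y)
          onL-semilinear : IsSemilinear σ onL
          onL-semilinear = record
            { f-cong = λ p → ⊕-cong (·-cong (cong₂ (λ s q → r * (σ s + t * σ q)) (b-cong p ≈-refl) (b-cong p ≈-refl)) ≈-refl)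
                (·-cong (cong (λ s → r * σ s) (b-cong p ≈-refl)) ≈-refl)
            ; f-⊕ = λ u v i → trans (cong₂ (λ s q → r * (s + t * q) * l₁ i + r * q * l₂ i)
                (trans (cong σ (b-⊕ˡ u v l₂)) (σ-+ _ _)) (trans (cong σ (b-⊕ˡ u v l₁)) (σ-+ _ _)))
                (solve 8 (λ r t s s′ q q′ x y → r :* ((s :+ s′) :+ t :* (q :+ q′)) :* x :+ r :* (q :+ q′) :* y :=
                  (r :* (s :+ t :* q) :* x :+ r :* q :* y) :+ (r :* (s′ :+ t :* q′) :* x :+ r :* q′ :* y)) refl
                  r t (σ (b u l₂)) (σ (b v l₂)) (σ (b u l₁)) (σ (b v l₁)) (l₁ i) (l₂ i))
            ; f-· = λ a v i → trans (cong₂ (λ s q → r * (s + t * q) * l₁ i + r * q * l₂ i)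
                (trans (cong σ (b-·ˡ a v l₂)) (σ-* _ _)) (trans (cong σ (b-·ˡ a v l₁)) (σ-* _ _)))
                (solve 7 (λ r t a s q x y → r :* (a :* s :+ t :* (a :* q)) :* x :+ r :* (a :* q) :* y :=
                  a :* (r :* (s :+ t :* q) :* x :+ r :* q :* y)) refl r t (σ a) (σ (b v l₂)) (σ (b v l₁)) (l₁ i) (l₂ i))
            }
          ιθP-semilinear : IsSemilinear σ (λ y → ι (θ (P y)))
          ιθP-semilinear = ∘-semilinear ι-linear (∘-semilinear semilinear P-linear)
          Q-onL : ∀ y → Q (onL y) ≡ μ * σ (Q (residual y))
          Q-onL y = begin
            Q (onL y) ≡⟨ Q-L (coefficient₁ y) (coefficient₂ y) ⟩
            (r * (s + t * s′)) * (r * (s + t * s′)) + (r * s′) * (r * s′) * δ + (r * (s + t * s′)) * (r * s′) ≡⟨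
              solve 5 (λ r t s s′ d → (r :* (s :+ t :* s′)) :* (r :* (s :+ t :* s′)) :+ (r :* s′) :* (r :* s′) :* d :+ (r :* (s :+ t :* s′)) :* (r :* s′) :=
                (r :* r) :* (s :* s :+ s′ :* s′ :* (d :+ (t :* t :+ t)) :+ s :* s′)) refl r t s s′ δ ⟩
            -- The shift by `t` adds t² + t = δ + σ(δ) to `δ`, leaving σ(δ): the norm form with its
            -- coefficients twisted by `σ`.
            (r * r) * (s * s + s′ * s′ * (δ + (t * t + t)) + s * s′) ≡⟨ cong₂ (λ m d → m * (s * s + s′ * s′ * (δ + d) + s * s′)) (√-square μ) tt+t ⟩
            μ * (s * s + s′ * s′ * (δ + (δ + σ δ)) + s * s′) ≡⟨ cong (λ d → μ * (s * s + s′ * s′ * d + s * s′)) (solve 2 (λ d e → d :+ (d :+ e) := e) refl δ (σ δ)) ⟩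
            μ * (s * s + s′ * s′ * σ δ + s * s′) ≡⟨ cong (μ *_) (sym σ-norm) ⟩
            μ * σ (x * x + y′ * y′ * δ + x * y′) ≡⟨ cong (λ n → μ * σ n) (sym (trans (Q-cong residual≈) (Q-L x y′))) ⟩
            μ * σ (Q (residual y)) ∎
            where
            x = b y l₂
            y′ = b y l₁
            s = σ x
            s′ = σ y′
            σ-norm : σ (x * x + y′ * y′ * δ + x * y′) ≡ s * s + s′ * s′ * σ δ + s * s′
            σ-norm = trans (σ-+ _ _) (cong₂ _+_ (trans (σ-+ _ _) (cong₂ _+_ (σ-* x x) (trans (σ-* _ _) (cong (_* σ δ) (σ-* y′ y′))))) (σ-* x y′))
            residual≈ : residual y ≈ (x · l₁ ⊕ y′ · l₂)
            residual≈ i = trans (cong (_+ ι (P y) i) (split y i)) (solve 3 (λ a b c → (a :+ b :+ c) :+ a := b :+ c) refl (ι (P y) i) _ _)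
          Q-f₆ : ∀ y → Q (f y) ≡ μ * σ (Q y)
          Q-f₆ y = trans (Q-sum (onL-InL y)) (trans (cong₂ _+_ (Q-f (P y)) (Q-onL y)) (trans (sym (distribˡ μ _ _))
            (cong (μ *_) (trans (sym (σ-+ _ _)) (cong σ (sym (Q-residual y)))))))
          f-semisimilitude : Semisimilitude Q A f
          f-semisimilitude = record
            { semilinear = record
                { f-cong = λ p → ⊕-cong (IsSemilinear.f-cong ιθP-semilinear p) (IsSemilinear.f-cong onL-semilinear p)
                ; f-⊕ = λ u v i → trans (cong₂ _+_ (IsSemilinear.f-⊕ ιθP-semilinear u v i) (IsSemilinear.f-⊕ onL-semilinear u v i))
                    (solve 4 (λ a b c d → (a :+ b) :+ (c :+ d) := (a :+ c) :+ (b :+ d)) refl (ι (θ (P u)) i) (ι (θ (P v)) i) (onL u i) (onL v i))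
                ; f-· = λ a v i → trans (cong₂ _+_ (IsSemilinear.f-· ιθP-semilinear a v i) (IsSemilinear.f-· onL-semilinear a v i)) (sym (distribˡ (σ a) _ _))
                }
            -- From f(y) = 0 the projection of `y` to Π vanishes and Q(y) = 0, so `y` is a singular
            -- vector of Π^ζ.
            ; kernel = λ y p → L-anisotropic (kernel (P y) (≈-trans (≈-sym (P-f y)) (linear-zero P-linear p)))
                (μσ-zero⁻¹ (trans (sym (Q-f₆ y)) (Q-0 p)))
            ; μ = μ ; μ≢0 = μ≢0 ; Q-f = Q-f₆ }
          module S₆′ = SemisimilitudeProperties isQ f-semisimilitude
          Q₄-f : ∀ y → Q₄ (P (f y)) ≡ μ * σ (Q₄ (P y))
          Q₄-f y = trans (S₄.Q-cong (P-f y)) (Q-f (P y))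
          f-maps : ∀ y → P₁.InH y ⟺ P₂.InH (f y)
          f-maps y = forward , backward
            where
            forward : P₁.InH y → P₂.InH (f y)
            forward (y≢0 , Q≡0 , alt) = (λ p → y≢0 (S₆′.kernel y p)) , trans (Q-f₆ y) (μσ-zero Q≡0) , move alt
              where
              move : (Q₄ (P y) ≢ 0# × O₁ (P y)) ⊎ (Q₄ (P y) ≡ 0# × ¬ O₁ (P y)) → (Q₄ (P (f y)) ≢ 0# × O₂ (P (f y))) ⊎ (Q₄ (P (f y)) ≡ 0# × ¬ O₂ (P (f y)))
              move (inj₁ (Q₄≢0 , o)) = inj₁ ((λ p → Q₄≢0 (μσ-zero⁻¹ (trans (sym (Q₄-f y)) p))) , P₂.O-cong (≈-sym (P-f y)) (proj₁ (maps _) o))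
              move (inj₂ (Q₄≡0 , ¬o)) = inj₂ (trans (Q₄-f y) (μσ-zero Q₄≡0) , λ o → ¬o (proj₂ (maps _) (P₂.O-cong (P-f y) o)))
            backward : P₂.InH (f y) → P₁.InH y
            backward (fy≢0 , Q≡0 , alt) = (λ p → fy≢0 (S₆′.f-zero p)) , μσ-zero⁻¹ (trans (sym (Q-f₆ y)) Q≡0) , move alt
              where
              move : (Q₄ (P (f y)) ≢ 0# × O₂ (P (f y))) ⊎ (Q₄ (P (f y)) ≡ 0# × ¬ O₂ (P (f y))) → (Q₄ (P y) ≢ 0# × O₁ (P y)) ⊎ (Q₄ (P y) ≡ 0# × ¬ O₁ (P y))
              move (inj₁ (Q₄≢0 , o)) = inj₁ ((λ p → Q₄≢0 (trans (Q₄-f y) (μσ-zero p))) , proj₂ (maps _) (P₂.O-cong (P-f y) o))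
              move (inj₂ (Q₄≡0 , ¬o)) = inj₂ (μσ-zero⁻¹ (trans (sym (Q₄-f y)) Q₄≡0) , λ o → ¬o (P₂.O-cong (≈-sym (P-f y)) (proj₁ (maps _) o)))

      -- Turning a collineation into a semisimilitude needs one singular point to start from; `z₀`
      -- provides it for Π and `ι z₀` for the whole space.
      module Equivalence {z₀} (z₀≢0 : Nonzero z₀) (Q₄z₀≡0 : Q₄ z₀ ≡ 0#) where

        HO-cong : ∀ {u v} → u ≈ v → P₂.HO u → P₂.HO v
        HO-cong p h = P₂.InH⇒HO (P₂.InH-cong p (P₂.HO⇒InH h))

        equivalence : MapsStabilizing 6 Q P₁.HO P₂.HO ⟺ MapsStabilizing 4 Q₄ O₁ O₂
        equivalence =
          (λ m → let A , f , sim , maps = intertwines {S₁ = P₁.HO} {P₂.HO} isQ nondeg (ι-nonzero z₀≢0) Q₄z₀≡0 m in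
            maps-stabilizing {S₁ = O₁} {O₂} isQ₄ P₂.O-cong (restrict (A , f , sim ,
              λ v → (λ h → P₂.HO⇒InH (proj₁ (maps v) (P₁.InH⇒HO h))) , (λ h → P₁.HO⇒InH (proj₂ (maps v) (P₂.InH⇒HO h)))))) ,
          (λ m → let A , f , sim , maps = extend (intertwines {S₁ = O₁} {O₂} isQ₄ (proj₁ elliptic) z₀≢0 Q₄z₀≡0 m) in
            maps-stabilizing {S₁ = P₁.HO} {P₂.HO} isQ HO-cong (A , f , sim ,
              λ v → (λ h → P₂.InH⇒HO (proj₁ (maps v) (P₁.HO⇒InH h))) , (λ h → P₁.InH⇒HO (proj₂ (maps v) (P₂.HO⇒InH h)))))

theorem4p31 : (q : ℕ) → 2 ∣ q → (F : FiniteField q) →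
    let open Geometry F in
    (Q : V 6 → FiniteField.Carrier F) → PlusType6 Q →
    (E : Matrix 6 4) → (∀ x → apply E x ≈ 0V → x ≈ 0V) →
    Elliptic4 (λ x → Q (apply E x)) →
    (O₁ O₂ : V 4 → Set) →
    IsOvoid (λ x → Q (apply E x)) O₁ → IsOvoid (λ x → Q (apply E x)) O₂ →
    ¬ EqualsQuadric (λ x → Q (apply E x)) O₁ → ¬ EqualsQuadric (λ x → Q (apply E x)) O₂ →
    MapsStabilizing 6 Q (H Q E O₁) (H Q E O₂)
    ⟺ MapsStabilizing 4 (λ x → Q (apply E x)) O₁ O₂
theorem4p31 q 2∣q F Q plus E _ elliptic O₁ O₂ ovoid₁ ovoid₂ _ _ =
  Hyperoval.Pair.Equivalence.equivalence (proj₁ plus) (proj₁ (proj₂ plus)) {Geometry.apply F E} (apply-linear E) elliptic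
    (ConstructSplitting.splitting plus {Geometry.apply F E} (apply-linear E) elliptic) ovoid₁ ovoid₂ {proj₁ singular} (proj₁ (proj₂ singular)) (proj₂ (proj₂ singular))
  where
  open Correspondence 2∣q F
  singular = proj₁ (proj₂ elliptic)
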